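{- Let $q$ be a positive integer, $T$ an abstract group, and $\mathcal{I}=(\rho_1,\ldots,\rho_r)$ an ordered $r$-tuple of (not necessarily distinct) permutation representations of $T$ into $S_q$ (that is, homomorphisms $T\to S_q$). Then the twisted permutation code $C(T,\mathcal{I})$ is a frequency permutation array of length $rq$ (every letter of $\{1,\ldots,q\}$ occurs exactly $r$ times in each codeword) with minimum distance $$\delta_{\mathrm{tw}}:=\delta(C(T,\mathcal{I}))\ \geq\ \delta_{\mathrm{rep}}:=\min_{\rho\in\mathcal{I}}\delta(\mathrm{Rep}_r(C(T,\rho))).$$ Moreover, the following twisted permutation codes have a minimum distance that is strictly greater than this lower bound, i.e. $\delta_{\mathrm{tw}}>\delta_{\mathrm{rep}}$, with the values indicated: (1) $T=S_6$, $r=2$, $q=6$, $\mathcal{I}=(\rho_1,\rho_2)$ with $\rho_1$ the identity map and $\rho_2$ an outer automorphism of $S_6$ with $\rho_2^2=\rho_1$: $\delta_{\mathrm{rep}}=4$, $\delta_{\mathrm{tw}}=8$. (2) $T=A_6$, $r=2$, $q=6$, $\mathcal{I}=(\rho_1,\rho_2)$ with $\rho_1$ the identity map (viewed as a map into $S_6$) and $\rho_2$ an automorphism of $A_6$ (viewed as a map into $S_6$) that is not induced by conjugation by an element of $S_6$ and satisfies $\rho_2^2=\rho_1$: $\delta_{\mathrm{rep}}=6$, $\delta_{\mathrm{tw}}=8$. (3) $T=\mathrm{ASL}(3,2)=\mathrm{AGL}(3,2)$, $r=2$, $q=8$, $\mathcal{I}=(\rho_1,\rho_2)$ with $\rho_1,\rho_2$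 the actions of $T$ on the right cosets of $H_1$ and of $H_2$, where $H_1,H_2$ are representatives of the two $T$-conjugacy classes of complements in $T$ of the translation subgroup: $\delta_{\mathrm{rep}}=8$, $\delta_{\mathrm{tw}}=12$. (4) $T=S_6$, $r=4$, $q=60$, where $H_1,\ldots,H_4$ are representatives of the four conjugacy classes of subgroups of order $12$ in $S_6$, $\rho_i$ is the action of $S_6$ on the right cosets of $H_i$, and $\mathcal{I}$ is a $4$-tuple formed by taking any four elements of $\{\rho_1,\rho_2,\rho_3,\rho_4\}$, repeats allowed: $\delta_{\mathrm{rep}}$ lies in the range $176$ to $192$, and $\delta_{\mathrm{tw}}\leq 224$.
   Context: Let $Q=\{1,\ldots,q\}$ and $S_q=\mathrm{Sym}(Q)$; permutations act on the right, $i\mapsto i^{g}$, and the image of $t\in T$ under $\rho$ is written $t\rho$. The Hamming distance between two tuples of the same length over $Q$ is the number of entries in which they differ. The minimum distance $\delta(C)$ of a code $C$ (a set of tuples of the same length over $Q$) is the smallest Hamming distance between distinct codewords of $C$; if $C$ consists of exactly one codeword, then $\delta(C)=0$. For a homomorphism $\rho:T\to S_q$ and $t\in T$ put $\alpha(t,\rho)=(1^{t\rho},\ldots,q^{t\rho})\in Q^q$ and $C(T,\rho)=\{\alpha(t,\rho):t\in T\}$. For $\mathcal{I}=(\rho_1,\ldots,\rho_r)$ put $\alpha(t,\mathcal{I})=(\alpha(t,\rho_1),\ldots,\alpha(t,\rho_r))\in Q^{rq}$ and $C(T,\mathcal{I})=\{\alpha(t,\mathcal{I}):t\in T\}$; this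 is the twisted permutation code. $\mathrm{Rep}_r(C(T,\rho))$ is the code $\{(\alpha,\ldots,\alpha)\ (r\text{ copies}):\alpha\in C(T,\rho)\}$. Actions on sets of size $q$ are regarded as homomorphisms to $S_q$ by labelling the points with $1,\ldots,q$. In case (4) there are several different repetition codes and several different twisted codes: as the representation(s) vary, the minimum distances of the repetition codes range from $176$ to $192$ and those of the twisted codes range from $176$ to $224$.
   Formalization: The bound δ_tw ≥ δ_rep is proved when all ρ_i have the same kernel (it fails for the two projections of C2×C2 onto S_2: δ_tw=2, δ_rep=4); in (4), δ_tw > δ_rep is stated for non-constant 4-tuples only, since for (ρ_i,ρ_i,ρ_i,ρ_i) the two codes coincide. -}

module Defs where

open import Algebra.Bundles using (Group)
open import Algebra.Morphism.Bundles using (GroupHomomorphism)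
import Algebra.Morphism.Construct.Composition as Composition
import Algebra.Morphism.Construct.Identity as Identity
open import Algebra.Morphism.Structures using (module GroupMorphisms)
import Algebra.Properties.Group as GroupProperties
open import Data.Bool.Base using (Bool; true; false; _xor_; _∧_)
open import Data.Bool.Properties using (xor-assoc; xor-comm; xor-same; xor-identityˡ; xor-identityʳ; ∧-assoc; ∧-distribˡ-xor; ∧-distribʳ-xor; ∧-zeroʳ; ∧-identityʳ)
open import Data.Fin.Base using (Fin)
open import Data.Fin.Permutation as Perm using (Permutation′; _⟨$⟩ʳ_; _⟨$⟩ˡ_; _∘ₚ_)
open import Data.Fin.Permutation.Transposition.List using (TranspositionList; eval)
open import Data.Fin.Properties using (_≟_)
open import Data.List.Base using ([]; _∷_; _++_; length)
open import Data.List.Properties using (length-++)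
open import Data.List.Relation.Unary.All using (All; []; _∷_)
open import Data.List.Relation.Unary.All.Properties using (++⁺)
import Data.Fin.Permutation.Components as PC
open import Data.Nat.Base using (ℕ; zero; suc; _+_; _*_; _≤_; _<_)
open import Data.Nat.Divisibility using (_∣_; ∣m∣n⇒∣m+n; _∣0)
open import Data.Nat.Properties using (+-comm)
open import Data.Product.Base using (Σ; Σ-syntax; ∃-syntax; _×_; _,_; proj₁; proj₂)
open import Data.Sum.Base using (_⊎_)
open import Data.Vec.Base as Vec using (Vec; []; _∷_; tabulate; concat; replicate; zip; zipWith; count)
open import Data.Vec.Functional using (Vector)
open import Data.Vec.Properties using (zipWith-assoc; zipWith-comm; zipWith-identityˡ; zipWith-identityʳ)
open import Function.Base using (_∘_)
open import Function.Bundles using (Inverse; _⇔_)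
open import Level using (Level; 0ℓ; _⊔_) renaming (suc to lsuc)
open import Relation.Binary.Bundles using (Setoid)
open import Relation.Binary.PropositionalEquality.Core using (_≡_; _≢_; refl; sym; trans; cong; cong₂; subst)
open import Relation.Binary.PropositionalEquality.Properties as ≡ using (module ≡-Reasoning)
open import Relation.Nullary.Decidable.Core using (¬?)
open import Relation.Unary using (Pred)

private
  variable
    a c ℓ p : Level
    m n q r : ℕ

------------------------------------------------------------------------
-- Codes

-- A code of length n over the alphabet Q, which is represented by Fin q.
Code : ℕ → ℕ → (a : Level) → Set (lsuc a)
Code q n a = Pred (Vec (Fin q) n) a

hamming : Vec (Fin q) n → Vec (Fin q) n → ℕ
hamming u v = count (λ xy → ¬? (proj₁ xy ≟ proj₂ xy)) (zip u v)

-- "δ(C) = d".  A relation rather than a function: codes are arbitrary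
-- subsets, so the minimum cannot be computed in general.
MinimumDistance : Code q n a → ℕ → Set a
MinimumDistance C d =
    ((∃[ u ] ∃[ v ] (C u × C v × u ≢ v × hamming u v ≡ d))
      × (∀ u v → C u → C v → u ≢ v → d ≤ hamming u v))
  ⊎ ((∃[ u ] (C u × (∀ v → C v → v ≡ u))) × d ≡ 0)

-- Every letter occurs exactly r times in every codeword.
FrequencyPermutationArray : ℕ → Code q n a → Set a
FrequencyPermutationArray r C = ∀ w → C w → ∀ x → count (x ≟_) w ≡ r

Rep : (r : ℕ) → Code q n a → Code q (r * n) a
Rep r C w = ∃[ α ] (C α × w ≡ concat (replicate r α))

------------------------------------------------------------------------
-- The symmetric group, acting on the right: g ∘ₚ h applies g first

flip-cong : {π σ : Permutation′ n} → π Perm.≈ σ → Perm.flip π Perm.≈ Perm.flip σ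
flip-cong {π = π} {σ} π≈σ i = begin
  π ⟨$⟩ˡ i                      ≡⟨ cong (π ⟨$⟩ˡ_) (Perm.inverseʳ σ) ⟨
  π ⟨$⟩ˡ (σ ⟨$⟩ʳ (σ ⟨$⟩ˡ i))    ≡⟨ cong (π ⟨$⟩ˡ_) (π≈σ (σ ⟨$⟩ˡ i)) ⟨
  π ⟨$⟩ˡ (π ⟨$⟩ʳ (σ ⟨$⟩ˡ i))    ≡⟨ Perm.inverseˡ π ⟩
  σ ⟨$⟩ˡ i                      ∎
  where open ≡-Reasoning

Sym : ℕ → Group 0ℓ 0ℓ
Sym n = record
  { Carrier = Permutation′ n
  ; _≈_     = Perm._≈_
  ; _∙_     = _∘ₚ_
  ; ε       = Perm.id
  ; _⁻¹     = Perm.flip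
  ; isGroup = record
    { isMonoid = record
      { isSemigroup = record
        { isMagma = record
          { isEquivalence = record
            { refl  = λ _ → refl
            ; sym   = λ e i → sym (e i)
            ; trans = λ e f i → trans (e i) (f i)
            }
          ; ∙-cong = λ {_} {_} {σ} e f i → trans (cong (σ ⟨$⟩ʳ_) (e i)) (f _)
          }
        ; assoc = λ _ _ _ _ → refl
        }
      ; identity = (λ _ _ → refl) , (λ _ _ → refl)
      }
    ; inverse = (λ π _ → Perm.inverseʳ π) , (λ π _ → Perm.inverseˡ π)
    ; ⁻¹-cong = λ {π} {σ} → flip-cong {π = π} {σ}
    }
  }

Hom : ∀ {c₁ ℓ₁ c₂ ℓ₂} → Group c₁ ℓ₁ → Group c₂ ℓ₂ → Set _
Hom G H = GroupHomomorphism (Group.rawGroup G) (Group.rawGroup H)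

idHom : (G : Group c ℓ) → Hom G G
idHom = Identity.groupHomomorphism

-- First φ, then ψ.
compose : ∀ {c₁ ℓ₁ c₂ ℓ₂ c₃ ℓ₃} (G : Group c₁ ℓ₁) (H : Group c₂ ℓ₂) (K : Group c₃ ℓ₃) →
  Hom G H → Hom H K → Hom G K
compose G H K = Composition.groupHomomorphism {M₁ = G} {H} {K}

PermRep : Group c ℓ → ℕ → Set _
PermRep T q = Hom T (Sym q)

open GroupHomomorphism public using (⟦_⟧)

------------------------------------------------------------------------
-- Twisted permutation codes

module _ (T : Group c ℓ) where

  open Group T using (Carrier)

  α : Carrier → PermRep T q → Vec (Fin q) q
  α t ρ = tabulate (⟦ ρ ⟧ t ⟨$⟩ʳ_)

  permCode : PermRep T q → Code q q c
  permCode ρ w = ∃[ t ] w ≡ α t ρ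

  αs : Carrier → Vector (PermRep T q) r → Vec (Fin q) (r * q)
  αs t I = concat (tabulate (λ i → α t (I i)))

  twistedCode : Vector (PermRep T q) r → Code q (r * q) c
  twistedCode I w = ∃[ t ] w ≡ αs t I

  -- "δ_tw = d"
  δtw≡ : Vector (PermRep T q) r → ℕ → Set c
  δtw≡ I d = MinimumDistance (twistedCode I) d

  -- "δ_rep = d": d is the least of the numbers δ(Rep_r(C(T,ρ))), ρ ∈ I.
  δrep≡ : Vector (PermRep T q) r → ℕ → Set c
  δrep≡ {r = r} I d =
      (∃[ i ] MinimumDistance (Rep r (permCode (I i))) d)
    × (∀ i → ∃[ d′ ] (MinimumDistance (Rep r (permCode (I i))) d′ × d ≤ d′))

  -- For every i and j, ker ρᵢ ⊆ ker ρⱼ; in particular this holds if every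
  -- ρᵢ is faithful.  Without it the bound δ_tw ≥ δ_rep fails: the two
  -- projections of C₂ × C₂ onto S₂ give δ_tw = 2 and δ_rep = 4.
  SameKernel : Vector (PermRep T q) r → Set c
  SameKernel I = ∀ i j t → ⟦ I i ⟧ t Perm.≈ Perm.id → ⟦ I j ⟧ t Perm.≈ Perm.id

  -- The twisted code beats the bound, with δ_rep = d and δ_tw = d′.
  Improves : Vector (PermRep T q) r → ℕ → ℕ → Set c
  Improves I d d′ = δrep≡ I d × δtw≡ I d′ × d < d′

------------------------------------------------------------------------
-- Subgroups

record Subgroup (G : Group c ℓ) (p : Level) : Set (c ⊔ ℓ ⊔ lsuc p) where
  open Group G using (Carrier; _≈_; _∙_; ε; _⁻¹)
  field
    Mem   : Pred Carrier p
    resp  : ∀ {x y} → x ≈ y → Mem x → Mem y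
    ∙-mem : ∀ {x y} → Mem x → Mem y → Mem (x ∙ y)
    ε-mem : Mem ε
    ⁻¹-mem : ∀ {x} → Mem x → Mem (x ⁻¹)

open Subgroup public using (Mem)

module _ {G : Group c ℓ} where

  open Group G renaming (refl to ≈-refl; sym to ≈-sym; trans to ≈-trans)
  open GroupProperties G using (⁻¹-anti-homo-∙; ⁻¹-involutive)

  toGroup : Subgroup G p → Group (c ⊔ p) ℓ
  toGroup H = record
    { Carrier = Σ Carrier (Mem H)
    ; _≈_     = λ x y → proj₁ x ≈ proj₁ y
    ; _∙_     = λ x y → proj₁ x ∙ proj₁ y , ∙-mem (proj₂ x) (proj₂ y)
    ; ε       = ε , ε-mem
    ; _⁻¹     = λ x → proj₁ x ⁻¹ , ⁻¹-mem (proj₂ x)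
    ; isGroup = record
      { isMonoid = record
        { isSemigroup = record
          { isMagma = record
            { isEquivalence = record { refl = ≈-refl ; sym = ≈-sym ; trans = ≈-trans }
            ; ∙-cong = ∙-cong
            }
          ; assoc = λ x y z → assoc (proj₁ x) (proj₁ y) (proj₁ z)
          }
        ; identity = identityˡ ∘ proj₁ , identityʳ ∘ proj₁
        }
      ; inverse = inverseˡ ∘ proj₁ , inverseʳ ∘ proj₁
      ; ⁻¹-cong = ⁻¹-cong
      }
    }
    where open Subgroup H

  inclusion : (H : Subgroup G p) → Hom (toGroup H) G
  inclusion H = record
    { ⟦_⟧ = proj₁
    ; isGroupHomomorphism = record
      { isMonoidHomomorphism = record
        { isMagmaHomomorphism = record
          { isRelHomomorphism = record { cong = λ e → e }
          ; homo = λ _ _ → ≈-refl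
          }
        ; ε-homo = ≈-refl
        }
      ; ⁻¹-homo = λ _ → ≈-refl
      }
    }

  -- K = g⁻¹ H g for some g.
  Conjugate : Subgroup G p → Subgroup G p → Set (c ⊔ p)
  Conjugate H K = ∃[ g ] (∀ x → Mem H x ⇔ Mem K (g ⁻¹ ∙ x ∙ g))

  HasOrder : ℕ → Subgroup G p → Set (c ⊔ ℓ ⊔ p)
  HasOrder n H = Inverse (Group.setoid (toGroup H)) (≡.setoid (Fin n))

  -- H is a complement of N: H ∩ N = 1 and G = HN.
  Complement : Subgroup G p → Subgroup G p → Set (c ⊔ ℓ ⊔ p)
  Complement N H =
      (∀ x → Mem H x → Mem N x → x ≈ ε)
    × (∀ x → ∃[ h ] ∃[ n ] (Mem H h × Mem N n × x ≈ h ∙ n))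

  -- The subgroups with property P form exactly k conjugacy classes, with
  -- representatives H₁, …, H_k.
  ClassRepresentatives : ∀ {b k} → (Subgroup G p → Set b) → Vector (Subgroup G p) k → Set _
  ClassRepresentatives P H =
      (∀ i → P (H i))
    × (∀ i j → Conjugate (H i) (H j) → i ≡ j)
    × (∀ K → P K → ∃[ i ] Conjugate (H i) K)

  -- x and y represent the same right coset, Hx = Hy, iff x y⁻¹ ∈ H.
  RightCosets : Subgroup G p → Setoid c p
  RightCosets H = record
    { Carrier = Carrier
    ; _≈_     = λ x y → Mem H (x ∙ y ⁻¹)
    ; isEquivalence = record
      { refl  = λ {x} → resp (≈-sym (inverseʳ x)) ε-mem
      ; sym   = λ {x} {y} xy⁻¹ → resp
          (≈-trans (⁻¹-anti-homo-∙ x (y ⁻¹)) (∙-congʳ (⁻¹-involutive y)))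
          (⁻¹-mem xy⁻¹)
      ; trans = λ {x} {y} {z} xy⁻¹ yz⁻¹ → resp
          (≈-trans (assoc x (y ⁻¹) (y ∙ z ⁻¹)) (∙-congˡ
            (≈-trans (≈-sym (assoc (y ⁻¹) y (z ⁻¹)))
              (≈-trans (∙-congʳ (inverseˡ y)) (identityˡ (z ⁻¹))))))
          (∙-mem xy⁻¹ yz⁻¹)
      }
    }
    where open Subgroup H

  -- ρ is the action of G on the right cosets of H by Hx ↦ Hxg, after some
  -- labelling of these cosets by the q points.
  CosetAction : Subgroup G p → PermRep G q → Set (c ⊔ p)
  CosetAction {q = q} H ρ =
    Σ[ label ∈ Inverse (RightCosets H) (≡.setoid (Fin q)) ]
      (∀ x g → Inverse.to label (x ∙ g) ≡ ⟦ ρ ⟧ g ⟨$⟩ʳ Inverse.to label x)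

------------------------------------------------------------------------
-- Automorphisms

IsAutomorphism : (G : Group c ℓ) → Hom G G → Set _
IsAutomorphism G φ = GroupMorphisms.IsGroupIsomorphism (Group.rawGroup G) (Group.rawGroup G) ⟦ φ ⟧

SquaresToIdentity : (G : Group c ℓ) → Hom G G → Set _
SquaresToIdentity G φ = ∀ x → Group._≈_ G (⟦ φ ⟧ (⟦ φ ⟧ x)) x

IsInner : (G : Group c ℓ) → Hom G G → Set _
IsInner G φ = ∃[ g ] (∀ x → ⟦ φ ⟧ x ≈ g ⁻¹ ∙ x ∙ g)
  where open Group G

-- φ is induced by conjugation by an element of the overgroup G of H.
InducedByConjugation : {G : Group c ℓ} (H : Subgroup G p) → Hom (toGroup H) (toGroup H) → Set _
InducedByConjugation {G = G} H φ = ∃[ g ] (∀ x → proj₁ (⟦ φ ⟧ x) ≈ g ⁻¹ ∙ proj₁ x ∙ g)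
  where open Group G

------------------------------------------------------------------------
-- The alternating group

-- π is a product of an even number of transpositions.  A TranspositionList
-- may contain pairs (i , i), which evaluate to the identity, so these are
-- excluded.
Even : Pred (Permutation′ n) 0ℓ
Even {n} π = Σ[ ts ∈ TranspositionList n ]
  (All (λ ij → proj₁ ij ≢ proj₂ ij) ts × 2 ∣ length ts × eval ts Perm.≈ π)

eval-++ : (ts us : TranspositionList n) → eval (ts ++ us) Perm.≈ (eval ts ∘ₚ eval us)
eval-++ []             us i = refl
eval-++ ((j , k) ∷ ts) us i = eval-++ ts us (Perm.transpose j k ⟨$⟩ʳ i)

invert : TranspositionList n → TranspositionList n
invert []             = []
invert ((j , k) ∷ ts) = invert ts ++ ((k , j) ∷ [])

length-invert : (ts : TranspositionList n) → length (invert ts) ≡ length ts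
length-invert []       = refl
length-invert ((j , k) ∷ ts) = begin
  length (invert ts ++ ((k , j) ∷ []))  ≡⟨ length-++ (invert ts) ⟩
  length (invert ts) + 1                ≡⟨ cong (_+ 1) (length-invert ts) ⟩
  length ts + 1                         ≡⟨ +-comm (length ts) 1 ⟩
  suc (length ts)                       ∎
  where open ≡-Reasoning

invert-distinct : {ts : TranspositionList n} →
  All (λ ij → proj₁ ij ≢ proj₂ ij) ts → All (λ ij → proj₁ ij ≢ proj₂ ij) (invert ts)
invert-distinct []       = []
invert-distinct (d ∷ ds) = ++⁺ (invert-distinct ds) ((d ∘ sym) ∷ [])

eval-invert : (ts : TranspositionList n) → eval (invert ts) Perm.≈ Perm.flip (eval ts)
eval-invert []             i = refl
eval-invert ((j , k) ∷ ts) i = trans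
  (eval-++ (invert ts) ((k , j) ∷ []) i)
  (cong (PC.transpose k j) (eval-invert ts i))

Alt : (n : ℕ) → Subgroup (Sym n) 0ℓ
Alt n = record
  { Mem    = Even
  ; resp   = λ { π≈σ (ts , ds , ev , e) → ts , ds , ev , (λ i → trans (e i) (π≈σ i)) }
  ; ∙-mem  = λ { {x} {y} (ts , ds , ev , e) (us , ds′ , ev′ , e′) →
      ts ++ us , ++⁺ ds ds′ ,
      subst (2 ∣_) (sym (length-++ ts)) (∣m∣n⇒∣m+n ev ev′) ,
      (λ i → trans (eval-++ ts us i) (trans (cong (eval us ⟨$⟩ʳ_) (e i)) (e′ (x ⟨$⟩ʳ i)))) }
  ; ε-mem  = [] , [] , (2 ∣0) , (λ _ → refl)
  ; ⁻¹-mem = λ { {x} (ts , ds , ev , e) →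
      invert ts , invert-distinct ds , subst (2 ∣_) (sym (length-invert ts)) ev ,
      (λ i → trans (eval-invert ts i) (flip-cong {π = eval ts} {σ = x} e i)) }
  }

------------------------------------------------------------------------
-- Row vectors and matrices over the field of two elements, which is
-- represented by Bool with _xor_ as addition and _∧_ as multiplication

F₂^ : ℕ → Set
F₂^ n = Vec Bool n

Matrix : ℕ → ℕ → Set
Matrix m n = Vec (F₂^ n) m

infixl 6 _⊕_
infixr 8 _·_
infixl 7 _⊛_ _⊠_

_⊕_ : F₂^ n → F₂^ n → F₂^ n
_⊕_ = zipWith _xor_

𝟎 : F₂^ n
𝟎 = replicate _ false

_·_ : Bool → F₂^ n → F₂^ n
b · x = Vec.map (b ∧_) x

_⊛_ : F₂^ m → Matrix m n → F₂^ n
[]      ⊛ []      = 𝟎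
(b ∷ x) ⊛ (v ∷ M) = b · v ⊕ x ⊛ M

_⊠_ : ∀ {k} → Matrix m n → Matrix n k → Matrix m k
M ⊠ N = Vec.map (_⊛ N) M

𝟙 : Matrix n n
𝟙 {zero}  = []
𝟙 {suc n} = (true ∷ 𝟎) ∷ Vec.map (false ∷_) 𝟙

⊕-assoc : (x y z : F₂^ n) → (x ⊕ y) ⊕ z ≡ x ⊕ (y ⊕ z)
⊕-assoc = zipWith-assoc xor-assoc

⊕-comm : (x y : F₂^ n) → x ⊕ y ≡ y ⊕ x
⊕-comm = zipWith-comm xor-comm

⊕-identityˡ : (x : F₂^ n) → 𝟎 ⊕ x ≡ x
⊕-identityˡ = zipWith-identityˡ xor-identityˡ

⊕-identityʳ : (x : F₂^ n) → x ⊕ 𝟎 ≡ x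
⊕-identityʳ = zipWith-identityʳ xor-identityʳ

⊕-self : (x : F₂^ n) → x ⊕ x ≡ 𝟎
⊕-self []      = refl
⊕-self (b ∷ x) = cong₂ _∷_ (xor-same b) (⊕-self x)

⊕-interchange : (w x y z : F₂^ n) → (w ⊕ x) ⊕ (y ⊕ z) ≡ (w ⊕ y) ⊕ (x ⊕ z)
⊕-interchange w x y z = begin
  (w ⊕ x) ⊕ (y ⊕ z)  ≡⟨ ⊕-assoc w x (y ⊕ z) ⟩
  w ⊕ (x ⊕ (y ⊕ z))  ≡⟨ cong (w ⊕_) (⊕-assoc x y z) ⟨
  w ⊕ ((x ⊕ y) ⊕ z)  ≡⟨ cong (λ u → w ⊕ (u ⊕ z)) (⊕-comm x y) ⟩
  w ⊕ ((y ⊕ x) ⊕ z)  ≡⟨ cong (w ⊕_) (⊕-assoc y x z) ⟩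
  w ⊕ (y ⊕ (x ⊕ z))  ≡⟨ ⊕-assoc w y (x ⊕ z) ⟨
  (w ⊕ y) ⊕ (x ⊕ z)  ∎
  where open ≡-Reasoning

·-distribˡ : ∀ b (x y : F₂^ n) → b · (x ⊕ y) ≡ b · x ⊕ b · y
·-distribˡ b []       []       = refl
·-distribˡ b (x ∷ xs) (y ∷ ys) = cong₂ _∷_ (∧-distribˡ-xor b x y) (·-distribˡ b xs ys)

·-distribʳ : ∀ b d (x : F₂^ n) → (b xor d) · x ≡ b · x ⊕ d · x
·-distribʳ b d []       = refl
·-distribʳ b d (x ∷ xs) = cong₂ _∷_ (∧-distribʳ-xor x b d) (·-distribʳ b d xs)

·-assoc : ∀ b d (x : F₂^ n) → (b ∧ d) · x ≡ b · (d · x)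
·-assoc b d []       = refl
·-assoc b d (x ∷ xs) = cong₂ _∷_ (∧-assoc b d x) (·-assoc b d xs)

·-𝟎 : ∀ b → b · 𝟎 {n} ≡ 𝟎
·-𝟎 {zero}  b = refl
·-𝟎 {suc n} b = cong₂ _∷_ (∧-zeroʳ b) (·-𝟎 b)

true-· : (x : F₂^ n) → true · x ≡ x
true-· []      = refl
true-· (_ ∷ x) = cong (_ ∷_) (true-· x)

false-· : (x : F₂^ n) → false · x ≡ 𝟎
false-· []      = refl
false-· (_ ∷ x) = cong (false ∷_) (false-· x)

⊛-⊕ : (x y : F₂^ m) (M : Matrix m n) → (x ⊕ y) ⊛ M ≡ x ⊛ M ⊕ y ⊛ M
⊛-⊕ []      []      []      = sym (⊕-identityˡ 𝟎)
⊛-⊕ (a ∷ x) (b ∷ y) (v ∷ M) = trans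
  (cong₂ _⊕_ (·-distribʳ a b v) (⊛-⊕ x y M))
  (⊕-interchange (a · v) (b · v) (x ⊛ M) (y ⊛ M))

⊛-· : ∀ b (x : F₂^ m) (M : Matrix m n) → (b · x) ⊛ M ≡ b · (x ⊛ M)
⊛-· b []      []      = sym (·-𝟎 b)
⊛-· b (a ∷ x) (v ∷ M) = trans
  (cong₂ _⊕_ (·-assoc b a v) (⊛-· b x M))
  (sym (·-distribˡ b (a · v) (x ⊛ M)))

𝟎-⊛ : (M : Matrix m n) → 𝟎 ⊛ M ≡ 𝟎
𝟎-⊛ []      = refl
𝟎-⊛ (v ∷ M) = trans (cong₂ _⊕_ (false-· v) (𝟎-⊛ M)) (⊕-identityˡ 𝟎)

⊛-⊠ : ∀ {k} (x : F₂^ m) (M : Matrix m n) (N : Matrix n k) → x ⊛ (M ⊠ N) ≡ (x ⊛ M) ⊛ N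
⊛-⊠ []      []      N = sym (𝟎-⊛ N)
⊛-⊠ (b ∷ x) (v ∷ M) N = begin
  b · (v ⊛ N) ⊕ x ⊛ (M ⊠ N)    ≡⟨ cong₂ _⊕_ (sym (⊛-· b v N)) (⊛-⊠ x M N) ⟩
  (b · v) ⊛ N ⊕ (x ⊛ M) ⊛ N    ≡⟨ ⊛-⊕ (b · v) (x ⊛ M) N ⟨
  (b · v ⊕ x ⊛ M) ⊛ N          ∎
  where open ≡-Reasoning

⊠-assoc : ∀ {k l} (L : Matrix m n) (M : Matrix n k) (N : Matrix k l) →
  (L ⊠ M) ⊠ N ≡ L ⊠ (M ⊠ N)
⊠-assoc []      M N = refl
⊠-assoc (x ∷ L) M N = cong₂ _∷_ (sym (⊛-⊠ x M N)) (⊠-assoc L M N)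

⊛-false∷ : (x : F₂^ m) (M : Matrix m n) → x ⊛ Vec.map (false ∷_) M ≡ false ∷ (x ⊛ M)
⊛-false∷ []      []      = refl
⊛-false∷ (b ∷ x) (v ∷ M) = trans
  (cong (b · (false ∷ v) ⊕_) (⊛-false∷ x M))
  (cong (_∷ (b · v ⊕ x ⊛ M)) (trans (xor-identityʳ (b ∧ false)) (∧-zeroʳ b)))

⊛-𝟙 : (x : F₂^ n) → x ⊛ 𝟙 ≡ x
⊛-𝟙 []      = refl
⊛-𝟙 (b ∷ x) = begin
  b · (true ∷ 𝟎) ⊕ x ⊛ Vec.map (false ∷_) 𝟙  ≡⟨ cong (b · (true ∷ 𝟎) ⊕_) (⊛-false∷ x 𝟙) ⟩
  b · (true ∷ 𝟎) ⊕ (false ∷ x ⊛ 𝟙)           ≡⟨ cong₂ _∷_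
                                                 (trans (xor-identityʳ (b ∧ true)) (∧-identityʳ b))
                                                 (trans (cong₂ _⊕_ (·-𝟎 b) (⊛-𝟙 x)) (⊕-identityˡ x)) ⟩
  b ∷ x                                       ∎
  where open ≡-Reasoning

⊠-identityʳ : (M : Matrix m n) → M ⊠ 𝟙 ≡ M
⊠-identityʳ []      = refl
⊠-identityʳ (x ∷ M) = cong₂ _∷_ (⊛-𝟙 x) (⊠-identityʳ M)

false∷-⊠ : ∀ {k} (L : Matrix m n) (v : F₂^ k) (M : Matrix n k) →
  Vec.map (false ∷_) L ⊠ (v ∷ M) ≡ L ⊠ M
false∷-⊠ []      v M = refl
false∷-⊠ (x ∷ L) v M = cong₂ _∷_
  (trans (cong (_⊕ x ⊛ M) (false-· v)) (⊕-identityˡ (x ⊛ M)))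
  (false∷-⊠ L v M)

⊠-identityˡ : (M : Matrix m n) → 𝟙 ⊠ M ≡ M
⊠-identityˡ []      = refl
⊠-identityˡ (v ∷ M) = cong₂ _∷_
  (trans (cong₂ _⊕_ (true-· v) (𝟎-⊛ M)) (⊕-identityʳ v))
  (trans (false∷-⊠ 𝟙 v M) (⊠-identityˡ M))

⊠-inverse-unique : {M N M′ N′ : Matrix n n} →
  N ⊠ M ≡ 𝟙 → M′ ⊠ N′ ≡ 𝟙 → M ≡ M′ → N ≡ N′
⊠-inverse-unique {M = M} {N} {M′} {N′} NM M′N′ M≡M′ = begin
  N              ≡⟨ ⊠-identityʳ N ⟨
  N ⊠ 𝟙          ≡⟨ cong (N ⊠_) M′N′ ⟨
  N ⊠ (M′ ⊠ N′)  ≡⟨ ⊠-assoc N M′ N′ ⟨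
  (N ⊠ M′) ⊠ N′  ≡⟨ cong (λ L → (N ⊠ L) ⊠ N′) M≡M′ ⟨
  (N ⊠ M) ⊠ N′   ≡⟨ cong (_⊠ N′) NM ⟩
  𝟙 ⊠ N′         ≡⟨ ⊠-identityˡ N′ ⟩
  N′             ∎
  where open ≡-Reasoning

⊠-cancel-middle : {L M N K : Matrix n n} → M ⊠ N ≡ 𝟙 → L ⊠ K ≡ 𝟙 → (L ⊠ M) ⊠ (N ⊠ K) ≡ 𝟙
⊠-cancel-middle {L = L} {M} {N} {K} MN LK = begin
  (L ⊠ M) ⊠ (N ⊠ K)  ≡⟨ ⊠-assoc L M (N ⊠ K) ⟩
  L ⊠ (M ⊠ (N ⊠ K))  ≡⟨ cong (L ⊠_) (⊠-assoc M N K) ⟨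
  L ⊠ ((M ⊠ N) ⊠ K)  ≡⟨ cong (λ J → L ⊠ (J ⊠ K)) MN ⟩
  L ⊠ (𝟙 ⊠ K)        ≡⟨ cong (L ⊠_) (⊠-identityˡ K) ⟩
  L ⊠ K              ≡⟨ LK ⟩
  𝟙                  ∎
  where open ≡-Reasoning

------------------------------------------------------------------------
-- AGL(n,2)

-- The affine transformation x ↦ x M + v of the row space, M invertible.
record Affine (n : ℕ) : Set where
  field
    matrix  : Matrix n n
    matrix⁻ : Matrix n n
    shift   : F₂^ n
    rightInverse : matrix ⊠ matrix⁻ ≡ 𝟙
    leftInverse  : matrix⁻ ⊠ matrix ≡ 𝟙

open Affine

AGL₂ : ℕ → Group 0ℓ 0ℓ
AGL₂ n = record
  { Carrier = Affine n
  ; _≈_     = λ f g → matrix f ≡ matrix g × shift f ≡ shift g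
  -- First f, then g: (x M + v) N + w = x (M N) + (v N + w).
  ; _∙_     = λ f g → record
      { matrix  = matrix f ⊠ matrix g
      ; matrix⁻ = matrix⁻ g ⊠ matrix⁻ f
      ; shift   = shift f ⊛ matrix g ⊕ shift g
      ; rightInverse = ⊠-cancel-middle (rightInverse g) (rightInverse f)
      ; leftInverse  = ⊠-cancel-middle (leftInverse f) (leftInverse g)
      }
  ; ε       = record
      { matrix = 𝟙 ; matrix⁻ = 𝟙 ; shift = 𝟎
      ; rightInverse = ⊠-identityˡ 𝟙 ; leftInverse = ⊠-identityˡ 𝟙 }
  -- The shift of the inverse is - v M⁻¹ = v M⁻¹.
  ; _⁻¹     = λ f → record
      { matrix = matrix⁻ f ; matrix⁻ = matrix f ; shift = shift f ⊛ matrix⁻ f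
      ; rightInverse = leftInverse f ; leftInverse = rightInverse f }
  ; isGroup = record
    { isMonoid = record
      { isSemigroup = record
        { isMagma = record
          { isEquivalence = record
            { refl  = refl , refl
            ; sym   = λ (e , e′) → sym e , sym e′
            ; trans = λ (e , e′) (d , d′) → trans e d , trans e′ d′
            }
          ; ∙-cong = λ (e , e′) (d , d′) →
              cong₂ _⊠_ e d , cong₂ _⊕_ (cong₂ _⊛_ e′ d) d′
          }
        ; assoc = λ f g h → ⊠-assoc (matrix f) (matrix g) (matrix h) , (begin
            (shift f ⊛ matrix g ⊕ shift g) ⊛ matrix h ⊕ shift h
              ≡⟨ cong (_⊕ shift h) (⊛-⊕ (shift f ⊛ matrix g) (shift g) (matrix h)) ⟩
            ((shift f ⊛ matrix g) ⊛ matrix h ⊕ shift g ⊛ matrix h) ⊕ shift h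
              ≡⟨ ⊕-assoc _ (shift g ⊛ matrix h) (shift h) ⟩
            (shift f ⊛ matrix g) ⊛ matrix h ⊕ (shift g ⊛ matrix h ⊕ shift h)
              ≡⟨ cong (_⊕ (shift g ⊛ matrix h ⊕ shift h)) (⊛-⊠ (shift f) (matrix g) (matrix h)) ⟨
            shift f ⊛ (matrix g ⊠ matrix h) ⊕ (shift g ⊛ matrix h ⊕ shift h) ∎)
        }
      ; identity =
          (λ f → ⊠-identityˡ (matrix f) ,
            trans (cong (_⊕ shift f) (𝟎-⊛ (matrix f))) (⊕-identityˡ (shift f)))
        , (λ f → ⊠-identityʳ (matrix f) ,
            trans (⊕-identityʳ _) (⊛-𝟙 (shift f)))
      }
    ; inverse =
        (λ f → leftInverse f , (begin
          (shift f ⊛ matrix⁻ f) ⊛ matrix f ⊕ shift f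
            ≡⟨ cong (_⊕ shift f) (⊛-⊠ (shift f) (matrix⁻ f) (matrix f)) ⟨
          shift f ⊛ (matrix⁻ f ⊠ matrix f) ⊕ shift f
            ≡⟨ cong (λ M → shift f ⊛ M ⊕ shift f) (leftInverse f) ⟩
          shift f ⊛ 𝟙 ⊕ shift f
            ≡⟨ cong (_⊕ shift f) (⊛-𝟙 (shift f)) ⟩
          shift f ⊕ shift f
            ≡⟨ ⊕-self (shift f) ⟩
          𝟎 ∎))
      , (λ f → rightInverse f , ⊕-self _)
    ; ⁻¹-cong = λ {f} {g} (e , e′) →
        let e⁻ = ⊠-inverse-unique {M = matrix f} {matrix⁻ f} {matrix g} {matrix⁻ g}
                   (leftInverse f) (rightInverse g) e
        in e⁻ , cong₂ _⊛_ e′ e⁻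
    }
  }
  where open ≡-Reasoning

Translations : (n : ℕ) → Subgroup (AGL₂ n) 0ℓ
Translations n = record
  { Mem    = λ f → matrix f ≡ 𝟙
  ; resp   = λ (e , _) f∈ → trans (sym e) f∈
  ; ∙-mem  = λ f∈ g∈ → trans (cong₂ _⊠_ f∈ g∈) (⊠-identityˡ 𝟙)
  ; ε-mem  = refl
  ; ⁻¹-mem = λ {f} f∈ → sym (⊠-inverse-unique {M = 𝟙} {𝟙} {matrix f} {matrix⁻ f}
               (⊠-identityˡ 𝟙) (rightInverse f) (sym f∈))
  }

{-# OPTIONS --safe #-}
module Submission where

-- Two codewords of a twisted code have as distance the total number of points
-- moved by ts⁻¹ in the r actions, so all minimum distances are minima, over
-- t ≠ 1, of sums of class functions "number of points moved by t".
--
-- In S₆ and A₆ an automorphism σ that maps one 3-cycle to a 3-cycle is induced by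
-- S₆: the 3-cycles (0 1 i) generate A₆, their pairwise products have order 2, and
-- any such quadruple of 3-cycles is conjugate to the standard one.  Otherwise σ
-- exchanges the two classes of elements of order 3, and the orders of the elements
-- determine enough of the number of points moved by σ(t) on each class.
--
-- For coset actions only the characters matter.  It suffices to exhibit as many
-- subgroups of the required kind as there are classes, with distinct characters:
-- these represent all the classes, whatever the given representatives are.  For
-- AGL(3,2) they are the graphs of the zero cocycle and of a cocycle on GL(3,2) that
-- is not a coboundary.

open import Defs
open import Algebra.Bundles using (Group)
open import Algebra.Morphism.Bundles using (GroupHomomorphism)
open import Algebra.Morphism.Structures using (module GroupMorphisms)
import Algebra.Properties.CommutativeMonoid.Sum
import Algebra.Properties.Group as GroupProperties
import Algebra.Properties.Semiring.Sum
open import Data.Bool.Base using (Bool; true; false; if_then_else_; _∧_; not; _xor_)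
import Data.Bool.Properties as Bool
open import Data.Fin.Base using (Fin; zero; suc; punchOut)
open import Data.Fin.Patterns
open import Data.Fin.Permutation as Perm using (Permutation′; _⟨$⟩ʳ_; _⟨$⟩ˡ_; _∘ₚ_; transpose)
open import Data.Fin.Permutation.Transposition.List using (TranspositionList; eval; decompose; eval-decompose)
open import Data.Fin.Properties using (_≟_; _<?_; all?; any?; injective⇒≤; punchOut-injective; suc-injective)
open import Data.List.Base as List using (List; []; _∷_; _++_; length; allFin)
open import Data.List.Properties using (length-++)
open import Data.List.Relation.Unary.All using (All; []; _∷_)
open import Data.List.Relation.Unary.All.Properties using (++⁺)
open import Data.Maybe.Base using (Maybe; just; nothing; fromMaybe)
open import Data.Nat.Base using (ℕ; zero; suc; _+_; _*_; _≤_; _<_; z≤n; s≤s; NonZero; >-nonZero⁻¹)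
open import Data.Nat.Divisibility using (_∣_; _∣?_; ∣m+n∣m⇒∣n; ∣m∣n⇒∣m+n; ∣-refl)
open import Data.Nat.DivMod using (_/_; _%_; _mod_)
import Data.Nat.Properties as ℕ
open import Data.Product.Base using (Σ-syntax; ∃-syntax; _×_; _,_; proj₁; proj₂; map₂)
open import Data.Sum.Base using (_⊎_; inj₁; inj₂)
open import Data.Vec.Base as Vec using (Vec; []; _∷_; tabulate; concat; replicate; zip; count; lookup)
open import Data.Vec.Functional as Vector using (Vector)
open import Data.Vec.Properties using (≡-dec; lookup-map; lookup-replicate; lookup∘tabulate; tabulate-cong; tabulate-∘)
open import Function.Base using (_∘_; const)
open import Function.Bundles using (Inverse; Equivalence)
open import Level using (Level; 0ℓ)
open import Relation.Binary.Bundles using (Setoid)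
open import Relation.Binary.PropositionalEquality.Core using (_≡_; _≢_; refl; sym; trans; cong; cong₂; subst)
open import Relation.Binary.PropositionalEquality.Properties using (module ≡-Reasoning)
open import Relation.Nullary.Decidable using (Dec; yes; no; does; ¬?; _×-dec_; _⊎-dec_; _→-dec_; from-yes; from-no; dec-true; dec-false)
open import Relation.Nullary.Negation.Core using (¬_; contradiction)
open import Relation.Unary using (Pred; Decidable; _≐_)

open Algebra.Properties.CommutativeMonoid.Sum ℕ.+-0-commutativeMonoid
  using (sum; sum-cong-≗; sum-permute; sum-replicate-zero; ∑-distrib-+)
open Algebra.Properties.Semiring.Sum ℕ.+-*-semiring using (*-distribˡ-sum)
open Affine

private
  variable
    ℓa ℓb ℓc ℓ p : Level
    A : Set ℓa
    m n q r : ℕ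

-- The automorphisms in (1) and (2) are arbitrary, so none of their values is available for
-- computation. What transfers is the order of an element and, for double transpositions, the
-- property of being the square of an element of order 4; this property yields the exact value 4 + 4
-- = 8, which attains the minimum in A₆. Transpositions need an argument of their own in S₆, because
-- their order does not tell them apart from the involutions that move four or six points. The
-- enumerations over all of S₆ run on words, that is, vectors of points, and are sealed by `opaque`
-- so that they are not evaluated again later.

indicator : Bool → ℕ
indicator b = if b then 1 else 0

sum-mono : {f g : Vector ℕ n} → (∀ i → f i ≤ g i) → sum f ≤ sum g
sum-mono {zero}  f≤g = z≤n
sum-mono {suc n} f≤g = ℕ.+-mono-≤ (f≤g zero) (sum-mono (f≤g ∘ suc))

sum-const : ∀ n k → sum {n} (const k) ≡ n * k
sum-const zero    k = refl
sum-const (suc n) k = cong (k +_) (sum-const n k)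

sum≡0⇒≡0 : (f : Vector ℕ n) → sum f ≡ 0 → ∀ i → f i ≡ 0
sum≡0⇒≡0 f ∑f≡0 zero    = ℕ.m+n≡0⇒m≡0 (f zero) ∑f≡0
sum≡0⇒≡0 f ∑f≡0 (suc i) = sum≡0⇒≡0 (f ∘ suc) (ℕ.m+n≡0⇒n≡0 (f zero) ∑f≡0) i

-- Hamming distances

module _ {P : Pred A p} (P? : Decidable P) where

  count-∷ : ∀ x (xs : Vec A n) → count P? (x ∷ xs) ≡ indicator (does (P? x)) + count P? xs
  count-∷ x xs with does (P? x)
  ... | true  = refl
  ... | false = refl

  count-++ : (xs : Vec A m) (ys : Vec A n) → count P? (xs Vec.++ ys) ≡ count P? xs + count P? ys
  count-++ []       ys = refl
  count-++ (x ∷ xs) ys with does (P? x)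
  ... | true  = cong suc (count-++ xs ys)
  ... | false = count-++ xs ys

  count-tabulate : (f : Fin n → A) → count P? (tabulate f) ≡ sum (indicator ∘ does ∘ P? ∘ f)
  count-tabulate {n = zero}  f = refl
  count-tabulate {n = suc n} f = trans
    (count-∷ (f zero) (tabulate (f ∘ suc)))
    (cong (indicator (does (P? (f zero))) +_) (count-tabulate (f ∘ suc)))

  count-concat : (F : Fin m → Vec A n) → count P? (concat (tabulate F)) ≡ sum (count P? ∘ F)
  count-concat {m = zero}  F = refl
  count-concat {m = suc m} F = trans
    (count-++ (F zero) (concat (tabulate (F ∘ suc))))
    (cong (count P? (F zero) +_) (count-concat (F ∘ suc)))

differ : Fin q → Fin q → ℕ
differ x y = indicator (does (¬? (x ≟ y)))

differ-refl : (x : Fin q) → differ x x ≡ 0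
differ-refl x rewrite dec-true (x ≟ x) refl = refl

differ≡0⇒≡ : (x y : Fin q) → differ x y ≡ 0 → x ≡ y
differ≡0⇒≡ x y with x ≟ y
... | yes x≡y = λ _ → x≡y
... | no  x≢y = λ ()

hamming-∷ : ∀ x y (u v : Vec (Fin q) n) → hamming (x ∷ u) (y ∷ v) ≡ differ x y + hamming u v
hamming-∷ x y u v = count-∷ _ (x , y) (zip u v)

hamming-++ : (u v : Vec (Fin q) m) (u′ v′ : Vec (Fin q) n) →
  hamming (u Vec.++ u′) (v Vec.++ v′) ≡ hamming u v + hamming u′ v′
hamming-++ []      []      u′ v′ = refl
hamming-++ (x ∷ u) (y ∷ v) u′ v′ = begin
  hamming (x ∷ u Vec.++ u′) (y ∷ v Vec.++ v′)      ≡⟨ hamming-∷ x y (u Vec.++ u′) (v Vec.++ v′) ⟩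
  differ x y + hamming (u Vec.++ u′) (v Vec.++ v′) ≡⟨ cong (differ x y +_) (hamming-++ u v u′ v′) ⟩
  differ x y + (hamming u v + hamming u′ v′)       ≡⟨ ℕ.+-assoc (differ x y) (hamming u v) (hamming u′ v′) ⟨
  differ x y + hamming u v + hamming u′ v′         ≡⟨ cong (_+ hamming u′ v′) (hamming-∷ x y u v) ⟨
  hamming (x ∷ u) (y ∷ v) + hamming u′ v′          ∎
  where open ≡-Reasoning

hamming-tabulate : (f g : Fin n → Fin q) →
  hamming (tabulate f) (tabulate g) ≡ sum (λ i → differ (f i) (g i))
hamming-tabulate {n = zero}  f g = refl
hamming-tabulate {n = suc n} f g = trans
  (hamming-∷ (f zero) (g zero) (tabulate (f ∘ suc)) (tabulate (g ∘ suc)))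
  (cong (differ (f zero) (g zero) +_) (hamming-tabulate (f ∘ suc) (g ∘ suc)))

hamming-concat : (F G : Fin m → Vec (Fin q) n) →
  hamming (concat (tabulate F)) (concat (tabulate G)) ≡ sum (λ i → hamming (F i) (G i))
hamming-concat {m = zero}  F G = refl
hamming-concat {m = suc m} F G = trans
  (hamming-++ (F zero) (G zero) (concat (tabulate (F ∘ suc))) (concat (tabulate (G ∘ suc))))
  (cong (hamming (F zero) (G zero) +_) (hamming-concat (F ∘ suc) (G ∘ suc)))

hamming-self : (u : Vec (Fin q) n) → hamming u u ≡ 0
hamming-self []      = refl
hamming-self (x ∷ u) = trans (hamming-∷ x x u u) (cong₂ _+_ (differ-refl x) (hamming-self u))

hamming≡0⇒≡ : (u v : Vec (Fin q) n) → hamming u v ≡ 0 → u ≡ v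
hamming≡0⇒≡ []      []      _ = refl
hamming≡0⇒≡ (x ∷ u) (y ∷ v) e = cong₂ _∷_
  (differ≡0⇒≡ x y (ℕ.m+n≡0⇒m≡0 (differ x y) e′))
  (hamming≡0⇒≡ u v (ℕ.m+n≡0⇒n≡0 (differ x y) e′))
  where e′ = trans (sym (hamming-∷ x y u v)) e

MinimumDistance-resp-≐ : {C : Code q n ℓa} {D : Code q n ℓb} {d : ℕ} →
  C ≐ D → MinimumDistance C d → MinimumDistance D d
MinimumDistance-resp-≐ (C⊆D , D⊆C) (inj₁ ((u , v , u∈ , v∈ , u≢v , e) , min)) =
  inj₁ ((u , v , C⊆D u∈ , C⊆D v∈ , u≢v , e) , λ u v u∈ v∈ → min u v (D⊆C u∈) (D⊆C v∈))
MinimumDistance-resp-≐ (C⊆D , D⊆C) (inj₂ ((u , u∈ , uniq) , e)) =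
  inj₂ ((u , C⊆D u∈ , λ v v∈ → uniq v (D⊆C v∈)) , e)

-- Permutations

moved : Permutation′ n → ℕ
moved π = sum (λ i → differ (π ⟨$⟩ʳ i) i)

moved-cong : (π σ : Permutation′ n) → π Perm.≈ σ → moved π ≡ moved σ
moved-cong π σ π≈σ = sum-cong-≗ (λ i → cong (λ x → differ x i) (π≈σ i))

moved-id : moved (Perm.id {n}) ≡ 0
moved-id {n} = trans (sum-cong-≗ {n} differ-refl) (sum-replicate-zero n)

moved≡0⇒≈id : (π : Permutation′ n) → moved π ≡ 0 → π Perm.≈ Perm.id
moved≡0⇒≈id π e i = differ≡0⇒≡ (π ⟨$⟩ʳ i) i (sum≡0⇒≡0 (λ j → differ (π ⟨$⟩ʳ j) j) e i)

differ-cong-⇔ : {x y : Fin m} {x′ y′ : Fin n} → (x ≡ y → x′ ≡ y′) → (x′ ≡ y′ → x ≡ y) →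
  differ x y ≡ differ x′ y′
differ-cong-⇔ {x = x} {y} {x′} {y′} to from with x ≟ y | x′ ≟ y′
... | yes _   | yes _     = refl
... | no _    | no _      = refl
... | yes x≡y | no x′≢y′  = contradiction (to x≡y) x′≢y′
... | no x≢y  | yes x′≡y′ = contradiction (from x′≡y′) x≢y

injective : (π : Permutation′ n) {i j : Fin n} → π ⟨$⟩ʳ i ≡ π ⟨$⟩ʳ j → i ≡ j
injective π {i} {j} e = trans (sym (Perm.inverseˡ π)) (trans (cong (π ⟨$⟩ˡ_) e) (Perm.inverseˡ π))

differ-triangle : (x y z : Fin q) → differ x z ≤ differ x y + differ y z
differ-triangle x y z with x ≟ y
... | yes refl = ℕ.≤-refl
... | no _ with x ≟ z
...   | yes _ = z≤n
...   | no _  = s≤s z≤n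

-- Triangle inequality along the path from i over its image under `π` to the image of that under
-- `σ`; reindexing by `π` turns the sum over the second steps into `moved σ`.
moved-∘ₚ : (π σ : Permutation′ n) → moved (π ∘ₚ σ) ≤ moved π + moved σ
moved-∘ₚ π σ = begin
  sum (λ i → differ (σ ⟨$⟩ʳ (π ⟨$⟩ʳ i)) i)
    ≤⟨ sum-mono (λ i → differ-triangle (σ ⟨$⟩ʳ (π ⟨$⟩ʳ i)) (π ⟨$⟩ʳ i) i) ⟩
  sum (λ i → differ (σ ⟨$⟩ʳ (π ⟨$⟩ʳ i)) (π ⟨$⟩ʳ i) + differ (π ⟨$⟩ʳ i) i)
    ≡⟨ ∑-distrib-+ (λ i → differ (σ ⟨$⟩ʳ (π ⟨$⟩ʳ i)) (π ⟨$⟩ʳ i)) (λ i → differ (π ⟨$⟩ʳ i) i) ⟩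
  sum (λ i → differ (σ ⟨$⟩ʳ (π ⟨$⟩ʳ i)) (π ⟨$⟩ʳ i)) + moved π
    ≡⟨ cong (_+ moved π) (sum-permute (λ i → differ (σ ⟨$⟩ʳ i) i) π) ⟨
  moved σ + moved π
    ≡⟨ ℕ.+-comm (moved σ) (moved π) ⟩
  moved π + moved σ ∎
  where open ℕ.≤-Reasoning

moved-conjugate : (π σ : Permutation′ n) → moved ((Perm.flip π ∘ₚ σ) ∘ₚ π) ≡ moved σ
moved-conjugate π σ = trans
  (sum-permute (λ i → differ (((Perm.flip π ∘ₚ σ) ∘ₚ π) ⟨$⟩ʳ i) i) π)
  (sum-cong-≗ (λ i → trans
    (cong (λ x → differ (π ⟨$⟩ʳ (σ ⟨$⟩ʳ x)) (π ⟨$⟩ʳ i)) (Perm.inverseˡ π))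
    (differ-cong-⇔ (injective π) (cong (π ⟨$⟩ʳ_)))))

-- Pigeonhole: if `y` were missed, punching it out would leave an injection into a set with one
-- point fewer.
injective⇒surjective : (f : Fin n → Fin n) → (∀ {i j} → f i ≡ f j → i ≡ j) →
  ∀ y → ∃[ x ] f x ≡ y
injective⇒surjective {suc n} f f-inj y with any? (λ x → f x ≟ y)
... | yes hit = hit
... | no miss = contradiction
  (injective⇒≤ {f = λ x → punchOut {i = y} (λ e → miss (x , sym e))}
    (λ e → f-inj (punchOut-injective (λ e′ → miss (_ , sym e′)) (λ e′ → miss (_ , sym e′)) e)))
  ℕ.1+n≰n

injective⇒permutation : (f : Fin n → Fin n) → (∀ {i j} → f i ≡ f j → i ≡ j) → Permutation′ n
injective⇒permutation f f-inj = Perm.permutation f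
  (proj₁ ∘ injective⇒surjective f f-inj)
  (proj₂ ∘ injective⇒surjective f f-inj)
  (λ x → f-inj (proj₂ (injective⇒surjective f f-inj (f x))))

sum-differ : (x : Fin n) → sum (λ j → indicator (does (x ≟ j))) ≡ 1
sum-differ {suc n} zero    = cong suc (sum-replicate-zero n)
sum-differ {suc n} (suc x) = sum-differ x

-- Twisted permutation codes

module _ {T : Group ℓc ℓ} where

  open Group T using (Carrier; _≈_; _∙_; ε; _⁻¹)

  weight : Vector (PermRep T q) r → Carrier → ℕ
  weight I t = sum (λ i → moved (⟦ I i ⟧ t))

  -- The codewords agree at position i iff `t` and `s` send i to the same point, that is, iff
  -- `t ∙ s ⁻¹` fixes i.
  hamming-α : (ρ : PermRep T q) (t s : Carrier) →
    hamming (α T t ρ) (α T s ρ) ≡ moved (⟦ ρ ⟧ (t ∙ s ⁻¹))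
  hamming-α ρ t s = trans
    (hamming-tabulate (⟦ ρ ⟧ t ⟨$⟩ʳ_) (⟦ ρ ⟧ s ⟨$⟩ʳ_))
    (sum-cong-≗ (λ i → differ-cong-⇔
      (λ e → trans (ts⁻¹ i) (trans (cong (⟦ ρ ⟧ s ⟨$⟩ˡ_) e) (Perm.inverseˡ (⟦ ρ ⟧ s))))
      (λ e → trans (sym (Perm.inverseʳ (⟦ ρ ⟧ s)))
               (cong (⟦ ρ ⟧ s ⟨$⟩ʳ_) (trans (sym (ts⁻¹ i)) e)))))
    where
    ts⁻¹ : ∀ i → ⟦ ρ ⟧ (t ∙ s ⁻¹) ⟨$⟩ʳ i ≡ ⟦ ρ ⟧ s ⟨$⟩ˡ (⟦ ρ ⟧ t ⟨$⟩ʳ i)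
    ts⁻¹ i = trans (GroupHomomorphism.homo ρ t (s ⁻¹) i)
                   (GroupHomomorphism.⁻¹-homo ρ s (⟦ ρ ⟧ t ⟨$⟩ʳ i))

  hamming-αs : (I : Vector (PermRep T q) r) (t s : Carrier) →
    hamming (αs T t I) (αs T s I) ≡ weight I (t ∙ s ⁻¹)
  hamming-αs I t s = trans
    (hamming-concat (λ i → α T t (I i)) (λ i → α T s (I i)))
    (sum-cong-≗ (λ i → hamming-α (I i) t s))

  weight-cong : (I : Vector (PermRep T q) r) {t s : Carrier} → t ≈ s → weight I t ≡ weight I s
  weight-cong I {t} {s} t≈s = sum-cong-≗ (λ i → moved-cong (⟦ I i ⟧ t) (⟦ I i ⟧ s) (GroupHomomorphism.⟦⟧-cong (I i) t≈s))

  weight-ε : (I : Vector (PermRep T q) r) → weight I ε ≡ 0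
  weight-ε {q = q} {r = r} I = trans
    (sum-cong-≗ {r} (λ i → trans (moved-cong (⟦ I i ⟧ ε) Perm.id (GroupHomomorphism.ε-homo (I i))) (moved-id {q})))
    (sum-replicate-zero r)

  hamming-αs-ε : (I : Vector (PermRep T q) r) (t : Carrier) →
    hamming (αs T t I) (αs T ε I) ≡ weight I t
  hamming-αs-ε I t = trans (hamming-αs I t ε)
    (weight-cong I (Group.trans T (Group.∙-congˡ T (GroupProperties.ε⁻¹≈ε T)) (Group.identityʳ T t)))

  αs-separated : (I : Vector (PermRep T q) r) (t : Carrier) → 0 < weight I t → αs T t I ≢ αs T ε I
  αs-separated I t 0<w e = ℕ.<⇒≢ 0<w (begin
    0                                   ≡⟨ hamming-self (αs T t I) ⟨
    hamming (αs T t I) (αs T t I)       ≡⟨ cong (hamming (αs T t I)) e ⟩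
    hamming (αs T t I) (αs T ε I)       ≡⟨ hamming-αs-ε I t ⟩
    weight I t                          ∎)
    where open ≡-Reasoning

  -- All distances are weights of quotients, so it is enough to compare with the codeword of `ε`.
  -- Positivity of `d` makes the attaining pair distinct; conversely, distinct codewords have a
  -- quotient other than `ε`.
  δtw-intro : (I : Vector (PermRep T q) r) (d : ℕ) → 0 < d →
    (∃[ t ] weight I t ≡ d) → (∀ t → ¬ t ≈ ε → d ≤ weight I t) → δtw≡ T I d
  δtw-intro I _ 0<d (t , refl) min = inj₁
    ( (αs T t I , αs T ε I , (t , refl) , (ε , refl) , αs-separated I t 0<d , hamming-αs-ε I t)
    , λ { _ _ (t , refl) (s , refl) u≢v → subst (_ ≤_) (sym (hamming-αs I t s))
          (min (t ∙ s ⁻¹) (λ e → u≢v (hamming≡0⇒≡ _ _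
            (trans (hamming-αs I t s) (trans (weight-cong I e) (weight-ε I)))))) } )

  δtw≤weight : (I : Vector (PermRep T q) r) {d : ℕ} → δtw≡ T I d →
    ∀ t → 0 < weight I t → d ≤ weight I t
  δtw≤weight I (inj₂ (_ , refl)) t _   = z≤n
  δtw≤weight I (inj₁ (_ , min))  t 0<w =
    subst (_ ≤_) (hamming-αs-ε I t) (min _ _ (t , refl) (ε , refl) (αs-separated I t 0<w))

  -- Lets the lemmas on twisted codes serve for `δrep≡`: repeating is twisting by a constant tuple.
  Rep≐twistedCode : ∀ r (ρ : PermRep T q) → twistedCode T {r = r} (const ρ) ≐ Rep r (permCode T ρ)
  Rep≐twistedCode r ρ =
    (λ { (t , refl) → α T t ρ , (t , refl) , cong concat (tabulate-const r (α T t ρ)) }) ,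
    (λ { (_ , (t , refl) , refl) → t , cong concat (sym (tabulate-const r (α T t ρ))) })
    where
    tabulate-const : ∀ n (x : A) → tabulate {n = n} (const x) ≡ replicate n x
    tabulate-const zero    x = refl
    tabulate-const (suc n) x = cong (x ∷_) (tabulate-const n x)

  δrep-intro : .{{_ : NonZero r}} (I : Vector (PermRep T q) r) (m : Fin r → ℕ) (i : Fin r) →
    (∀ j → 0 < m j) →
    (∀ j → ∃[ t ] moved (⟦ I j ⟧ t) ≡ m j) →
    (∀ j t → ¬ t ≈ ε → m j ≤ moved (⟦ I j ⟧ t)) →
    (∀ j → m i ≤ m j) → δrep≡ T I (r * m i)
  δrep-intro {r = r} I m i 0<m attained min least =
    (i , minRep i) , λ j → r * m j , minRep j , ℕ.*-monoʳ-≤ r (least j)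
    where
    weight-const : ∀ j t → weight {r = r} (const (I j)) t ≡ r * moved (⟦ I j ⟧ t)
    weight-const j t = sum-const r (moved (⟦ I j ⟧ t))

    minRep : ∀ j → MinimumDistance (Rep r (permCode T (I j))) (r * m j)
    minRep j = MinimumDistance-resp-≐ (Rep≐twistedCode r (I j)) (δtw-intro {r = r} (const (I j)) (r * m j)
      (ℕ.*-mono-≤ (>-nonZero⁻¹ r) (0<m j))
      (map₂ (λ {t} e → trans (weight-const j t) (cong (r *_) e)) (attained j))
      (λ t t≉ε → subst (r * m j ≤_) (sym (weight-const j t)) (ℕ.*-monoʳ-≤ r (min j t t≉ε))))

  -- Each of the `r` blocks lists the values of a permutation and hence contains `x` once.
  frequency : (I : Vector (PermRep T q) r) → FrequencyPermutationArray r (twistedCode T I)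
  frequency {q = q} {r = r} I _ (t , refl) x = begin
    count (x ≟_) (αs T t I)                      ≡⟨ count-concat (x ≟_) (λ i → α T t (I i)) ⟩
    sum (λ i → count (x ≟_) (α T t (I i)))       ≡⟨ sum-cong-≗ once ⟩
    sum {r} (const 1)                            ≡⟨ sum-const r 1 ⟩
    r * 1                                        ≡⟨ ℕ.*-identityʳ r ⟩
    r                                            ∎
    where
    open ≡-Reasoning
    once : ∀ i → count (x ≟_) (α T t (I i)) ≡ 1
    once i = begin
      count (x ≟_) (α T t (I i))                          ≡⟨ count-tabulate (x ≟_) (⟦ I i ⟧ t ⟨$⟩ʳ_) ⟩
      sum (λ j → indicator (does (x ≟ ⟦ I i ⟧ t ⟨$⟩ʳ j))) ≡⟨ sum-permute (λ j → indicator (does (x ≟ j))) (⟦ I i ⟧ t) ⟨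
      sum (λ j → indicator (does (x ≟ j)))                ≡⟨ sum-differ x ⟩
      1                                                   ∎

  Rep⇒twisted : ∀ r (ρ : PermRep T q) {d : ℕ} →
    MinimumDistance (Rep r (permCode T ρ)) d → δtw≡ T {r = r} (const ρ) d
  Rep⇒twisted r ρ = MinimumDistance-resp-≐ (proj₂ (Rep≐twistedCode r ρ) , proj₁ (Rep≐twistedCode r ρ))

  δrep≤r*moved : .{{_ : NonZero r}} (I : Vector (PermRep T q) r) {d : ℕ} → δrep≡ T I d →
    ∀ j x → ¬ (⟦ I j ⟧ x Perm.≈ Perm.id) → d ≤ r * moved (⟦ I j ⟧ x)
  δrep≤r*moved {r = r} {q = q} I (_ , bound) j x x∉ker with bound j
  ... | d′ , δ , d≤d′ = ℕ.≤-trans d≤d′ (subst (d′ ≤_) (sum-const r (moved (⟦ I j ⟧ x)))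
    (δtw≤weight I′ (Rep⇒twisted r (I j) δ) x
      (ℕ.n≢0⇒n>0 (λ e → x∉ker (moved≡0⇒≈id (⟦ I j ⟧ x) (sum≡0⇒≡0 (λ i → moved (⟦ I′ i ⟧ x)) e j))))))
    where
    I′ : Vector (PermRep T q) r
    I′ = const (I j)

  -- The distances of the blocks add up to zero, so each of them is zero. This settles codes with a
  -- single codeword.
  αs-const : (I : Vector (PermRep T q) r) (i : Fin r) {t s : Carrier} →
    αs T t I ≡ αs T s I → αs T {r = r} t (const (I i)) ≡ αs T {r = r} s (const (I i))
  αs-const {r = r} I i {t} {s} e = hamming≡0⇒≡ _ _ (begin
    hamming (αs T {r = r} t (const (I i))) (αs T {r = r} s (const (I i))) ≡⟨ hamming-αs {r = r} (const (I i)) t s ⟩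
    sum {r} (const (moved (⟦ I i ⟧ (t ∙ s ⁻¹))))          ≡⟨ sum-const r _ ⟩
    r * moved (⟦ I i ⟧ (t ∙ s ⁻¹))                        ≡⟨ cong (r *_) (sum≡0⇒≡0 (λ j → moved (⟦ I j ⟧ (t ∙ s ⁻¹))) w≡0 i) ⟩
    r * 0                                                 ≡⟨ ℕ.*-zeroʳ r ⟩
    0                                                     ∎)
    where
    open ≡-Reasoning
    w≡0 : weight I (t ∙ s ⁻¹) ≡ 0
    w≡0 = trans (sym (hamming-αs I t s)) (trans (cong (hamming (αs T t I)) (sym e)) (hamming-self (αs T t I)))

  -- Averaging: each action contributes at least `drep` after multiplication by `r`, so the sum over
  -- all `r` actions gives `r * drep ≤ r * weight I x`, and `r` cancels. If the twisted code has one
  -- codeword, so has each repetition code, and `drep` is 0.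
  δrep≤δtw : .{{_ : NonZero r}} (I : Vector (PermRep T q) r) → SameKernel T I →
    ∀ dtw drep → δtw≡ T I dtw → δrep≡ T I drep → drep ≤ dtw
  δrep≤δtw {r = r} I _ _ drep (inj₂ ((w , _ , uniq) , refl)) ((i , δ) , _) = one-codeword (Rep⇒twisted r (I i) δ)
    where
    one-codeword : δtw≡ T {r = r} (const (I i)) drep → drep ≤ 0
    one-codeword (inj₂ (_ , refl)) = z≤n
    one-codeword (inj₁ ((_ , _ , (t , refl) , (s , refl) , u≢v , _) , _)) = contradiction
      (αs-const I i (trans (uniq (αs T t I) (t , refl)) (sym (uniq (αs T s I) (s , refl)))))
      u≢v
  δrep≤δtw {r = r} {q = q} I same _ drep (inj₁ ((_ , _ , (t , refl) , (s , refl) , u≢v , refl) , _)) δrep =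
    ℕ.*-cancelˡ-≤ r (begin
      r * drep                                       ≡⟨ sum-const r drep ⟨
      sum {r} (const drep)                           ≤⟨ sum-mono (λ j → δrep≤r*moved I δrep j x (x∉ker j)) ⟩
      sum (λ j → r * moved (⟦ I j ⟧ x))              ≡⟨ *-distribˡ-sum r (λ j → moved (⟦ I j ⟧ x)) ⟨
      r * weight I x                                 ≡⟨ cong (r *_) (hamming-αs I t s) ⟨
      r * hamming (αs T t I) (αs T s I)              ∎)
    where
    open ℕ.≤-Reasoning
    x = t ∙ s ⁻¹
    -- An `x` in one kernel lies in all of them by `same`, and then the two codewords coincide.
    x∉ker : ∀ j → ¬ (⟦ I j ⟧ x Perm.≈ Perm.id)
    x∉ker j x∈ker = u≢v (hamming≡0⇒≡ _ _ (trans (hamming-αs I t s) (trans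
      (sum-cong-≗ {r} (λ i → trans (moved-cong (⟦ I i ⟧ x) Perm.id (same j i x x∈ker)) (moved-id {q})))
      (sum-replicate-zero r))))

-- Coset actions

module _ {G : Group ℓc ℓ} where

  open Group G renaming (refl to ≈-refl; sym to ≈-sym; trans to ≈-trans)

  -- The points labelled H g zⱼ exhaust the cosets of H, and t fixes H g zⱼ
  -- iff zⱼ t zⱼ⁻¹ lies in g⁻¹ H g = K.
  moved-coset : (H K : Subgroup G p) (ρ : PermRep G q) → CosetAction H ρ → Conjugate H K →
    (K? : Decidable (Mem K)) (z : Fin q → Carrier) → (∀ {i j} → Mem K (z i ∙ z j ⁻¹) → i ≡ j) →
    ∀ t → moved (⟦ ρ ⟧ t) ≡ sum (λ j → indicator (does (¬? (K? (z j ∙ t ∙ z j ⁻¹)))))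
  moved-coset {q = q} H K ρ (label , action) (g , conj) K? z distinct t = trans
    (sum-permute (λ i → differ (⟦ ρ ⟧ t ⟨$⟩ʳ i) i) (injective⇒permutation point (λ e → distinct (point-≡⇒ e))))
    (sum-cong-≗ (λ j → at j (K? (z j ∙ t ∙ z j ⁻¹))))
    where
    open import Relation.Binary.Reasoning.Setoid (Group.setoid G)

    module Cosets = Setoid (RightCosets H)

    L : Carrier → Fin q
    L = Inverse.to label

    conj-quotient : ∀ x y → g ⁻¹ ∙ ((g ∙ x) ∙ (g ∙ y) ⁻¹) ∙ g ≈ x ∙ y ⁻¹
    conj-quotient x y = begin
      g ⁻¹ ∙ ((g ∙ x) ∙ (g ∙ y) ⁻¹) ∙ g      ≈⟨ ∙-congʳ (assoc _ _ _) ⟨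
      g ⁻¹ ∙ (g ∙ x) ∙ (g ∙ y) ⁻¹ ∙ g        ≈⟨ ∙-cong (∙-cong (≈-sym (assoc _ _ _)) (GroupProperties.⁻¹-anti-homo-∙ G g y)) ≈-refl ⟩
      g ⁻¹ ∙ g ∙ x ∙ (y ⁻¹ ∙ g ⁻¹) ∙ g       ≈⟨ assoc _ _ _ ⟩
      g ⁻¹ ∙ g ∙ x ∙ (y ⁻¹ ∙ g ⁻¹ ∙ g)       ≈⟨ ∙-cong (≈-trans (∙-congʳ (inverseˡ g)) (identityˡ x))
                                                   (≈-trans (assoc _ _ _) (≈-trans (∙-congˡ (inverseˡ g)) (identityʳ (y ⁻¹)))) ⟩
      x ∙ y ⁻¹                               ∎

    L-≡⇒ : ∀ {x y} → L (g ∙ x) ≡ L (g ∙ y) → Mem K (x ∙ y ⁻¹)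
    L-≡⇒ {x} {y} e = Subgroup.resp K (conj-quotient x y) (Equivalence.to (conj _)
      -- The element that `label` assigns to the common point represents both cosets.
      (Cosets.trans (Cosets.sym (Inverse.inverseʳ label refl)) (Inverse.inverseʳ label e)))

    L-≡⇐ : ∀ {x y} → Mem K (x ∙ y ⁻¹) → L (g ∙ x) ≡ L (g ∙ y)
    L-≡⇐ {x} {y} k = Inverse.to-cong label (Equivalence.from (conj _) (Subgroup.resp K (≈-sym (conj-quotient x y)) k))

    point : Fin q → Fin q
    point j = L (g ∙ z j)

    point-≡⇒ : ∀ {i j} → point i ≡ point j → Mem K (z i ∙ z j ⁻¹)
    point-≡⇒ = L-≡⇒

    moves : ∀ j → ⟦ ρ ⟧ t ⟨$⟩ʳ point j ≡ L (g ∙ (z j ∙ t))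
    moves j = trans (sym (action (g ∙ z j) t)) (Inverse.to-cong label
      (Subgroup.resp H (≈-trans (≈-sym (inverseʳ _)) (∙-congʳ (≈-sym (assoc g (z j) t)))) (Subgroup.ε-mem H)))

    at : ∀ j (d : Dec (Mem K (z j ∙ t ∙ z j ⁻¹))) →
      differ (⟦ ρ ⟧ t ⟨$⟩ʳ point j) (point j) ≡ indicator (does (¬? d))
    at j (yes k) = trans (cong (λ x → differ x (point j)) (trans (moves j) (L-≡⇐ k))) (differ-refl (point j))
    at j (no ¬k) with ⟦ ρ ⟧ t ⟨$⟩ʳ point j ≟ point j
    ... | yes e = contradiction (L-≡⇒ (trans (sym (moves j)) e)) ¬k
    ... | no _  = refl

-- Permutations as words

Word : ℕ → Set
Word n = Vec (Fin n) n

⌜_⌝ : Permutation′ n → Word n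
⌜ π ⌝ = tabulate (π ⟨$⟩ʳ_)

infixl 9 _⨾_
_⨾_ : Word n → Word n → Word n
v ⨾ w = Vec.map (lookup w) v

⌜⌝-cong : (π σ : Permutation′ n) → π Perm.≈ σ → ⌜ π ⌝ ≡ ⌜ σ ⌝
⌜⌝-cong π σ = tabulate-cong

lookup-⌜⌝ : (π : Permutation′ n) → ∀ i → lookup ⌜ π ⌝ i ≡ π ⟨$⟩ʳ i
lookup-⌜⌝ π = lookup∘tabulate (π ⟨$⟩ʳ_)

⌜⌝-injective : (π σ : Permutation′ n) → ⌜ π ⌝ ≡ ⌜ σ ⌝ → π Perm.≈ σ
⌜⌝-injective π σ e i = trans (sym (lookup-⌜⌝ π i)) (trans (cong (λ v → lookup v i) e) (lookup-⌜⌝ σ i))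

⌜∘ₚ⌝ : (π σ : Permutation′ n) → ⌜ π ∘ₚ σ ⌝ ≡ ⌜ π ⌝ ⨾ ⌜ σ ⌝
⌜∘ₚ⌝ π σ = trans (tabulate-cong (λ i → sym (lookup-⌜⌝ σ (π ⟨$⟩ʳ i)))) (tabulate-∘ (lookup ⌜ σ ⌝) (π ⟨$⟩ʳ_))

movedʷ : Word n → ℕ
movedʷ v = sum (λ i → differ (lookup v i) i)

moved-⌜⌝ : (π : Permutation′ n) → movedʷ ⌜ π ⌝ ≡ moved π
moved-⌜⌝ π = sum-cong-≗ (λ i → cong (λ x → differ x i) (lookup-⌜⌝ π i))

_≟ʷ_ : (v w : Word n) → Dec (v ≡ w)
_≟ʷ_ = ≡-dec _≟_

-- Exhaustive checks over all permutations

every : (Fin n → Bool) → Bool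
every {zero}  P = true
every {suc n} P = P zero ∧ every (P ∘ suc)

∧-trueˡ : {x y : Bool} → x ∧ y ≡ true → x ≡ true
∧-trueˡ {true} _ = refl

∧-trueʳ : {x y : Bool} → x ∧ y ≡ true → y ≡ true
∧-trueʳ {true} e = e

every-sound : (P : Fin n → Bool) → every P ≡ true → ∀ i → P i ≡ true
every-sound P e zero    = ∧-trueˡ e
every-sound P e (suc i) = every-sound (P ∘ suc) (∧-trueʳ {P zero} e) i

fresh : Fin n → List (Fin n) → Bool
fresh x []       = true
fresh x (y ∷ ys) = if does (x ≟ y) then false else fresh x ys

fresh-complete : {x : Fin n} {ys : List (Fin n)} → All (x ≢_) ys → fresh x ys ≡ true
fresh-complete []                          = refl
fresh-complete {x = x} {y ∷ _} (x≢y ∷ x≢ys) rewrite dec-false (x ≟ y) x≢y = fresh-complete x≢ys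

-- Branches on a letter only if it has not been used, so that n! words of length n are visited
-- instead of all nⁿ.
everyFresh : ∀ k → List (Fin n) → (Vec (Fin n) k → Bool) → Bool
everyFresh zero    used P = P []
everyFresh (suc k) used P =
  every (λ x → if fresh x used then everyFresh k (x ∷ used) (P ∘ (x ∷_)) else true)

everyFresh-sound : ∀ k used (P : Vec (Fin n) k → Bool) → everyFresh k used P ≡ true →
  (f : Fin k → Fin n) → (∀ {i j} → f i ≡ f j → i ≡ j) → (∀ i → All (f i ≢_) used) →
  P (tabulate f) ≡ true
everyFresh-sound zero    used P e f f-inj f-fresh = e
everyFresh-sound (suc k) used P e f f-inj f-fresh = everyFresh-sound k (f zero ∷ used) (P ∘ (f zero ∷_))
  (subst (λ b → (if b then everyFresh k (f zero ∷ used) (P ∘ (f zero ∷_)) else true) ≡ true)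
    (fresh-complete (f-fresh zero)) (every-sound _ e (f zero)))
  (f ∘ suc)
  (λ e′ → suc-injective (f-inj e′))
  (λ i → (λ e′ → case (f-inj e′)) ∷ f-fresh (suc i))
  where
  case : ∀ {i : Fin k} → suc i ≢ zero
  case ()

everyPermutation : (Word n → Bool) → Bool
everyPermutation {n} = everyFresh n []

does-sound : {A : Set p} (A? : Dec A) → does A? ≡ true → A
does-sound (yes a) _ = a

permutationwise : (f : Word n → Bool) {P : Pred (Word n) p} → (∀ v → f v ≡ true → P v) →
  everyPermutation f ≡ true → ∀ π → P ⌜ π ⌝
permutationwise {n = n} f sound e π = sound ⌜ π ⌝
  (everyFresh-sound n [] f e (π ⟨$⟩ʳ_) (injective π) (λ _ → []))

permutationwise? : {P : Pred (Word n) p} (P? : Decidable P) → everyPermutation (does ∘ P?) ≡ true →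
  ∀ π → P ⌜ π ⌝
permutationwise? P? = permutationwise (does ∘ P?) (λ v → does-sound (P? v))

opaque
  -- Squares are even, while a permutation that moves exactly two points is a transposition.
  square-not-transposition : (π : Permutation′ 6) → movedʷ (⌜ π ⌝ ⨾ ⌜ π ⌝) ≢ 2
  square-not-transposition = permutationwise? (λ v → ¬? (movedʷ (v ⨾ v) ℕ.≟ 2)) refl

position : Vec (Fin n) m → Fin n → Maybe (Fin m)
position []      j = nothing
position (x ∷ v) j with does (x ≟ j) | position v j
... | true  | _      = just zero
... | false | just i = just (suc i)
... | false | nothing = nothing

-- Junk value: points that do not occur in v are fixed.
inverseʷ : Word n → Word n
inverseʷ v = tabulate λ j → fromMaybe j (position v j)

-- Junk value: the identity, if v is not a permutation.
fromWord : Word n → Permutation′ n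
fromWord v with (v ⨾ inverseʷ v) ≟ʷ tabulate (λ i → i) | (inverseʷ v ⨾ v) ≟ʷ tabulate (λ i → i)
... | yes e | yes e′ = Perm.permutation (lookup v) (lookup (inverseʷ v)) (cancel (inverseʷ v) v e′) (cancel v (inverseʷ v) e)
  where
  cancel : (v w : Word _) → v ⨾ w ≡ tabulate (λ i → i) → ∀ i → lookup w (lookup v i) ≡ i
  cancel v w e i = trans (sym (lookup-map i (lookup w) v)) (trans (cong (λ u → lookup u i) e) (lookup∘tabulate (λ i → i) i))
... | _     | _      = Perm.id

-- Conjugation

infixl 10 _^_
_^_ : Permutation′ n → Permutation′ n → Permutation′ n
x ^ g = (Perm.flip g ∘ₚ x) ∘ₚ g

^-cong : (g x y : Permutation′ n) → x Perm.≈ y → x ^ g Perm.≈ y ^ g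
^-cong g x y x≈y i = cong (g ⟨$⟩ʳ_) (x≈y (g ⟨$⟩ˡ i))

^-homo : (g x y : Permutation′ n) → (x ∘ₚ y) ^ g Perm.≈ (x ^ g) ∘ₚ (y ^ g)
^-homo g x y i = cong (λ j → g ⟨$⟩ʳ (y ⟨$⟩ʳ j)) (sym (Perm.inverseˡ g))

^-flip : (g x : Permutation′ n) → (x ^ g) ^ Perm.flip g Perm.≈ x
^-flip g x i = trans (Perm.inverseˡ g) (cong (x ⟨$⟩ʳ_) (Perm.inverseˡ g))

^-flip′ : (g x : Permutation′ n) → (x ^ Perm.flip g) ^ g Perm.≈ x
^-flip′ g x i = trans (Perm.inverseʳ g) (cong (x ⟨$⟩ʳ_) (Perm.inverseʳ g))

∘ₚ-cong : (x x′ y y′ : Permutation′ n) → x Perm.≈ x′ → y Perm.≈ y′ → x ∘ₚ y Perm.≈ x′ ∘ₚ y′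
∘ₚ-cong x x′ y y′ e e′ i = trans (cong (y ⟨$⟩ʳ_) (e i)) (e′ (x′ ⟨$⟩ʳ i))

-- Conjugacy is tested in the form g y = x g, which spares the searches the inversion of g.
⌜^⌝⇒≈ : (g x y : Permutation′ n) → ⌜ g ⌝ ⨾ ⌜ y ⌝ ≡ ⌜ x ⌝ ⨾ ⌜ g ⌝ → y Perm.≈ x ^ g
⌜^⌝⇒≈ g x y e i = trans (cong (y ⟨$⟩ʳ_) (sym (Perm.inverseʳ g)))
  (⌜⌝-injective (g ∘ₚ y) (x ∘ₚ g) (trans (⌜∘ₚ⌝ g y) (trans e (sym (⌜∘ₚ⌝ x g)))) (g ⟨$⟩ˡ i))

-- The conjugacy classes of the symmetric group of degree 6

-- Representatives of the cycle types 1, 2, 2², 2³, 3, 3·2, 3², 4, 4·2, 5, 6.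
representatives : Vec (Word 6) 11
representatives =
    (0F ∷ 1F ∷ 2F ∷ 3F ∷ 4F ∷ 5F ∷ [])
  ∷ (1F ∷ 0F ∷ 2F ∷ 3F ∷ 4F ∷ 5F ∷ [])
  ∷ (1F ∷ 0F ∷ 3F ∷ 2F ∷ 4F ∷ 5F ∷ [])
  ∷ (1F ∷ 0F ∷ 3F ∷ 2F ∷ 5F ∷ 4F ∷ [])
  ∷ (1F ∷ 2F ∷ 0F ∷ 3F ∷ 4F ∷ 5F ∷ [])
  ∷ (1F ∷ 2F ∷ 0F ∷ 4F ∷ 3F ∷ 5F ∷ [])
  ∷ (1F ∷ 2F ∷ 0F ∷ 4F ∷ 5F ∷ 3F ∷ [])
  ∷ (1F ∷ 2F ∷ 3F ∷ 0F ∷ 4F ∷ 5F ∷ [])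
  ∷ (1F ∷ 2F ∷ 3F ∷ 0F ∷ 5F ∷ 4F ∷ [])
  ∷ (1F ∷ 2F ∷ 3F ∷ 4F ∷ 0F ∷ 5F ∷ [])
  ∷ (1F ∷ 2F ∷ 3F ∷ 4F ∷ 5F ∷ 0F ∷ [])
  ∷ []

opaque
  rep : Fin 11 → Permutation′ 6
  rep k = fromWord (lookup representatives k)

cycle : ℕ → Word n → Fin n → Fin n → List (Fin n)
cycle zero       v x y = []
cycle (suc fuel) v x y = y ∷ (if does (lookup v y ≟ x) then [] else cycle fuel v x (lookup v y))

-- The points in the order in which they are listed by the cycle notation
-- of v, longest cycles first.
cycleNotation : Word 6 → Word 6
cycleNotation v = toWord 6 (List.foldl (λ used l → List.foldl (extend l) used (allFin 6)) [] (6 ∷ 5 ∷ 4 ∷ 3 ∷ 2 ∷ 1 ∷ []))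
  where
  extend : ℕ → List (Fin 6) → Fin 6 → List (Fin 6)
  extend l used x with cycle 6 v x x
  ... | c = if does (length c ℕ.≟ l) ∧ fresh x used then used ++ c else used
  toWord : ∀ k → List (Fin 6) → Vec (Fin 6) k
  toWord zero    _        = []
  toWord (suc k) []       = zero ∷ toWord k []
  toWord (suc k) (x ∷ xs) = x ∷ toWord k xs

ConjugateToRep : Word 6 → Set
ConjugateToRep v = ∃[ k ] ∃[ g ] ⌜ g ⌝ ⨾ v ≡ lookup representatives k ⨾ ⌜ g ⌝

-- The auxiliary function makes g ⨾ v shared between the comparisons.
hasRep? : ∀ g v → Dec (∃[ k ] g ⨾ v ≡ lookup representatives k ⨾ g)
hasRep? g v = search (g ⨾ v)
  where
  search : ∀ u → Dec (∃[ k ] u ≡ lookup representatives k ⨾ g)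
  search u = any? λ k → u ≟ʷ (lookup representatives k ⨾ g)

-- The representatives are written on consecutive points with the longest cycles first. Hence the
-- permutation that sends i to the ith point in the cycle notation of `v` conjugates the
-- representative of the same cycle type to `v`.
findRep : Word 6 → Bool
findRep v = does (hasRep? ⌜ fromWord (cycleNotation v) ⌝ v)

hasRep-sound : ∀ g v → does (hasRep? ⌜ g ⌝ v) ≡ true → ConjugateToRep v
hasRep-sound g v e = proj₁ hit , g , proj₂ hit
  where hit = does-sound (hasRep? ⌜ g ⌝ v) e

findRep-sound : ∀ v → findRep v ≡ true → ConjugateToRep v
findRep-sound v = hasRep-sound (fromWord (cycleNotation v)) v

opaque
  unfolding rep

  rep-word : ∀ k → ⌜ rep k ⌝ ≡ lookup representatives k
  rep-word = from-yes (all? λ k → ⌜ rep k ⌝ ≟ʷ lookup representatives k)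

  conjugate-to-repʷ : (t : Permutation′ 6) → ConjugateToRep ⌜ t ⌝
  conjugate-to-repʷ = permutationwise findRep {ConjugateToRep} findRep-sound refl

conjugate-to-rep : (t : Permutation′ 6) → ∃[ k ] ∃[ g ] t Perm.≈ rep k ^ g
conjugate-to-rep t with conjugate-to-repʷ t
... | k , g , e = k , g , ⌜^⌝⇒≈ g (rep k) t (trans e (cong (_⨾ ⌜ g ⌝) (sym (rep-word k))))

moved-^ : (g x : Permutation′ n) → moved (x ^ g) ≡ moved x
moved-^ = moved-conjugate

-- Quadruples of 3-cycles whose pairwise products have order 2

star : Fin 5 → Permutation′ 6
star i = transpose zero (suc i)

-- The cycle (0 1 i+2).
threeCycle : Fin 4 → Permutation′ 6
threeCycle i = star zero ∘ₚ star (suc i)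

idʷ : Word n
idʷ = tabulate (λ i → i)

Involution : Word n → Set
Involution v = v ≢ idʷ × v ⨾ v ≡ idʷ

involution? : (v : Word n) → Dec (Involution v)
involution? v = ¬? (v ≟ʷ idʷ) ×-dec ((v ⨾ v) ≟ʷ idʷ)

⌜⌝-involution : (π : Permutation′ n) → ¬ π Perm.≈ Perm.id → π ∘ₚ π Perm.≈ Perm.id → Involution ⌜ π ⌝
⌜⌝-involution π π≉id ππ≈id =
  (λ e → π≉id (⌜⌝-injective π Perm.id e)) ,
  trans (sym (⌜∘ₚ⌝ π π)) (⌜⌝-cong (π ∘ₚ π) Perm.id ππ≈id)

triangle : Fin n → Fin n → Fin n → Word n
triangle a b x = tabulate λ y →
  if does (y ≟ a) then b else if does (y ≟ b) then x else if does (y ≟ x) then a else y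

opaque
  threeCycleʷ : Fin 4 → Word 6
  threeCycleʷ i = triangle 0F 1F (suc (suc i))

edge : Fin 3 → Fin 6 × Fin 6
edge 0F = 0F , 1F
edge 1F = 1F , 2F
edge 2F = 2F , 0F

-- Two 3-cycles have a product of order 2 iff they are of the form (a b x) and
-- (a b y) with x ≠ y; 3-cycles that are pairwise so related share one edge a → b.
opaque
  neighbour : Fin 3 × Fin 3 → Word 6
  neighbour (e , x) = triangle (proj₁ (edge e)) (proj₂ (edge e)) (suc (suc (suc x)))

Neighbour : Word 6 → Set
Neighbour v = movedʷ v ≡ 3 → Involution (threeCycleʷ 0F ⨾ v) → ∃[ e ] ∃[ x ] v ≡ neighbour (e , x)

neighbour? : ∀ v → Dec (Neighbour v)
neighbour? v = (movedʷ v ℕ.≟ 3) →-dec involution? (threeCycleʷ 0F ⨾ v) →-dec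
  any? λ e → any? λ x → v ≟ʷ neighbour (e , x)

-- Maps the edge 0 → 1 to e, and i+2 to the third point of the ith triangle.
opaque
  unfolding threeCycleʷ

  frame : Fin 3 → (x y z : Fin 3) → Permutation′ 6
  frame e x y z = fromWord (a ∷ b ∷ third ∷ suc (suc (suc x)) ∷ suc (suc (suc y)) ∷ suc (suc (suc z)) ∷ [])
    where
    a b third : Fin 6
    a = proj₁ (edge e)
    b = proj₂ (edge e)
    third = lookup (threeCycleʷ 0F) b

Aligned : (x y z g : Word 6) → Set
Aligned x y z g =
    g ⨾ threeCycleʷ 0F ≡ threeCycleʷ 0F ⨾ g × g ⨾ x ≡ threeCycleʷ 1F ⨾ g
  × g ⨾ y ≡ threeCycleʷ 2F ⨾ g × g ⨾ z ≡ threeCycleʷ 3F ⨾ g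

aligned? : ∀ x y z g → Dec (Aligned x y z g)
aligned? x y z g =
       ((g ⨾ threeCycleʷ 0F) ≟ʷ (threeCycleʷ 0F ⨾ g)) ×-dec ((g ⨾ x) ≟ʷ (threeCycleʷ 1F ⨾ g))
  ×-dec ((g ⨾ y) ≟ʷ (threeCycleʷ 2F ⨾ g)) ×-dec ((g ⨾ z) ≟ʷ (threeCycleʷ 3F ⨾ g))

opaque
  unfolding rep threeCycleʷ neighbour frame

  ⌜threeCycle⌝ : ∀ i → ⌜ threeCycle i ⌝ ≡ threeCycleʷ i
  ⌜threeCycle⌝ = from-yes (all? λ i → ⌜ threeCycle i ⌝ ≟ʷ threeCycleʷ i)

  ⌜rep-4⌝ : ⌜ rep 4F ⌝ ≡ threeCycleʷ 0F
  ⌜rep-4⌝ = refl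

  neighbours : ∀ π → Neighbour ⌜ π ⌝
  neighbours = permutationwise? {P = Neighbour} neighbour? refl

  -- The premises force one common edge and distinct third points, so that `frame` is built from a
  -- genuine permutation whenever its value matters.
  align : ∀ e x e′ y e″ z → let u = neighbour (e , x); v = neighbour (e′ , y); w = neighbour (e″ , z) in
    Involution (u ⨾ v) → Involution (u ⨾ w) → Involution (v ⨾ w) → Aligned u v w ⌜ frame e x y z ⌝
  align = from-yes (all? λ e → all? λ x → all? λ e′ → all? λ y → all? λ e″ → all? λ z →
    let u = neighbour (e , x); v = neighbour (e′ , y); w = neighbour (e″ , z) in
    involution? (u ⨾ v) →-dec involution? (u ⨾ w) →-dec involution? (v ⨾ w) →-dec
    aligned? u v w ⌜ frame e x y z ⌝)

_≈?_ : (π σ : Permutation′ n) → Dec (π Perm.≈ σ)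
π ≈? σ = all? λ i → (π ⟨$⟩ʳ i) ≟ (σ ⟨$⟩ʳ i)

opaque
  unfolding rep

  moved-rep-3 : ∀ k → moved (rep k) ≡ 3 → k ≡ 4F
  moved-rep-3 = from-yes (all? λ k → (moved (rep k) ℕ.≟ 3) →-dec (k ≟ 4F))

align′ : ∀ {u v w} e x e′ y e″ z → u ≡ neighbour (e , x) → v ≡ neighbour (e′ , y) → w ≡ neighbour (e″ , z) →
  Involution (u ⨾ v) → Involution (u ⨾ w) → Involution (v ⨾ w) → ∃[ g ] Aligned u v w ⌜ g ⌝
align′ e x e′ y e″ z refl refl refl uv uw vw = frame e x y z , align e x e′ y e″ z uv uw vw

triple-conjugate : (d : Fin 3 → Permutation′ 6) → (∀ i → moved (d i) ≡ 3) →
  (∀ i → Involution (threeCycleʷ 0F ⨾ ⌜ d i ⌝)) → (∀ i j → i ≢ j → Involution (⌜ d i ⌝ ⨾ ⌜ d j ⌝)) →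
  ∃[ g ] Aligned ⌜ d 0F ⌝ ⌜ d 1F ⌝ ⌜ d 2F ⌝ ⌜ g ⌝
triple-conjugate d moved≡3 c0d dd =
  align′ (e 0F) (x 0F) (e 1F) (x 1F) (e 2F) (x 2F) (d≡ 0F) (d≡ 1F) (d≡ 2F)
    (dd 0F 1F λ ()) (dd 0F 2F λ ()) (dd 1F 2F λ ())
  where
  near : ∀ i → ∃[ e ] ∃[ x ] ⌜ d i ⌝ ≡ neighbour (e , x)
  near i = neighbours (d i) (trans (moved-⌜⌝ (d i)) (moved≡3 i)) (c0d i)
  e x : Fin 3 → Fin 3
  e i = proj₁ (near i)
  x i = proj₁ (proj₂ (near i))
  d≡ : ∀ i → ⌜ d i ⌝ ≡ neighbour (e i , x i)
  d≡ i = proj₂ (proj₂ (near i))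

-- Conjugation by `Perm.flip h` makes the first 3-cycle equal to (0 1 2). The other three are then
-- among its nine neighbours, and a search over quadruples of permutations is avoided.
threeCycles-conjugate : (d : Fin 4 → Permutation′ 6) → (∀ i → moved (d i) ≡ 3) →
  (∀ i j → i ≢ j → ¬ d i ∘ₚ d j Perm.≈ Perm.id × (d i ∘ₚ d j) ∘ₚ (d i ∘ₚ d j) Perm.≈ Perm.id) →
  ∃[ g ] (∀ i → d i Perm.≈ threeCycle i ^ g)
threeCycles-conjugate d moved≡3 dd =
  g ∘ₚ h , λ i j → trans (sym (^-flip′ h (d i) j)) (^-cong h (d′ i) (threeCycle i ^ g) (d′≈ i) j)
  where
  κ : Fin 11
  κ = proj₁ (conjugate-to-rep (d 0F))

  h : Permutation′ 6
  h = proj₁ (proj₂ (conjugate-to-rep (d 0F)))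

  d₀≈rep : d 0F Perm.≈ rep κ ^ h
  d₀≈rep = proj₂ (proj₂ (conjugate-to-rep (d 0F)))

  d₀≈ : d 0F Perm.≈ rep 4F ^ h
  d₀≈ = subst (λ k → d 0F Perm.≈ rep k ^ h)
    (moved-rep-3 κ (trans (sym (trans (moved-cong (d 0F) (rep κ ^ h) d₀≈rep) (moved-^ h (rep κ)))) (moved≡3 0F)))
    d₀≈rep

  d′ : Fin 4 → Permutation′ 6
  d′ i = d i ^ Perm.flip h

  d′₀ : ⌜ d′ 0F ⌝ ≡ threeCycleʷ 0F
  d′₀ = trans (⌜⌝-cong (d′ 0F) (rep 4F) (λ j → trans (^-cong (Perm.flip h) (d 0F) (rep 4F ^ h) d₀≈ j) (^-flip h (rep 4F) j)))
    ⌜rep-4⌝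

  involution : ∀ i j → i ≢ j → Involution (⌜ d′ i ⌝ ⨾ ⌜ d′ j ⌝)
  involution i j i≢j = subst Involution (trans (⌜⌝-cong (x ^ Perm.flip h) (d′ i ∘ₚ d′ j) (^-homo (Perm.flip h) (d i) (d j))) (⌜∘ₚ⌝ (d′ i) (d′ j)))
    (⌜⌝-involution (x ^ Perm.flip h)
      (λ e → proj₁ (dd i j i≢j) λ y → trans (sym (^-flip′ h x y)) (trans (^-cong h (x ^ Perm.flip h) Perm.id e y) (Perm.inverseʳ h)))
      (λ y → trans (sym (^-homo (Perm.flip h) x x y)) (trans (^-cong (Perm.flip h) (x ∘ₚ x) Perm.id (proj₂ (dd i j i≢j)) y) (Perm.inverseˡ h))))
    where
    x : Permutation′ 6
    x = d i ∘ₚ d j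

  aligned : ∃[ g ] Aligned ⌜ d′ 1F ⌝ ⌜ d′ 2F ⌝ ⌜ d′ 3F ⌝ ⌜ g ⌝
  aligned = triple-conjugate (d′ ∘ suc)
    (λ i → trans (moved-^ (Perm.flip h) (d (suc i))) (moved≡3 (suc i)))
    (λ i → subst (λ v → Involution (v ⨾ ⌜ d′ (suc i) ⌝)) d′₀ (involution 0F (suc i) λ ()))
    (λ i j i≢j → involution (suc i) (suc j) (i≢j ∘ suc-injective))

  g : Permutation′ 6
  g = proj₁ aligned

  conj : ∀ i → ⌜ g ⌝ ⨾ ⌜ d′ i ⌝ ≡ threeCycleʷ i ⨾ ⌜ g ⌝ → d′ i Perm.≈ threeCycle i ^ g
  conj i e = ⌜^⌝⇒≈ g (threeCycle i) (d′ i) (trans e (cong (_⨾ ⌜ g ⌝) (sym (⌜threeCycle⌝ i))))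

  d′≈ : ∀ i → d′ i Perm.≈ threeCycle i ^ g
  d′≈ 0F = conj 0F (trans (cong (⌜ g ⌝ ⨾_) d′₀) (proj₁ (proj₂ aligned)))
  d′≈ 1F = conj 1F (proj₁ (proj₂ (proj₂ aligned)))
  d′≈ 2F = conj 2F (proj₁ (proj₂ (proj₂ (proj₂ aligned))))
  d′≈ 3F = conj 3F (proj₂ (proj₂ (proj₂ (proj₂ aligned))))

-- Homomorphisms from the alternating group of degree 6

A₆ : Group 0ℓ 0ℓ
A₆ = toGroup (Alt 6)

module A₆ = Group A₆

even-pair : (i j k l : Fin 6) → i ≢ j → k ≢ l → A₆.Carrier
even-pair i j k l i≢j k≢l = transpose i j ∘ₚ transpose k l ,
  (i , j) ∷ (k , l) ∷ [] , i≢j ∷ k≢l ∷ [] , ∣-refl , λ _ → refl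

starPair : Fin 5 → Fin 5 → A₆.Carrier
starPair a b = even-pair 0F (suc a) 0F (suc b) (λ ()) (λ ())

cycle³ : Fin 4 → A₆.Carrier
cycle³ i = starPair 0F (suc i)

cycle³₀ : Fin 5 → A₆.Carrier
cycle³₀ zero    = A₆.ε
cycle³₀ (suc i) = cycle³ i

-- Conjugates (0 1 2) to (0 1 i+2). The second transposition only makes the conjugating element
-- even, so that a homomorphism defined on A₆ can be applied to it.
shift³ : Fin 4 → A₆.Carrier
shift³ 0F = A₆.ε
shift³ 1F = even-pair 2F 3F 4F 5F (λ ()) (λ ())
shift³ 2F = even-pair 2F 4F 3F 5F (λ ()) (λ ())
shift³ 3F = even-pair 2F 5F 3F 4F (λ ()) (λ ())

opaque
  cycle³-conjugate : ∀ i → proj₁ (cycle³ i) Perm.≈ proj₁ (cycle³ 0F) ^ proj₁ (shift³ i)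
  cycle³-conjugate = from-yes (all? λ i → proj₁ (cycle³ i) ≈? (proj₁ (cycle³ 0F) ^ proj₁ (shift³ i)))

  cycle³-product-≉ε : ∀ i j → i ≢ j → ¬ (cycle³ i A₆.∙ cycle³ j) A₆.≈ A₆.ε
  cycle³-product-≉ε = from-yes (all? λ i → all? λ j → ¬? (i ≟ j) →-dec
    ¬? (proj₁ (cycle³ i A₆.∙ cycle³ j) ≈? Perm.id))

  cycle³-product-² : ∀ i j → i ≢ j →
    ((cycle³ i A₆.∙ cycle³ j) A₆.∙ (cycle³ i A₆.∙ cycle³ j)) A₆.≈ A₆.ε
  cycle³-product-² = from-yes (all? λ i → all? λ j → ¬? (i ≟ j) →-dec
    (proj₁ ((cycle³ i A₆.∙ cycle³ j) A₆.∙ (cycle³ i A₆.∙ cycle³ j)) ≈? Perm.id))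

  -- Inserting `star 0F` twice between the two stars gives the inverse of one 3-cycle times another;
  -- `cycle³₀` also covers the degenerate product of `star 0F` with itself.
  starPair-cycle³ : ∀ a b → starPair a b A₆.≈ (cycle³₀ a A₆.⁻¹ A₆.∙ cycle³₀ b)
  starPair-cycle³ = from-yes (all? λ a → all? λ b →
    proj₁ (starPair a b) ≈? proj₁ (cycle³₀ a A₆.⁻¹ A₆.∙ cycle³₀ b))

  -- (i j) = (0 i)(0 j)(0 i) if neither point is 0; otherwise a = b works, since then the product
  -- collapses to one star.
  transpose-star : ∀ i j → i ≢ j → ∃[ a ] ∃[ b ] transpose i j Perm.≈ (star a ∘ₚ star b) ∘ₚ star a
  transpose-star = from-yes (all? λ i → all? λ j → ¬? (i ≟ j) →-dec
    any? λ a → any? λ b → transpose i j ≈? ((star a ∘ₚ star b) ∘ₚ star a))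

module _ (τ : Hom A₆ (Sym 6)) where

  private
    module τ = GroupHomomorphism τ

  moved-cycle³ : ∀ i → moved (⟦ τ ⟧ (cycle³ i)) ≡ moved (⟦ τ ⟧ (cycle³ 0F))
  moved-cycle³ i = trans (moved-cong (⟦ τ ⟧ (cycle³ i)) (⟦ τ ⟧ (cycle³ 0F) ^ ⟦ τ ⟧ (shift³ i)) conj) (moved-^ (⟦ τ ⟧ (shift³ i)) (⟦ τ ⟧ (cycle³ 0F)))
    where
    conj : ⟦ τ ⟧ (cycle³ i) Perm.≈ ⟦ τ ⟧ (cycle³ 0F) ^ ⟦ τ ⟧ (shift³ i)
    conj j = begin
      ⟦ τ ⟧ (cycle³ i) ⟨$⟩ʳ j
        ≡⟨ τ.⟦⟧-cong {cycle³ i} {h⁻¹ A₆.∙ cycle³ 0F A₆.∙ h} (cycle³-conjugate i) j ⟩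
      ⟦ τ ⟧ (h⁻¹ A₆.∙ cycle³ 0F A₆.∙ h) ⟨$⟩ʳ j
        ≡⟨ τ.homo (h⁻¹ A₆.∙ cycle³ 0F) h j ⟩
      ⟦ τ ⟧ h ⟨$⟩ʳ (⟦ τ ⟧ (h⁻¹ A₆.∙ cycle³ 0F) ⟨$⟩ʳ j)
        ≡⟨ cong (⟦ τ ⟧ h ⟨$⟩ʳ_) (τ.homo h⁻¹ (cycle³ 0F) j) ⟩
      ⟦ τ ⟧ h ⟨$⟩ʳ (⟦ τ ⟧ (cycle³ 0F) ⟨$⟩ʳ (⟦ τ ⟧ h⁻¹ ⟨$⟩ʳ j))
        ≡⟨ cong (λ x → ⟦ τ ⟧ h ⟨$⟩ʳ (⟦ τ ⟧ (cycle³ 0F) ⟨$⟩ʳ x)) (τ.⁻¹-homo h j) ⟩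
      (⟦ τ ⟧ (cycle³ 0F) ^ ⟦ τ ⟧ h) ⟨$⟩ʳ j ∎
      where
      open ≡-Reasoning
      h = shift³ i
      h⁻¹ = h A₆.⁻¹

  module _ (g : Permutation′ 6) where

    AgreesAt : A₆.Carrier → Set
    AgreesAt x = ⟦ τ ⟧ x Perm.≈ proj₁ x ^ g

    agrees-resp : ∀ x y → x A₆.≈ y → AgreesAt x → AgreesAt y
    agrees-resp x y x≈y ax i = trans (sym (τ.⟦⟧-cong {x} {y} x≈y i)) (trans (ax i) (^-cong g (proj₁ x) (proj₁ y) x≈y i))

    agrees-∙ : ∀ x y → AgreesAt x → AgreesAt y → AgreesAt (x A₆.∙ y)
    agrees-∙ x y ax ay i = trans (τ.homo x y i)
      (trans (∘ₚ-cong (⟦ τ ⟧ x) (proj₁ x ^ g) (⟦ τ ⟧ y) (proj₁ y ^ g) ax ay i) (sym (^-homo g (proj₁ x) (proj₁ y) i)))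

    agrees-ε : AgreesAt A₆.ε
    agrees-ε i = trans (τ.ε-homo i) (sym (Perm.inverseʳ g))

    agrees-⁻¹ : ∀ x → AgreesAt x → AgreesAt (x A₆.⁻¹)
    agrees-⁻¹ x ax i = trans (τ.⁻¹-homo x i) (flip-cong {π = ⟦ τ ⟧ x} {proj₁ x ^ g} ax i)

    module _ (agrees-cycle³ : ∀ i → AgreesAt (cycle³ i)) where

      agrees-cycle³₀ : ∀ a → AgreesAt (cycle³₀ a)
      agrees-cycle³₀ zero    = agrees-ε
      agrees-cycle³₀ (suc i) = agrees-cycle³ i

      agrees-starPair : ∀ a b → AgreesAt (starPair a b)
      agrees-starPair a b = agrees-resp (cycle³₀ a A₆.⁻¹ A₆.∙ cycle³₀ b) (starPair a b)
        (λ i → sym (starPair-cycle³ a b i))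
        (agrees-∙ (cycle³₀ a A₆.⁻¹) (cycle³₀ b) (agrees-⁻¹ (cycle³₀ a) (agrees-cycle³₀ a)) (agrees-cycle³₀ b))

      -- Transpositions are consumed in pairs. With s for `star`, the product of two is (sₐ s_b
      -- sₐ)(s_c s_d s_c), which regroups into the three even factors sₐ s_b, sₐ s_c and s_d s_c.
      agrees-product : (ts : TranspositionList 6) → All (λ ij → proj₁ ij ≢ proj₂ ij) ts → 2 ∣ length ts →
        ∃[ y ] (proj₁ y Perm.≈ eval ts × AgreesAt y)
      agrees-product []           _  _  = A₆.ε , (λ _ → refl) , agrees-ε
      agrees-product (_ ∷ [])     _  ev = contradiction ev (from-no (2 ∣? 1))
      agrees-product ((i , j) ∷ (k , l) ∷ ts) (i≢j ∷ k≢l ∷ ds) ev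
        with transpose-star i j i≢j | transpose-star k l k≢l | agrees-product ts ds (∣m+n∣m⇒∣n ev ∣-refl)
      ... | a , b , e | c , d , e′ | y , y≈ , ay =
        z ,
        (λ x → trans (cong (λ w → proj₁ y ⟨$⟩ʳ ((star c ∘ₚ star d) ∘ₚ star c ⟨$⟩ʳ w)) (sym (e x)))
                 (trans (cong (proj₁ y ⟨$⟩ʳ_) (sym (e′ (transpose i j ⟨$⟩ʳ x)))) (y≈ _))) ,
        agrees-∙ z₂ y (agrees-∙ z₁ (starPair d c)
          (agrees-∙ (starPair a b) (starPair a c) (agrees-starPair a b) (agrees-starPair a c))
          (agrees-starPair d c)) ay
        where
        z₁ = starPair a b A₆.∙ starPair a c
        z₂ = z₁ A₆.∙ starPair d c
        z  = z₂ A₆.∙ y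

      agrees : ∀ x → AgreesAt x
      agrees x@(_ , ts , ds , ev , ts≈x) with agrees-product ts ds ev
      ... | y , y≈ , ay = agrees-resp y x (λ i → trans (y≈ i) (ts≈x i)) ay

  module _ (kernel : ∀ x → ⟦ τ ⟧ x Perm.≈ Perm.id → x A₆.≈ A₆.ε) where

    private
      d : Fin 4 → Permutation′ 6
      d i = ⟦ τ ⟧ (cycle³ i)

      dd : ∀ i j → ⟦ τ ⟧ (cycle³ i A₆.∙ cycle³ j) Perm.≈ d i ∘ₚ d j
      dd i j = τ.homo (cycle³ i) (cycle³ j)

      dd≉id : ∀ i j → i ≢ j → ¬ d i ∘ₚ d j Perm.≈ Perm.id
      dd≉id i j i≢j dd≈id = cycle³-product-≉ε i j i≢j
        (kernel (cycle³ i A₆.∙ cycle³ j) λ x → trans (dd i j x) (dd≈id x))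

      dd²≈id : ∀ i j → i ≢ j → (d i ∘ₚ d j) ∘ₚ (d i ∘ₚ d j) Perm.≈ Perm.id
      dd²≈id i j i≢j x = begin
        (d i ∘ₚ d j) ∘ₚ (d i ∘ₚ d j) ⟨$⟩ʳ x   ≡⟨ ∘ₚ-cong (⟦ τ ⟧ c) (d i ∘ₚ d j) (⟦ τ ⟧ c) (d i ∘ₚ d j) (dd i j) (dd i j) x ⟨
        ⟦ τ ⟧ c ∘ₚ ⟦ τ ⟧ c ⟨$⟩ʳ x             ≡⟨ τ.homo c c x ⟨
        ⟦ τ ⟧ (c A₆.∙ c) ⟨$⟩ʳ x               ≡⟨ τ.⟦⟧-cong {c A₆.∙ c} {A₆.ε} (cycle³-product-² i j i≢j) x ⟩
        ⟦ τ ⟧ A₆.ε ⟨$⟩ʳ x                     ≡⟨ τ.ε-homo x ⟩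
        x                                     ∎
        where
        open ≡-Reasoning
        c : A₆.Carrier
        c = cycle³ i A₆.∙ cycle³ j

    -- A trivial kernel preserves the order 2 of the pairwise products, so the images of the
    -- generating 3-cycles form a quadruple of the same kind, and the conjugating element found
    -- there works on all that they generate.
    embedding-inner : moved (⟦ τ ⟧ (cycle³ 0F)) ≡ 3 → ∃[ g ] (∀ x → AgreesAt g x)
    embedding-inner e = proj₁ conj , agrees (proj₁ conj) (proj₂ conj)
      where
      conj : ∃[ g ] (∀ i → AgreesAt g (cycle³ i))
      conj = threeCycles-conjugate d (λ i → trans (moved-cycle³ i) e)
        (λ i j i≢j → dd≉id i j i≢j , dd²≈id i j i≢j)

-- Orders of permutations of six points

-- In S₆ an element that moves at most three points has order at most 3; one of order 4 has type 4
-- or 4·2, and its square is a double transposition; one of order 3 moves three or six points, of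
-- which the bound 5 is all that is used.
MovesTwo MovesFour RootMovesFour MovesSix MovesEven : Pred (Word 6) 0ℓ
MovesTwo v      = v ≢ idʷ → 2 ≤ movedʷ v
MovesFour v     = v ⨾ v ≢ idʷ → v ⨾ v ⨾ v ≢ idʷ → 4 ≤ movedʷ v
RootMovesFour v = v ⨾ v ≢ idʷ → v ⨾ v ⨾ (v ⨾ v) ≡ idʷ → movedʷ (v ⨾ v) ≡ 4
MovesSix v      = v ≢ idʷ → v ⨾ v ⨾ v ≡ idʷ → movedʷ v ≢ 3 → 5 ≤ movedʷ v
MovesEven v     = v ≢ idʷ → v ⨾ v ≡ idʷ → movedʷ v ≡ 2 ⊎ movedʷ v ≡ 4 ⊎ movedʷ v ≡ 6

-- The element (0 2 1 3)(4 5), an even square root of (0 1)(2 3).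
root : A₆.Carrier
root = starPair 1F 0F A₆.∙ even-pair 0F 3F 4F 5F (λ ()) (λ ())

movedByRep : Vec ℕ 11
movedByRep = 0 ∷ 2 ∷ 4 ∷ 6 ∷ 3 ∷ 5 ∷ 6 ∷ 4 ∷ 6 ∷ 5 ∷ 6 ∷ []

opaque
  unfolding rep threeCycleʷ

  movesTwo : ∀ π → MovesTwo ⌜ π ⌝
  movesTwo = permutationwise? {P = MovesTwo} (λ v → ¬? (v ≟ʷ idʷ) →-dec (2 ℕ.≤? movedʷ v)) refl

  movesFour : ∀ π → MovesFour ⌜ π ⌝
  movesFour = permutationwise? {P = MovesFour}
    (λ v → ¬? ((v ⨾ v) ≟ʷ idʷ) →-dec ¬? ((v ⨾ v ⨾ v) ≟ʷ idʷ) →-dec (4 ℕ.≤? movedʷ v)) refl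

  rootMovesFour : ∀ π → RootMovesFour ⌜ π ⌝
  rootMovesFour = permutationwise? {P = RootMovesFour}
    (λ v → ¬? ((v ⨾ v) ≟ʷ idʷ) →-dec ((v ⨾ v ⨾ (v ⨾ v)) ≟ʷ idʷ) →-dec (movedʷ (v ⨾ v) ℕ.≟ 4)) refl

  movesSix : ∀ π → MovesSix ⌜ π ⌝
  movesSix = permutationwise? {P = MovesSix}
    (λ v → ¬? (v ≟ʷ idʷ) →-dec ((v ⨾ v ⨾ v) ≟ʷ idʷ) →-dec ¬? (movedʷ v ℕ.≟ 3) →-dec (5 ℕ.≤? movedʷ v)) refl

  movesEven : ∀ π → MovesEven ⌜ π ⌝
  movesEven = permutationwise? {P = MovesEven}
    (λ v → ¬? (v ≟ʷ idʷ) →-dec ((v ⨾ v) ≟ʷ idʷ) →-dec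
      ((movedʷ v ℕ.≟ 2) ⊎-dec (movedʷ v ℕ.≟ 4) ⊎-dec (movedʷ v ℕ.≟ 6))) refl

  rep₁≈star : rep 1F Perm.≈ star 0F
  rep₁≈star = from-yes (rep 1F ≈? star 0F)

  rep₄≈threeCycle : rep 4F Perm.≈ threeCycle 0F
  rep₄≈threeCycle = from-yes (rep 4F ≈? threeCycle 0F)

  root²≈rep₂ : proj₁ root ∘ₚ proj₁ root Perm.≈ rep 2F
  root²≈rep₂ = from-yes ((proj₁ root ∘ₚ proj₁ root) ≈? rep 2F)

  rep₂²≈id : rep 2F ∘ₚ rep 2F Perm.≈ Perm.id
  rep₂²≈id = from-yes ((rep 2F ∘ₚ rep 2F) ≈? Perm.id)

  involution-rep : ∀ k → moved (rep k) ≡ 4 → rep k ∘ₚ rep k Perm.≈ Perm.id → k ≡ 2F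
  involution-rep = from-yes (all? λ k → (moved (rep k) ℕ.≟ 4) →-dec ((rep k ∘ₚ rep k) ≈? Perm.id) →-dec (k ≟ 2F))

  rep₄³≈id : (rep 4F ∘ₚ rep 4F) ∘ₚ rep 4F Perm.≈ Perm.id
  rep₄³≈id = from-yes (((rep 4F ∘ₚ rep 4F) ∘ₚ rep 4F) ≈? Perm.id)

  rep²≉id : ∀ k → k ≡ 5F ⊎ k ≡ 7F ⊎ k ≡ 9F → ¬ rep k ∘ₚ rep k Perm.≈ Perm.id
  rep²≉id = from-yes (all? λ k → ((k ≟ 5F) ⊎-dec (k ≟ 7F) ⊎-dec (k ≟ 9F)) →-dec ¬? ((rep k ∘ₚ rep k) ≈? Perm.id))

  rep³≉id : ∀ k → k ≡ 5F ⊎ k ≡ 7F ⊎ k ≡ 9F → ¬ (rep k ∘ₚ rep k) ∘ₚ rep k Perm.≈ Perm.id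
  rep³≉id = from-yes (all? λ k → ((k ≟ 5F) ⊎-dec (k ≟ 7F) ⊎-dec (k ≟ 9F)) →-dec ¬? (((rep k ∘ₚ rep k) ∘ₚ rep k) ≈? Perm.id))

  rep-≉id : ∀ k → k ≢ 0F → ¬ rep k Perm.≈ Perm.id
  rep-≉id = from-yes (all? λ k → ¬? (k ≟ 0F) →-dec ¬? (rep k ≈? Perm.id))

  moved-rep : ∀ k → moved (rep k) ≡ lookup movedByRep k
  moved-rep = from-yes (all? λ k → moved (rep k) ℕ.≟ lookup movedByRep k)

module _ (π : Permutation′ n) where

  ⌜⌝≡id⇒ : ⌜ π ⌝ ≡ idʷ → π Perm.≈ Perm.id
  ⌜⌝≡id⇒ = ⌜⌝-injective π Perm.id

  ⌜∘∘⌝ : ⌜ (π ∘ₚ π) ∘ₚ π ⌝ ≡ ⌜ π ⌝ ⨾ ⌜ π ⌝ ⨾ ⌜ π ⌝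
  ⌜∘∘⌝ = trans (⌜∘ₚ⌝ (π ∘ₚ π) π) (cong (_⨾ ⌜ π ⌝) (⌜∘ₚ⌝ π π))

module _ (π : Permutation′ 6) where

  2≤moved : ¬ π Perm.≈ Perm.id → 2 ≤ moved π
  2≤moved π≉id = subst (2 ≤_) (moved-⌜⌝ π) (movesTwo π (π≉id ∘ ⌜⌝≡id⇒ π))

  4≤moved : ¬ π ∘ₚ π Perm.≈ Perm.id → ¬ (π ∘ₚ π) ∘ₚ π Perm.≈ Perm.id → 4 ≤ moved π
  4≤moved π²≉id π³≉id = subst (4 ≤_) (moved-⌜⌝ π) (movesFour π
    (λ e → π²≉id (⌜⌝≡id⇒ (π ∘ₚ π) (trans (⌜∘ₚ⌝ π π) e)))
    (λ e → π³≉id (⌜⌝≡id⇒ ((π ∘ₚ π) ∘ₚ π) (trans (⌜∘∘⌝ π) e))))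

  moved-square : ¬ π ∘ₚ π Perm.≈ Perm.id → (π ∘ₚ π) ∘ₚ (π ∘ₚ π) Perm.≈ Perm.id → moved (π ∘ₚ π) ≡ 4
  moved-square π²≉id π⁴≈id = trans (sym (trans (cong movedʷ (sym (⌜∘ₚ⌝ π π))) (moved-⌜⌝ (π ∘ₚ π)))) (rootMovesFour π
    (λ e → π²≉id (⌜⌝≡id⇒ (π ∘ₚ π) (trans (⌜∘ₚ⌝ π π) e)))
    (trans (sym (trans (⌜∘ₚ⌝ (π ∘ₚ π) (π ∘ₚ π)) (cong₂ _⨾_ (⌜∘ₚ⌝ π π) (⌜∘ₚ⌝ π π))))
      (⌜⌝-cong ((π ∘ₚ π) ∘ₚ (π ∘ₚ π)) Perm.id π⁴≈id)))

  moved-square≢2 : moved (π ∘ₚ π) ≢ 2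
  moved-square≢2 e = square-not-transposition π
    (trans (cong movedʷ (sym (⌜∘ₚ⌝ π π))) (trans (moved-⌜⌝ (π ∘ₚ π)) e))

  5≤moved : ¬ π Perm.≈ Perm.id → (π ∘ₚ π) ∘ₚ π Perm.≈ Perm.id → moved π ≢ 3 → 5 ≤ moved π
  5≤moved π≉id π³≈id ≢3 = subst (5 ≤_) (moved-⌜⌝ π) (movesSix π (π≉id ∘ ⌜⌝≡id⇒ π)
    (trans (sym (⌜∘∘⌝ π)) (⌜⌝-cong ((π ∘ₚ π) ∘ₚ π) Perm.id π³≈id))
    (λ e → ≢3 (trans (sym (moved-⌜⌝ π)) e)))

  moved-involution : ¬ π Perm.≈ Perm.id → π ∘ₚ π Perm.≈ Perm.id → moved π ≡ 2 ⊎ moved π ≡ 4 ⊎ moved π ≡ 6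
  moved-involution π≉id π²≈id = subst (λ m → m ≡ 2 ⊎ m ≡ 4 ⊎ m ≡ 6) (moved-⌜⌝ π) (movesEven π (π≉id ∘ ⌜⌝≡id⇒ π)
    (trans (sym (⌜∘ₚ⌝ π π)) (⌜⌝-cong (π ∘ₚ π) Perm.id π²≈id)))

-- Stated for two embeddings of an abstract group in order to serve S₆ and A₆ alike. With both
-- kernels trivial, the equations t² = 1 and t³ = 1 hold in one image iff they hold in the other.
module PairBound {T : Group ℓc ℓ} (ι τ : Hom T (Sym 6))
  (ι-kernel : ∀ x → ⟦ ι ⟧ x Perm.≈ Perm.id → Group._≈_ T x (Group.ε T))
  (τ-kernel : ∀ x → ⟦ τ ⟧ x Perm.≈ Perm.id → Group._≈_ T x (Group.ε T))
  where

  open Group T using (Carrier; _≈_; _∙_; ε)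

  private
    module ι = GroupHomomorphism ι

    homo² : (φ : Hom T (Sym 6)) → ∀ t → ⟦ φ ⟧ (t ∙ t) Perm.≈ ⟦ φ ⟧ t ∘ₚ ⟦ φ ⟧ t
    homo² φ t = GroupHomomorphism.homo φ t t

    homo³ : (φ : Hom T (Sym 6)) → ∀ t → ⟦ φ ⟧ (t ∙ t ∙ t) Perm.≈ (⟦ φ ⟧ t ∘ₚ ⟦ φ ⟧ t) ∘ₚ ⟦ φ ⟧ t
    homo³ φ t i = trans (GroupHomomorphism.homo φ (t ∙ t) t i) (cong (⟦ φ ⟧ t ⟨$⟩ʳ_) (homo² φ t i))

    ε⇒id : (φ : Hom T (Sym 6)) → ∀ {t} → t ≈ ε → ⟦ φ ⟧ t Perm.≈ Perm.id
    ε⇒id φ e i = trans (GroupHomomorphism.⟦⟧-cong φ e i) (GroupHomomorphism.ε-homo φ i)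

    square : Permutation′ 6 → Permutation′ 6
    square π = π ∘ₚ π

    cube : Permutation′ 6 → Permutation′ 6
    cube π = (π ∘ₚ π) ∘ₚ π

    square-cong : (π σ : Permutation′ 6) → π Perm.≈ σ → square π Perm.≈ square σ
    square-cong π σ e = ∘ₚ-cong π σ π σ e e

    cube-cong : (π σ : Permutation′ 6) → π Perm.≈ σ → cube π Perm.≈ cube σ
    cube-cong π σ e = ∘ₚ-cong (square π) (square σ) π σ (square-cong π σ e) e

    square-id⇒ : ∀ t π → ⟦ ι ⟧ t Perm.≈ π → square π Perm.≈ Perm.id → square (⟦ τ ⟧ t) Perm.≈ Perm.id
    square-id⇒ t π e s i = trans (sym (homo² τ t i)) (ε⇒id τ (ι-kernel (t ∙ t) (λ j →
      trans (homo² ι t j) (trans (square-cong (⟦ ι ⟧ t) π e j) (s j)))) i)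

    cube-id⇒ : ∀ t π → ⟦ ι ⟧ t Perm.≈ π → cube π Perm.≈ Perm.id → cube (⟦ τ ⟧ t) Perm.≈ Perm.id
    cube-id⇒ t π e s i = trans (sym (homo³ τ t i)) (ε⇒id τ (ι-kernel (t ∙ t ∙ t) (λ j →
      trans (homo³ ι t j) (trans (cube-cong (⟦ ι ⟧ t) π e j) (s j)))) i)

    square-id⇐ : ∀ t π → ⟦ ι ⟧ t Perm.≈ π → square (⟦ τ ⟧ t) Perm.≈ Perm.id → square π Perm.≈ Perm.id
    square-id⇐ t π e s i = trans (sym (square-cong (⟦ ι ⟧ t) π e i)) (trans (sym (homo² ι t i))
      (ε⇒id ι (τ-kernel (t ∙ t) (λ j → trans (homo² τ t j) (s j))) i))

    cube-id⇐ : ∀ t π → ⟦ ι ⟧ t Perm.≈ π → cube (⟦ τ ⟧ t) Perm.≈ Perm.id → cube π Perm.≈ Perm.id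
    cube-id⇐ t π e s i = trans (sym (cube-cong (⟦ ι ⟧ t) π e i)) (trans (sym (homo³ ι t i))
      (ε⇒id ι (τ-kernel (t ∙ t ∙ t) (λ j → trans (homo³ τ t j) (s j))) i))

    id⇐ : ∀ t π → ⟦ ι ⟧ t Perm.≈ π → ⟦ τ ⟧ t Perm.≈ Perm.id → π Perm.≈ Perm.id
    id⇐ t π e s i = trans (sym (e i)) (ε⇒id ι (τ-kernel t s) i)

  module _ (r : Carrier) (ιr≈root : ⟦ ι ⟧ r Perm.≈ proj₁ root) where

    r²≈rep₂ : ⟦ ι ⟧ (r ∙ r) Perm.≈ rep 2F
    r²≈rep₂ i = trans (homo² ι r i) (trans (square-cong (⟦ ι ⟧ r) (proj₁ root) ιr≈root i) (root²≈rep₂ i))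

    -- Here t = r², and `τ` preserves the order 4 of r; the square of an element of order 4 moves
    -- exactly four points.
    moved-double-transposition : ∀ t → ⟦ ι ⟧ t Perm.≈ rep 2F → moved (⟦ τ ⟧ t) ≡ 4
    moved-double-transposition t ιt≈rep = trans (moved-cong (⟦ τ ⟧ t) (square (⟦ τ ⟧ r)) t≈r²)
      (moved-square (⟦ τ ⟧ r)
        (λ e → rep-≉id 2F (λ ()) (λ i → trans (sym (root²≈rep₂ i)) (square-id⇐ r (proj₁ root) ιr≈root e i)))
        (λ i → trans (sym (square-cong (⟦ τ ⟧ (r ∙ r)) (square (⟦ τ ⟧ r)) (homo² τ r) i))
                 (square-id⇒ (r ∙ r) (rep 2F) r²≈rep₂ rep₂²≈id i)))
      where
      t≈r² : ⟦ τ ⟧ t Perm.≈ square (⟦ τ ⟧ r)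
      t≈r² i = trans (GroupHomomorphism.⟦⟧-cong τ t≈rr i) (homo² τ r i)
        where
        open Group T using (_⁻¹)
        open import Algebra.Properties.Group T using (x∙y⁻¹≈ε⇒x≈y)
        t≈rr : t ≈ r ∙ r
        t≈rr = x∙y⁻¹≈ε⇒x≈y t (r ∙ r) (ι-kernel (t ∙ (r ∙ r) ⁻¹) λ j →
          trans (ι.homo t ((r ∙ r) ⁻¹) j) (trans (ι.⁻¹-homo (r ∙ r) (⟦ ι ⟧ t ⟨$⟩ʳ j))
            (trans (cong (⟦ ι ⟧ (r ∙ r) ⟨$⟩ˡ_) (trans (ιt≈rep j) (sym (r²≈rep₂ j)))) (Perm.inverseˡ (⟦ ι ⟧ (r ∙ r))))))

    -- The classes that move six points need only two more. The types 3·2, 5 and 4 move at least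
    -- four, and their orders 6, 5 and 4 force four more. A 3-cycle gains at least five, since its
    -- image has order 3 and does not move three points. Transpositions are left to S₆, for A₆
    -- contains none.
    pair-bound : ∀ t k → ⟦ ι ⟧ t Perm.≈ rep k → k ≢ 0F → k ≢ 1F → (k ≡ 4F → moved (⟦ τ ⟧ t) ≢ 3) →
      8 ≤ moved (⟦ ι ⟧ t) + moved (⟦ τ ⟧ t)
    pair-bound t k ιt≈rep k≢0 k≢1 ≢3 = subst (λ m → 8 ≤ m + moved (⟦ τ ⟧ t))
      (sym (trans (moved-cong (⟦ ι ⟧ t) (rep k) ιt≈rep) (moved-rep k)))
      (cases k ιt≈rep k≢0 k≢1 ≢3)
      where
      nontrivial : ∀ k → k ≢ 0F → ⟦ ι ⟧ t Perm.≈ rep k → ¬ ⟦ τ ⟧ t Perm.≈ Perm.id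
      nontrivial k k≢0 e s = rep-≉id k k≢0 (id⇐ t (rep k) e s)

      two : ∀ k → k ≢ 0F → ⟦ ι ⟧ t Perm.≈ rep k → 8 ≤ 6 + moved (⟦ τ ⟧ t)
      two k k≢0 e = ℕ.+-monoʳ-≤ 6 (2≤moved (⟦ τ ⟧ t) (nontrivial k k≢0 e))

      four : ∀ k → k ≡ 5F ⊎ k ≡ 7F ⊎ k ≡ 9F → ⟦ ι ⟧ t Perm.≈ rep k → 4 ≤ moved (⟦ τ ⟧ t)
      four k k∈ e = 4≤moved (⟦ τ ⟧ t)
        (λ s → rep²≉id k k∈ (square-id⇐ t (rep k) e s)) (λ s → rep³≉id k k∈ (cube-id⇐ t (rep k) e s))

      five : 4 ≤ moved (⟦ τ ⟧ t) → 8 ≤ 5 + moved (⟦ τ ⟧ t)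
      five 4≤ = ℕ.≤-trans (ℕ.n≤1+n 8) (ℕ.+-monoʳ-≤ 5 4≤)

      cases : ∀ k → ⟦ ι ⟧ t Perm.≈ rep k → k ≢ 0F → k ≢ 1F → (k ≡ 4F → moved (⟦ τ ⟧ t) ≢ 3) →
        8 ≤ lookup movedByRep k + moved (⟦ τ ⟧ t)
      cases 0F e k≢0 k≢1 ≢3 = contradiction refl k≢0
      cases 1F e k≢0 k≢1 ≢3 = contradiction refl k≢1
      cases 2F e k≢0 k≢1 ≢3 = ℕ.≤-reflexive (cong (4 +_) (sym (moved-double-transposition t e)))
      cases 3F e k≢0 k≢1 ≢3 = two 3F k≢0 e
      cases 4F e k≢0 k≢1 ≢3 = ℕ.+-monoʳ-≤ 3 (5≤moved (⟦ τ ⟧ t) (nontrivial 4F k≢0 e)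
        (cube-id⇒ t (rep 4F) e rep₄³≈id) (≢3 refl))
      cases 5F e k≢0 k≢1 ≢3 = five (four 5F (inj₁ refl) e)
      cases 6F e k≢0 k≢1 ≢3 = two 6F k≢0 e
      cases 7F e k≢0 k≢1 ≢3 = ℕ.+-monoʳ-≤ 4 (four 7F (inj₂ (inj₁ refl)) e)
      cases 8F e k≢0 k≢1 ≢3 = two 8F k≢0 e
      cases 9F e k≢0 k≢1 ≢3 = five (four 9F (inj₂ (inj₂ refl)) e)
      cases (suc 9F) e k≢0 k≢1 ≢3 = two (suc 9F) k≢0 e

-- The outer automorphisms of S₆

kernel-of-iso : ∀ {c ℓ} {T : Group c ℓ} (σ : Hom T T) → IsAutomorphism T σ →
  ∀ x → Group._≈_ T (⟦ σ ⟧ x) (Group.ε T) → Group._≈_ T x (Group.ε T)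
kernel-of-iso {T = T} σ iso x e = GroupMorphisms.IsGroupIsomorphism.injective iso
  (Group.trans T e (Group.sym T (GroupHomomorphism.ε-homo σ)))

Reverses : Word 6 → Set
Reverses v = (∀ i → v ⨾ ⌜ threeCycle i ⌝ ⨾ v ≡ ⌜ star 0F ⌝ ⨾ ⌜ threeCycle i ⌝ ⨾ ⌜ star 0F ⌝) → v ≡ ⌜ star 0F ⌝

opaque
  reverses : ∀ π → Reverses ⌜ π ⌝
  reverses = permutationwise? {P = Reverses}
    (λ v → (all? λ i → (v ⨾ ⌜ threeCycle i ⌝ ⨾ v) ≟ʷ (⌜ star 0F ⌝ ⨾ ⌜ threeCycle i ⌝ ⨾ ⌜ star 0F ⌝)) →-dec
      (v ≟ʷ ⌜ star 0F ⌝)) refl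

  star-suc : ∀ i → star (suc i) Perm.≈ star 0F ∘ₚ threeCycle i
  star-suc = from-yes (all? λ i → star (suc i) ≈? (star 0F ∘ₚ threeCycle i))

  star₀²≈id : star 0F ∘ₚ star 0F Perm.≈ Perm.id
  star₀²≈id = from-yes ((star 0F ∘ₚ star 0F) ≈? Perm.id)

  star-conjugate : star 1F Perm.≈ star 0F ^ transpose 1F 2F
  star-conjugate = from-yes (star 1F ≈? (star 0F ^ transpose 1F 2F))

  transpose-same : (i : Fin 6) → transpose i i Perm.≈ Perm.id
  transpose-same = from-yes (all? {n = 6} λ i → transpose i i ≈? Perm.id)

  -- star 0F ∘ₚ threeCycle i ∘ₚ star 0F is even, being the inverse of a 3-cycle.
  star-threeCycle : ∀ i → (star 0F ∘ₚ threeCycle i) ∘ₚ star 0F Perm.≈ proj₁ (cycle³ i A₆.⁻¹)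
  star-threeCycle = from-yes (all? λ i → ((star 0F ∘ₚ threeCycle i) ∘ₚ star 0F) ≈? proj₁ (cycle³ i A₆.⁻¹))

homo-^ : ∀ {m n} (σ : Hom (Sym m) (Sym n)) → ∀ x g → ⟦ σ ⟧ (x ^ g) Perm.≈ ⟦ σ ⟧ x ^ ⟦ σ ⟧ g
homo-^ σ x g i = trans (σ.homo (Perm.flip g ∘ₚ x) g i) (cong (⟦ σ ⟧ g ⟨$⟩ʳ_)
  (trans (σ.homo (Perm.flip g) x i) (cong (⟦ σ ⟧ x ⟨$⟩ʳ_) (σ.⁻¹-homo g i))))
  where module σ = GroupHomomorphism σ

moved-conjugate-rep : (ρ : Hom (Sym 6) (Sym n)) → ∀ t k g → t Perm.≈ rep k ^ g →
  moved (⟦ ρ ⟧ t) ≡ moved (⟦ ρ ⟧ (rep k))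
moved-conjugate-rep ρ t k g t≈ = trans
  (moved-cong (⟦ ρ ⟧ t) (⟦ ρ ⟧ (rep k) ^ ⟦ ρ ⟧ g) λ i →
    trans (GroupHomomorphism.⟦⟧-cong ρ {t} {rep k ^ g} t≈ i) (homo-^ ρ (rep k) g i))
  (moved-^ (⟦ ρ ⟧ g) (⟦ ρ ⟧ (rep k)))

module _ (σ : Hom (Sym 6) (Sym 6)) where

  private
    module σ = GroupHomomorphism σ

    τ : Hom A₆ (Sym 6)
    τ = compose A₆ (Sym 6) (Sym 6) (inclusion (Alt 6)) σ

  -- S₆ is generated by A₆ and s = `star 0F`, so only σ(s) is in question. Let y be σ(s) conjugated
  -- back by `g`. For each 3-cycle c the product s c s is even, so the agreement on A₆ yields y c y
  -- = s c s; by enumeration this forces y = s.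
  inner-from-A₆ : ∀ g → (∀ x → AgreesAt τ g x) → ∀ x → ⟦ σ ⟧ x Perm.≈ x ^ g
  inner-from-A₆ g agree x i = trans (sym (σ.⟦⟧-cong {eval ts} {x} (eval-decompose x) i))
    (trans (onEval ts i) (^-cong g (eval ts) x (eval-decompose x) i))
    where
    Agrees : Permutation′ 6 → Set
    Agrees x = ⟦ σ ⟧ x Perm.≈ x ^ g

    ts : TranspositionList 6
    ts = decompose x

    resp : ∀ x y → x Perm.≈ y → Agrees y → Agrees x
    resp x y x≈y ay i = trans (σ.⟦⟧-cong {x} {y} x≈y i) (trans (ay i) (sym (^-cong g x y x≈y i)))

    product : ∀ x y → Agrees x → Agrees y → Agrees (x ∘ₚ y)
    product x y ax ay i = trans (σ.homo x y i)
      (trans (∘ₚ-cong (⟦ σ ⟧ x) (x ^ g) (⟦ σ ⟧ y) (y ^ g) ax ay i) (sym (^-homo g x y i)))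

    identity : Agrees Perm.id
    identity i = trans (σ.ε-homo i) (sym (Perm.inverseʳ g))

    y : Permutation′ 6
    y = ⟦ σ ⟧ (star 0F) ^ Perm.flip g

    y-reverses : ∀ i → (y ∘ₚ threeCycle i) ∘ₚ y Perm.≈ (star 0F ∘ₚ threeCycle i) ∘ₚ star 0F
    y-reverses i j = begin
      ((y ∘ₚ c) ∘ₚ y) ⟨$⟩ʳ j
        ≡⟨ ∘ₚ-cong (y ∘ₚ c) (y ∘ₚ c ^ g ^ g⁻) y y (∘ₚ-cong y y c (c ^ g ^ g⁻) (λ _ → refl) (λ x → sym (^-flip g c x))) (λ _ → refl) j ⟩
      ((y ∘ₚ c ^ g ^ g⁻) ∘ₚ y) ⟨$⟩ʳ j
        ≡⟨ ∘ₚ-cong (y ∘ₚ c ^ g ^ g⁻) ((σs ∘ₚ c ^ g) ^ g⁻) y y (λ x → sym (^-homo g⁻ σs (c ^ g) x)) (λ _ → refl) j ⟩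
      ((σs ∘ₚ c ^ g) ^ g⁻ ∘ₚ y) ⟨$⟩ʳ j
        ≡⟨ ^-homo g⁻ (σs ∘ₚ c ^ g) σs j ⟨
      (((σs ∘ₚ c ^ g) ∘ₚ σs) ^ g⁻) ⟨$⟩ʳ j
        ≡⟨ ^-cong g⁻ ((σs ∘ₚ c ^ g) ∘ₚ σs) (scs ^ g) inside j ⟩
      ((scs ^ g) ^ g⁻) ⟨$⟩ʳ j
        ≡⟨ ^-flip g scs j ⟩
      scs ⟨$⟩ʳ j ∎
      where
      open ≡-Reasoning
      c σs scs g⁻ : Permutation′ 6
      c = threeCycle i
      σs = ⟦ σ ⟧ (star 0F)
      scs = (star 0F ∘ₚ c) ∘ₚ star 0F
      g⁻ = Perm.flip g
      inside : (σs ∘ₚ c ^ g) ∘ₚ σs Perm.≈ scs ^ g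
      inside x = begin
        ((σs ∘ₚ c ^ g) ∘ₚ σs) ⟨$⟩ʳ x
          ≡⟨ cong (σs ⟨$⟩ʳ_) (agree (cycle³ i) (σs ⟨$⟩ʳ x)) ⟨
        ((σs ∘ₚ ⟦ σ ⟧ c) ∘ₚ σs) ⟨$⟩ʳ x
          ≡⟨ cong (σs ⟨$⟩ʳ_) (σ.homo (star 0F) c x) ⟨
        (⟦ σ ⟧ (star 0F ∘ₚ c) ∘ₚ σs) ⟨$⟩ʳ x
          ≡⟨ σ.homo (star 0F ∘ₚ c) (star 0F) x ⟨
        ⟦ σ ⟧ scs ⟨$⟩ʳ x
          ≡⟨ σ.⟦⟧-cong {scs} {proj₁ (cycle³ i A₆.⁻¹)} (star-threeCycle i) x ⟩
        ⟦ τ ⟧ (cycle³ i A₆.⁻¹) ⟨$⟩ʳ x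
          ≡⟨ agree (cycle³ i A₆.⁻¹) x ⟩
        (proj₁ (cycle³ i A₆.⁻¹) ^ g) ⟨$⟩ʳ x
          ≡⟨ ^-cong g scs (proj₁ (cycle³ i A₆.⁻¹)) (star-threeCycle i) x ⟨
        (scs ^ g) ⟨$⟩ʳ x ∎

    ⌜y⌝ : ⌜ y ⌝ ≡ ⌜ star 0F ⌝
    ⌜y⌝ = reverses y λ i → trans
      (sym (trans (⌜∘ₚ⌝ (y ∘ₚ threeCycle i) y) (cong (_⨾ ⌜ y ⌝) (⌜∘ₚ⌝ y (threeCycle i)))))
      (trans (⌜⌝-cong ((y ∘ₚ threeCycle i) ∘ₚ y) ((star 0F ∘ₚ threeCycle i) ∘ₚ star 0F) (y-reverses i))
        (trans (⌜∘ₚ⌝ (star 0F ∘ₚ threeCycle i) (star 0F)) (cong (_⨾ ⌜ star 0F ⌝) (⌜∘ₚ⌝ (star 0F) (threeCycle i)))))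

    onStar₀ : Agrees (star 0F)
    onStar₀ i = trans (sym (^-flip′ g (⟦ σ ⟧ (star 0F)) i))
      (^-cong g y (star 0F) (⌜⌝-injective y (star 0F) ⌜y⌝) i)
    onStar : ∀ a → Agrees (star a)
    onStar zero    = onStar₀
    onStar (suc a) = resp (star (suc a)) (star 0F ∘ₚ threeCycle a) (star-suc a)
      (product (star 0F) (threeCycle a) onStar₀ (agree (cycle³ a)))

    onTransposition : ∀ i j → Agrees (transpose i j)
    onTransposition i j = helper (i ≟ j)
      where
      helper : Dec (i ≡ j) → Agrees (transpose i j)
      helper (yes refl) = resp (transpose i i) Perm.id (transpose-same i) identity
      helper (no i≢j)   = resp (transpose i j) ((star a ∘ₚ star b) ∘ₚ star a) (proj₂ (proj₂ w))
        (product (star a ∘ₚ star b) (star a) (product (star a) (star b) (onStar a) (onStar b)) (onStar a))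
        where
        w : ∃[ a ] ∃[ b ] transpose i j Perm.≈ (star a ∘ₚ star b) ∘ₚ star a
        w = transpose-star i j i≢j
        a b : Fin 5
        a = proj₁ w
        b = proj₁ (proj₂ w)

    onEval : ∀ ts → Agrees (eval ts)
    onEval []             = identity
    onEval ((i , j) ∷ ts) = product (transpose i j) (eval ts) (onTransposition i j) (onEval ts)

module _ (σ : Hom (Sym 6) (Sym 6)) (auto : IsAutomorphism (Sym 6) σ) (outer : ¬ IsInner (Sym 6) σ) where

  private
    module σ = GroupHomomorphism σ

    kernel : ∀ x → ⟦ σ ⟧ x Perm.≈ Perm.id → x Perm.≈ Perm.id
    kernel = kernel-of-iso {T = Sym 6} σ auto

    I : Vector (PermRep (Sym 6) 6) 2
    I = idHom (Sym 6) Vector.∷ σ Vector.∷ Vector.[]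

    preimage : ∀ y → ∃[ x ] ⟦ σ ⟧ x Perm.≈ y
    preimage y = proj₁ s , proj₂ s {proj₁ s} λ _ → refl
      where s = GroupMorphisms.IsGroupIsomorphism.surjective auto y

    three-cycle : moved (⟦ σ ⟧ (threeCycle 0F)) ≢ 3
    three-cycle e = outer (proj₁ inner , inner-from-A₆ σ (proj₁ inner) (proj₂ inner))
      where
      inner = embedding-inner (compose A₆ (Sym 6) (Sym 6) (inclusion (Alt 6)) σ) (λ x → kernel (proj₁ x)) e

    open PairBound {T = Sym 6} (idHom (Sym 6)) σ (λ _ e → e) kernel

    σs : Permutation′ 6
    σs = ⟦ σ ⟧ (star 0F)

    star≉id : ¬ star 0F Perm.≈ Perm.id
    star≉id e = rep-≉id 1F (λ ()) (λ i → trans (rep₁≈star i) (e i))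

    moved-star : moved (star 0F) ≡ 2
    moved-star = trans (sym (moved-cong (rep 1F) (star 0F) rep₁≈star)) (moved-rep 1F)

    σs²≈id : σs ∘ₚ σs Perm.≈ Perm.id
    σs²≈id i = trans (sym (σ.homo (star 0F) (star 0F) i))
      (trans (σ.⟦⟧-cong {star 0F ∘ₚ star 0F} {Perm.id} star₀²≈id i) (σ.ε-homo i))

    -- A 3-cycle is a product of two transpositions, so its image would move at most four points;
    -- being of order 3 and not a 3-cycle, the image moves at least five.
    not-2 : moved σs ≢ 2
    not-2 e = ℕ.<⇒≱ (s≤s (begin
      moved (⟦ σ ⟧ (threeCycle 0F))            ≡⟨ moved-cong (⟦ σ ⟧ (threeCycle 0F)) (σs ∘ₚ ⟦ σ ⟧ (star 1F)) (σ.homo (star 0F) (star 1F)) ⟩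
      moved (σs ∘ₚ ⟦ σ ⟧ (star 1F))            ≤⟨ moved-∘ₚ σs (⟦ σ ⟧ (star 1F)) ⟩
      moved σs + moved (⟦ σ ⟧ (star 1F))       ≡⟨ cong₂ _+_ e (trans (moved-cong (⟦ σ ⟧ (star 1F)) (σs ^ ⟦ σ ⟧ h) conj) (trans (moved-^ (⟦ σ ⟧ h) σs) e)) ⟩
      4                                        ∎))
      (5≤moved (⟦ σ ⟧ (threeCycle 0F))
        (λ e → rep-≉id 4F (λ ()) λ i → trans (rep₄≈threeCycle i) (kernel (threeCycle 0F) e i))
        (λ i → trans (sym (trans (σ.homo (c ∘ₚ c) c i) (cong (⟦ σ ⟧ c ⟨$⟩ʳ_) (σ.homo c c i))))
          (trans (σ.⟦⟧-cong {(c ∘ₚ c) ∘ₚ c} {Perm.id} c³ i) (σ.ε-homo i)))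
        three-cycle)
      where
      open ℕ.≤-Reasoning
      c h : Permutation′ 6
      c = threeCycle 0F
      h = transpose 1F 2F
      c³ : (c ∘ₚ c) ∘ₚ c Perm.≈ Perm.id
      c³ i = trans (sym (∘ₚ-cong (rep 4F ∘ₚ rep 4F) (c ∘ₚ c) (rep 4F) c
        (∘ₚ-cong (rep 4F) c (rep 4F) c rep₄≈threeCycle rep₄≈threeCycle) rep₄≈threeCycle i)) (rep₄³≈id i)
      conj : ⟦ σ ⟧ (star 1F) Perm.≈ σs ^ ⟦ σ ⟧ h
      conj i = trans (σ.⟦⟧-cong {star 1F} {star 0F ^ h} star-conjugate i) (homo-^ σ (star 0F) h i)

    -- Double transpositions are squares, transpositions are not.
    not-4 : moved σs ≢ 4
    not-4 e = moved-square≢2 d (trans (moved-cong (d ∘ₚ d) (star 0F) d²≈star) moved-star)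
      where
      class = conjugate-to-rep σs
      κ : Fin 11
      κ = proj₁ class
      g : Permutation′ 6
      g = proj₁ (proj₂ class)
      σs≈κ : σs Perm.≈ rep κ ^ g
      σs≈κ = proj₂ (proj₂ class)
      κ≡2 : κ ≡ 2F
      κ≡2 = involution-rep κ (trans (sym (trans (moved-cong σs (rep κ ^ g) σs≈κ) (moved-^ g (rep κ)))) e)
        (λ i → begin
          (rep κ ∘ₚ rep κ) ⟨$⟩ʳ i                                ≡⟨ ^-flip g (rep κ ∘ₚ rep κ) i ⟨
          ((rep κ ∘ₚ rep κ) ^ g ^ Perm.flip g) ⟨$⟩ʳ i            ≡⟨ ^-cong (Perm.flip g) ((rep κ ∘ₚ rep κ) ^ g) (rep κ ^ g ∘ₚ rep κ ^ g) (^-homo g (rep κ) (rep κ)) i ⟩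
          ((rep κ ^ g ∘ₚ rep κ ^ g) ^ Perm.flip g) ⟨$⟩ʳ i        ≡⟨ ^-cong (Perm.flip g) (σs ∘ₚ σs) (rep κ ^ g ∘ₚ rep κ ^ g) (∘ₚ-cong σs (rep κ ^ g) σs (rep κ ^ g) σs≈κ σs≈κ) i ⟨
          ((σs ∘ₚ σs) ^ Perm.flip g) ⟨$⟩ʳ i                      ≡⟨ ^-cong (Perm.flip g) (σs ∘ₚ σs) Perm.id σs²≈id i ⟩
          (Perm.id ^ Perm.flip g) ⟨$⟩ʳ i                         ≡⟨ Perm.inverseˡ g ⟩
          i                                                      ∎)
        where open ≡-Reasoning
      σs≈ : σs Perm.≈ rep 2F ^ g
      σs≈ = subst (λ κ → σs Perm.≈ rep κ ^ g) κ≡2 σs≈κ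
      s d : Permutation′ 6
      s = proj₁ root
      d = proj₁ (preimage (s ^ g))
      d²≈star : d ∘ₚ d Perm.≈ star 0F
      d²≈star = GroupMorphisms.IsGroupIsomorphism.injective auto {d ∘ₚ d} {star 0F} λ i → begin
        ⟦ σ ⟧ (d ∘ₚ d) ⟨$⟩ʳ i              ≡⟨ σ.homo d d i ⟩
        (⟦ σ ⟧ d ∘ₚ ⟦ σ ⟧ d) ⟨$⟩ʳ i        ≡⟨ ∘ₚ-cong (⟦ σ ⟧ d) (s ^ g) (⟦ σ ⟧ d) (s ^ g) (proj₂ (preimage (s ^ g))) (proj₂ (preimage (s ^ g))) i ⟩
        (s ^ g ∘ₚ s ^ g) ⟨$⟩ʳ i            ≡⟨ ^-homo g s s i ⟨
        ((s ∘ₚ s) ^ g) ⟨$⟩ʳ i              ≡⟨ ^-cong g (s ∘ₚ s) (rep 2F) root²≈rep₂ i ⟩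
        (rep 2F ^ g) ⟨$⟩ʳ i                ≡⟨ σs≈ i ⟨
        σs ⟨$⟩ʳ i                          ∎
        where open ≡-Reasoning

    moved-σs : moved σs ≡ 6
    moved-σs = pick (moved-involution σs (λ e → star≉id (kernel (star 0F) e)) σs²≈id)
      where
      pick : moved σs ≡ 2 ⊎ moved σs ≡ 4 ⊎ moved σs ≡ 6 → moved σs ≡ 6
      pick (inj₁ e)        = contradiction e not-2
      pick (inj₂ (inj₁ e)) = contradiction e not-4
      pick (inj₂ (inj₂ e)) = e

    weight-rep : ∀ t k → t Perm.≈ rep k → k ≢ 0F → 8 ≤ moved t + moved (⟦ σ ⟧ t)
    weight-rep t k e k≢0 = helper (k ≟ 1F)
      where
      helper : Dec (k ≡ 1F) → 8 ≤ moved t + moved (⟦ σ ⟧ t)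
      helper (yes refl) = ℕ.≤-reflexive (sym (cong₂ _+_
        (trans (moved-cong t (star 0F) t≈star) moved-star)
        (trans (moved-cong (⟦ σ ⟧ t) σs (σ.⟦⟧-cong {t} {star 0F} t≈star)) moved-σs)))
        where
        t≈star : t Perm.≈ star 0F
        t≈star i = trans (e i) (rep₁≈star i)
      helper (no k≢1) = pair-bound (proj₁ root) (λ _ → refl) t k e k≢0 k≢1
        (λ { refl e′ → three-cycle (trans (moved-cong (⟦ σ ⟧ (threeCycle 0F)) (⟦ σ ⟧ t)
          (σ.⟦⟧-cong {threeCycle 0F} {t} λ i → sym (trans (e i) (rep₄≈threeCycle i)))) e′) })

    weight-bound : ∀ t → ¬ t Perm.≈ Perm.id → 8 ≤ weight {T = Sym 6} I t
    weight-bound t t≉id = subst (8 ≤_)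
      (cong₂ _+_ moved-t (trans moved-σt (sym (ℕ.+-identityʳ (moved (⟦ σ ⟧ t))))))
      (weight-rep (rep κ) κ (λ _ → refl) κ≢0)
      where
      class = conjugate-to-rep t
      κ : Fin 11
      κ = proj₁ class
      g : Permutation′ 6
      g = proj₁ (proj₂ class)
      t≈ : t Perm.≈ rep κ ^ g
      t≈ = proj₂ (proj₂ class)
      moved-t : moved (rep κ) ≡ moved t
      moved-t = sym (trans (moved-cong t (rep κ ^ g) t≈) (moved-^ g (rep κ)))
      moved-σt : moved (⟦ σ ⟧ (rep κ)) ≡ moved (⟦ σ ⟧ t)
      moved-σt = sym (moved-conjugate-rep σ t κ g t≈)
      κ≢0 : κ ≢ 0F
      κ≢0 κ≡0 = t≉id (moved≡0⇒≈id t (trans (sym moved-t) (trans (cong (moved ∘ rep) κ≡0) (moved-rep 0F))))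

  outer-improves : Improves (Sym 6) I 4 8
  outer-improves =
    δrep-intro {T = Sym 6} I (const 2) 0F (λ _ → s≤s z≤n)
      (λ { 0F → star 0F , moved-star
         ; 1F → s , trans (moved-cong (⟦ σ ⟧ s) (star 0F) (proj₂ (preimage (star 0F)))) moved-star })
      (λ { 0F t t≉id → 2≤moved t t≉id ; 1F t t≉id → 2≤moved (⟦ σ ⟧ t) (λ e → t≉id (kernel t e)) })
      (λ _ → ℕ.≤-refl) ,
    δtw-intro {T = Sym 6} I 8 (s≤s z≤n) (star 0F , cong₂ _+_ moved-star (cong (_+ 0) moved-σs)) weight-bound ,
    s≤s (s≤s (s≤s (s≤s (s≤s z≤n))))
    where
    s : Permutation′ 6
    s = proj₁ (preimage (star 0F))

-- The exceptional automorphisms of A₆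

-- The sign, computed from the number of inversions; true for even permutations.
opaque
  sgn : ∀ {m n} → Vec (Fin m) n → Bool
  sgn []      = true
  sgn {m} (x ∷ v) = smaller v
    where
    smaller : ∀ {k} → Vec (Fin m) k → Bool
    smaller []      = sgn v
    smaller (y ∷ w) = if does (y <? x) then not (smaller w) else smaller w

Alternates : Word 6 → Set
Alternates v = ∀ a → sgn (⌜ star a ⌝ ⨾ v) ≡ not (sgn v)

OddIfTransposition : Word 6 → Set
OddIfTransposition v = sgn v ≡ true → movedʷ v ≢ 2

opaque
  unfolding sgn

  sgn-id : sgn (idʷ {6}) ≡ true
  sgn-id = refl

  alternates : ∀ π → Alternates ⌜ π ⌝
  alternates = permutationwise? {P = Alternates} 
    (λ v → all? λ a → sgn (⌜ star a ⌝ ⨾ v) Bool.≟ not (sgn v)) refl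

  oddIfTransposition : ∀ π → OddIfTransposition ⌜ π ⌝
  oddIfTransposition = permutationwise? {P = OddIfTransposition}
    (λ v → (sgn v Bool.≟ true) →-dec ¬? (movedʷ v ℕ.≟ 2)) refl

sgn-star : ∀ a π → sgn ⌜ star a ∘ₚ π ⌝ ≡ not (sgn ⌜ π ⌝)
sgn-star a π = trans (cong sgn (⌜∘ₚ⌝ (star a) π)) (alternates π a)

-- A product of three stars flips the sign three times.
sgn-transpose : ∀ i j → i ≢ j → ∀ π → sgn ⌜ transpose i j ∘ₚ π ⌝ ≡ not (sgn ⌜ π ⌝)
sgn-transpose i j i≢j π = begin
  sgn ⌜ transpose i j ∘ₚ π ⌝                     ≡⟨ cong sgn (⌜⌝-cong (transpose i j ∘ₚ π) (star a ∘ₚ (star b ∘ₚ (star a ∘ₚ π))) (λ x → cong (π ⟨$⟩ʳ_) (ij≈aba x))) ⟩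
  sgn ⌜ star a ∘ₚ (star b ∘ₚ (star a ∘ₚ π)) ⌝    ≡⟨ sgn-star a (star b ∘ₚ (star a ∘ₚ π)) ⟩
  not (sgn ⌜ star b ∘ₚ (star a ∘ₚ π) ⌝)          ≡⟨ cong not (sgn-star b (star a ∘ₚ π)) ⟩
  not (not (sgn ⌜ star a ∘ₚ π ⌝))                ≡⟨ Bool.not-involutive (sgn ⌜ star a ∘ₚ π ⌝) ⟩
  sgn ⌜ star a ∘ₚ π ⌝                            ≡⟨ sgn-star a π ⟩
  not (sgn ⌜ π ⌝)                                ∎
  where
  open ≡-Reasoning
  w : ∃[ a ] ∃[ b ] transpose i j Perm.≈ (star a ∘ₚ star b) ∘ₚ star a
  w = transpose-star i j i≢j
  a b : Fin 5
  a = proj₁ w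
  b = proj₁ (proj₂ w)
  ij≈aba : transpose i j Perm.≈ (star a ∘ₚ star b) ∘ₚ star a
  ij≈aba = proj₂ (proj₂ w)

sgn-eval : (ts : TranspositionList 6) → All (λ ij → proj₁ ij ≢ proj₂ ij) ts → 2 ∣ length ts →
  sgn ⌜ eval ts ⌝ ≡ true
sgn-eval []                             _                _  = sgn-id
sgn-eval (_ ∷ [])                       _                ev = contradiction ev (from-no (2 ∣? 1))
sgn-eval ((i , j) ∷ (k , l) ∷ ts) (i≢j ∷ k≢l ∷ ds) ev = begin
  sgn ⌜ transpose i j ∘ₚ (transpose k l ∘ₚ eval ts) ⌝   ≡⟨ sgn-transpose i j i≢j (transpose k l ∘ₚ eval ts) ⟩
  not (sgn ⌜ transpose k l ∘ₚ eval ts ⌝)                ≡⟨ cong not (sgn-transpose k l k≢l (eval ts)) ⟩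
  not (not (sgn ⌜ eval ts ⌝))                           ≡⟨ Bool.not-involutive (sgn ⌜ eval ts ⌝) ⟩
  sgn ⌜ eval ts ⌝                                       ≡⟨ sgn-eval ts ds (∣m+n∣m⇒∣n ev ∣-refl) ⟩
  true                                                  ∎
  where open ≡-Reasoning

-- `Even` only asserts that some list of even length exists; the sign is the invariant that rules
-- out such a list for a transposition.
moved-even≢2 : (x : A₆.Carrier) → moved (proj₁ x) ≢ 2
moved-even≢2 (x , ts , ds , ev , ts≈x) e = oddIfTransposition x
  (trans (cong sgn (sym (⌜⌝-cong (eval ts) x ts≈x))) (sgn-eval ts ds ev))
  (trans (moved-⌜⌝ x) e)

3≤moved-even : (x : A₆.Carrier) → ¬ x A₆.≈ A₆.ε → 3 ≤ moved (proj₁ x)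
3≤moved-even x x≉ε = ℕ.≤∧≢⇒< (2≤moved (proj₁ x) x≉ε) (moved-even≢2 x ∘ sym)

-- Conjugation puts one transposition at each end of the list and keeps the parity of its length. A
-- pair with i = j must not enter the list, but it is the identity and changes nothing.
even-transpose : ∀ i j (x : Permutation′ n) → Even x → Even (x ^ transpose i j)
even-transpose i j x (ts , ds , ev , ts≈x) = helper (i ≟ j)
  where
  helper : Dec (i ≡ j) → Even (x ^ transpose i j)
  helper (no i≢j)   = (j , i) ∷ ts ++ (i , j) ∷ [] , (i≢j ∘ sym) ∷ ++⁺ ds (i≢j ∷ []) ,
    subst (2 ∣_) (cong suc (trans (ℕ.+-comm 1 (length ts)) (sym (length-++ ts)))) (∣m∣n⇒∣m+n ∣-refl ev) ,
    λ y → trans (eval-++ ts ((i , j) ∷ []) (transpose j i ⟨$⟩ʳ y)) (cong (transpose i j ⟨$⟩ʳ_) (ts≈x (transpose j i ⟨$⟩ʳ y)))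
  helper (yes refl) = ts , ds , ev , λ y → trans (ts≈x y) (sym (trans (transpose-same′ (x ⟨$⟩ʳ (transpose i i ⟨$⟩ʳ y)))
    (cong (x ⟨$⟩ʳ_) (transpose-same′ y))))
    where
    transpose-same′ : ∀ y → transpose i i ⟨$⟩ʳ y ≡ y
    transpose-same′ y with y ≟ i
    ... | yes refl = refl
    ... | no y≢i rewrite dec-false (y ≟ i) y≢i = refl

even-eval : (ts : TranspositionList n) (x : Permutation′ n) → Even x → Even (x ^ eval ts)
even-eval []             x ev = ev
even-eval ((i , j) ∷ ts) x ev = even-eval ts (x ^ transpose i j) (even-transpose i j x ev)

even-^ : (g x : Permutation′ n) → Even x → Even (x ^ g)
even-^ {n} g x ev = Subgroup.resp (Alt n) {x ^ eval (decompose g)} {x ^ g}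
  (λ i → trans (eval-decompose g _) (cong (λ y → g ⟨$⟩ʳ (x ⟨$⟩ʳ y)) (flip-cong {π = eval (decompose g)} {g} (eval-decompose g) i)))
  (even-eval (decompose g) x ev)

conjugation : Permutation′ 6 → Hom A₆ A₆
conjugation g = record
  { ⟦_⟧ = λ x → proj₁ x ^ g , even-^ g (proj₁ x) (proj₂ x)
  ; isGroupHomomorphism = record
    { isMonoidHomomorphism = record
      { isMagmaHomomorphism = record
        { isRelHomomorphism = record { cong = λ {x} {y} → ^-cong g (proj₁ x) (proj₁ y) }
        ; homo = λ x y → ^-homo g (proj₁ x) (proj₁ y)
        }
      ; ε-homo = λ _ → Perm.inverseʳ g
      }
    ; ⁻¹-homo = λ _ _ → refl
    }
  }

module _ (σ : Hom A₆ A₆) (auto : IsAutomorphism A₆ σ) (exceptional : ¬ InducedByConjugation (Alt 6) σ) where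

  private
    ι τ : Hom A₆ (Sym 6)
    ι = inclusion (Alt 6)
    τ = compose A₆ A₆ (Sym 6) σ ι

    -- The `g` that conjugates a representative to x may be odd, and then `τ` cannot be applied to
    -- it. Precomposing `τ` with conjugation by `g` moves it into the homomorphism: the value at the
    -- representative becomes the value of `τ` at x.
    τ^ : Permutation′ 6 → Hom A₆ (Sym 6)
    τ^ g = compose A₆ A₆ (Sym 6) (conjugation g) τ

    I : Vector (PermRep A₆ 6) 2
    I = ι Vector.∷ τ Vector.∷ Vector.[]

    kernel : ∀ x → ⟦ τ ⟧ x Perm.≈ Perm.id → x A₆.≈ A₆.ε
    kernel x e = kernel-of-iso {T = A₆} σ auto x e

    kernel^ : ∀ g x → ⟦ τ^ g ⟧ x Perm.≈ Perm.id → x A₆.≈ A₆.ε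
    kernel^ g x e i = trans (sym (^-flip g (proj₁ x) i))
      (trans (^-cong (Perm.flip g) (proj₁ x ^ g) Perm.id (kernel (⟦ conjugation g ⟧ x) e) i) (Perm.inverseˡ g))

    preimage : ∀ y → ∃[ x ] ⟦ σ ⟧ x A₆.≈ y
    preimage y = proj₁ s , proj₂ s {proj₁ s} λ _ → refl
      where s = GroupMorphisms.IsGroupIsomorphism.surjective auto y

    back : ∀ g → A₆.Carrier → A₆.Carrier
    back g x = proj₁ x ^ Perm.flip g , even-^ (Perm.flip g) (proj₁ x) (proj₂ x)

    τ^-back : ∀ g x → ⟦ τ^ g ⟧ (back g x) Perm.≈ ⟦ τ ⟧ x
    τ^-back g x = GroupHomomorphism.⟦⟧-cong τ {⟦ conjugation g ⟧ (back g x)} {x} (^-flip′ g (proj₁ x))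

    three-cycle : ∀ g → moved (⟦ τ^ g ⟧ (cycle³ 0F)) ≢ 3
    -- If `τ^ g` is conjugation by h, then `τ` is conjugation by g⁻¹h.
    three-cycle g e = exceptional (Perm.flip g ∘ₚ h , λ x i → trans (sym (τ^-back g x i)) (proj₂ inner (back g x) i))
      where
      inner = embedding-inner (τ^ g) (kernel^ g) e
      h : Permutation′ 6
      h = proj₁ inner

    weight-bound : ∀ x → ¬ x A₆.≈ A₆.ε → 8 ≤ weight {T = A₆} I x
    weight-bound x x≉ε = subst (8 ≤_)
      (cong₂ _+_ (moved-^ (Perm.flip g) (proj₁ x))
        (trans (moved-cong (⟦ τ^ g ⟧ (back g x)) (⟦ τ ⟧ x) (τ^-back g x)) (sym (ℕ.+-identityʳ (moved (⟦ τ ⟧ x))))))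
      (PairBound.pair-bound {T = A₆} ι (τ^ g) (λ _ e → e) (kernel^ g) root (λ _ → refl)
        (back g x) κ back≈ κ≢0 κ≢1 not-three)
      where
      class = conjugate-to-rep (proj₁ x)
      κ : Fin 11
      κ = proj₁ class
      g : Permutation′ 6
      g = proj₁ (proj₂ class)
      x≈ : proj₁ x Perm.≈ rep κ ^ g
      x≈ = proj₂ (proj₂ class)
      back≈ : proj₁ x ^ Perm.flip g Perm.≈ rep κ
      back≈ i = trans (^-cong (Perm.flip g) (proj₁ x) (rep κ ^ g) x≈ i) (^-flip g (rep κ) i)
      moved-x : moved (proj₁ x) ≡ moved (rep κ)
      moved-x = trans (moved-cong (proj₁ x) (rep κ ^ g) x≈) (moved-^ g (rep κ))
      κ≢0 : κ ≢ 0F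
      κ≢0 κ≡0 = x≉ε (moved≡0⇒≈id (proj₁ x) (trans moved-x (trans (cong (moved ∘ rep) κ≡0) (moved-rep 0F))))
      κ≢1 : κ ≢ 1F
      κ≢1 κ≡1 = moved-even≢2 x (trans moved-x (trans (cong (moved ∘ rep) κ≡1) (moved-rep 1F)))
      not-three : κ ≡ 4F → moved (⟦ τ^ g ⟧ (back g x)) ≢ 3
      not-three κ≡4 e = three-cycle g (trans
        (moved-cong (⟦ τ^ g ⟧ (cycle³ 0F)) (⟦ τ^ g ⟧ (back g x))
          (GroupHomomorphism.⟦⟧-cong (τ^ g) {cycle³ 0F} {back g x} λ i →
            trans (sym (rep₄≈threeCycle i)) (sym (subst (λ κ → proj₁ x ^ Perm.flip g Perm.≈ rep κ) κ≡4 back≈ i))))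
        e)

    moved-cycle : moved (proj₁ (cycle³ 0F)) ≡ 3
    moved-cycle = trans (sym (moved-cong (rep 4F) (threeCycle 0F) rep₄≈threeCycle)) (moved-rep 4F)

    root² : A₆.Carrier
    root² = root A₆.∙ root

    moved-root² : moved (proj₁ root²) ≡ 4
    moved-root² = trans (moved-cong (proj₁ root²) (rep 2F) root²≈rep₂) (moved-rep 2F)

  exceptional-improves : Improves A₆ I 6 8
  exceptional-improves =
    δrep-intro {T = A₆} I (const 3) 0F (λ _ → s≤s z≤n)
      (λ { 0F → cycle³ 0F , moved-cycle
         ; 1F → s , trans (moved-cong (⟦ τ ⟧ s) (threeCycle 0F) (proj₂ (preimage (cycle³ 0F)))) moved-cycle })
      (λ { 0F x x≉ε → 3≤moved-even x x≉ε ; 1F x x≉ε → 3≤moved-even (⟦ σ ⟧ x) (λ e → x≉ε (kernel x e)) })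
      (λ _ → ℕ.≤-refl) ,
    δtw-intro {T = A₆} I 8 (s≤s z≤n) (root² , cong₂ _+_ moved-root² (cong (_+ 0)
      (PairBound.moved-double-transposition {T = A₆} ι τ (λ _ e → e) kernel root (λ _ → refl) root² root²≈rep₂))) weight-bound ,
    ℕ.n≤1+n 7
    where
    s : A₆.Carrier
    s = proj₁ (preimage (cycle³ 0F))

_≟ᵛ_ : (x y : F₂^ n) → Dec (x ≡ y)
_≟ᵛ_ = ≡-dec Bool._≟_

_≟ᵐ_ : (M N : Matrix m n) → Dec (M ≡ N)
_≟ᵐ_ = ≡-dec _≟ᵛ_

-- Exhaustive checks over all invertible matrices

everyVector : ∀ n → (F₂^ n → Bool) → Bool
everyVector zero    P = P []
everyVector (suc n) P = everyVector n (P ∘ (true ∷_)) ∧ everyVector n (P ∘ (false ∷_))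

everyVector-sound : (P : F₂^ n → Bool) → everyVector n P ≡ true → ∀ x → P x ≡ true
everyVector-sound P e []          = e
everyVector-sound P e (true  ∷ x) = everyVector-sound (P ∘ (true ∷_)) (∧-trueˡ e) x
everyVector-sound P e (false ∷ x) = everyVector-sound (P ∘ (false ∷_)) (∧-trueʳ {everyVector _ (P ∘ (true ∷_))} e) x

outside : F₂^ n → Matrix m n → Bool
outside {m = m} v M = everyVector m λ x → not (does (v ≟ᵛ (x ⊛ M)))

-- Builds a matrix row by row, each new row outside the span of the others; for m = n = 3 only the
-- 168 invertible matrices are visited.
everyIndependent : ∀ m → (Matrix m n → Bool) → Bool
everyIndependent         zero    P = P []
everyIndependent {n = n} (suc m) P = everyIndependent m λ M → everyVector n λ v →
  if outside v M then P (v ∷ M) else true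

Independent : Matrix m n → Set
Independent M = ∀ x → x ⊛ M ≡ 𝟎 → x ≡ 𝟎

everyVector-complete : (P : F₂^ n → Bool) → (∀ x → P x ≡ true) → everyVector n P ≡ true
everyVector-complete {zero}  P e = e []
everyVector-complete {suc n} P e rewrite everyVector-complete (P ∘ (true ∷_)) (e ∘ (true ∷_)) =
  everyVector-complete (P ∘ (false ∷_)) (e ∘ (false ∷_))

everyIndependent-sound : ∀ m (P : Matrix m n → Bool) → everyIndependent m P ≡ true →
  ∀ M → Independent M → P M ≡ true
everyIndependent-sound zero    P e []      ind = e
everyIndependent-sound (suc m) P e (v ∷ M) ind = subst (λ b → (if b then P (v ∷ M) else true) ≡ true)
  (everyVector-complete (λ x → not (does (v ≟ᵛ (x ⊛ M)))) λ x → cong not (dec-false (v ≟ᵛ (x ⊛ M)) (v≢ x)))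
  (everyVector-sound _ (everyIndependent-sound m _ e M independent) v)
  where
  tail-≡ : {x y : F₂^ m} {a b : Bool} → a ∷ x ≡ b ∷ y → x ≡ y
  tail-≡ refl = refl

  independent : Independent M
  independent x xM≡0 = tail-≡ (ind (false ∷ x) (trans (cong₂ _⊕_ (false-· v) xM≡0) (⊕-identityˡ 𝟎)))

  v≢ : ∀ x → v ≢ x ⊛ M
  v≢ x v≡ with () ← ind (true ∷ x) (trans (cong₂ _⊕_ (trans (true-· v) v≡) refl) (⊕-self (x ⊛ M)))

invertible⇒independent : (M N : Matrix n n) → M ⊠ N ≡ 𝟙 → Independent M
invertible⇒independent M N MN x xM≡0 = begin
  x               ≡⟨ ⊛-𝟙 x ⟨
  x ⊛ 𝟙           ≡⟨ cong (x ⊛_) MN ⟨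
  x ⊛ (M ⊠ N)     ≡⟨ ⊛-⊠ x M N ⟩
  (x ⊛ M) ⊛ N     ≡⟨ cong (_⊛ N) xM≡0 ⟩
  𝟎 ⊛ N           ≡⟨ 𝟎-⊛ N ⟩
  𝟎               ∎
  where open ≡-Reasoning

⊛-cancel : (M N : Matrix n n) → M ⊠ N ≡ 𝟙 → ∀ x → (x ⊛ M) ⊛ N ≡ x
⊛-cancel M N MN x = trans (sym (⊛-⊠ x M N)) (trans (cong (x ⊛_) MN) (⊛-𝟙 x))

⊕-cancelˡ : (x y : F₂^ n) → x ⊕ (x ⊕ y) ≡ y
⊕-cancelˡ x y = trans (sym (⊕-assoc x x y)) (trans (cong (_⊕ y) (⊕-self x)) (⊕-identityˡ y))

⊕≡𝟎⇒≡ : (x y : F₂^ n) → x ⊕ y ≡ 𝟎 → x ≡ y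
⊕≡𝟎⇒≡ x y e = trans (sym (⊕-identityʳ x)) (trans (cong (x ⊕_) (sym e)) (⊕-cancelˡ x y))

matrix⁻-cong : (f g : Affine n) → matrix f ≡ matrix g → matrix⁻ f ≡ matrix⁻ g
matrix⁻-cong f g = ⊠-inverse-unique {M = matrix f} {matrix⁻ f} {matrix g} {matrix⁻ g} (leftInverse f) (rightInverse g)

-- Complements of the translation subgroup

-- A cocycle on GL(n,2), written as a function of the inverse matrix.
Cocycle : (Matrix n n → F₂^ n) → Set
Cocycle {n} c = ∀ (f g : Affine n) → c (matrix⁻ g ⊠ matrix⁻ f) ≡ c (matrix⁻ f) ⊛ matrix g ⊕ c (matrix⁻ g)

module _ (c : Matrix n n → F₂^ n) (cocycle : Cocycle c) where

  private
    module G = Group (AGL₂ n)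

    c-𝟙 : c 𝟙 ≡ 𝟎
    c-𝟙 = begin
      c 𝟙               ≡⟨ cong c (⊠-identityˡ 𝟙) ⟨
      c (𝟙 ⊠ 𝟙)         ≡⟨ cocycle G.ε G.ε ⟩
      c 𝟙 ⊛ 𝟙 ⊕ c 𝟙     ≡⟨ cong (_⊕ c 𝟙) (⊛-𝟙 (c 𝟙)) ⟩
      c 𝟙 ⊕ c 𝟙         ≡⟨ ⊕-self (c 𝟙) ⟩
      𝟎                 ∎
      where open ≡-Reasoning

  Graph : Subgroup (AGL₂ n) 0ℓ
  Graph = record
    { Mem    = λ f → shift f ≡ c (matrix⁻ f)
    ; resp   = λ {f} {g} (e , e′) f∈ → trans (sym e′) (trans f∈ (cong c (matrix⁻-cong f g e)))
    ; ∙-mem  = λ {f} {g} f∈ g∈ → trans (cong₂ (λ x y → x ⊛ matrix g ⊕ y) f∈ g∈) (sym (cocycle f g))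
    ; ε-mem  = sym c-𝟙
    ; ⁻¹-mem = λ {f} f∈ → trans (cong (_⊛ matrix⁻ f) f∈) (⊕≡𝟎⇒≡ _ _ (begin
        c (matrix⁻ f) ⊛ matrix⁻ f ⊕ c (matrix f)   ≡⟨ cocycle f (f G.⁻¹) ⟨
        c (matrix f ⊠ matrix⁻ f)                   ≡⟨ cong c (rightInverse f) ⟩
        c 𝟙                                        ≡⟨ c-𝟙 ⟩
        𝟎                                          ∎))
    }
    where open ≡-Reasoning

  -- The factor in the graph takes the linear part of `f` and the shift prescribed by `c`; a
  -- translation makes up the difference of the shifts.
  Graph-complement : Complement (Translations n) Graph
  Graph-complement =
    (λ f f∈ M≡𝟙 → M≡𝟙 , trans f∈ (trans (cong c (matrix⁻-cong f G.ε M≡𝟙)) c-𝟙)) ,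
    (λ f → record f { shift = c (matrix⁻ f) } ,
      record { matrix = 𝟙 ; matrix⁻ = 𝟙 ; shift = c (matrix⁻ f) ⊕ shift f
             ; rightInverse = ⊠-identityˡ 𝟙 ; leftInverse = ⊠-identityˡ 𝟙 } ,
      refl , refl , sym (⊠-identityʳ (matrix f)) ,
      sym (trans (cong (_⊕ (c (matrix⁻ f) ⊕ shift f)) (⊛-𝟙 (c (matrix⁻ f)))) (⊕-cancelˡ (c (matrix⁻ f)) (shift f))))

  Graph? : Decidable (Mem Graph)
  Graph? f = shift f ≟ᵛ c (matrix⁻ f)

-- Represents the first cohomology group of GL(3,2) on its natural module,
-- which has order 2.
opaque
  F : F₂^ 3 → F₂^ 3 → Bool
  F (a₀ ∷ a₁ ∷ a₂ ∷ []) (b₀ ∷ b₁ ∷ b₂ ∷ []) =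
    a₀ ∧ (b₀ xor b₂) xor a₁ ∧ (b₁ xor b₀) xor a₂ ∧ (b₂ xor b₁)
    xor a₀ ∧ a₁ ∧ b₂ xor a₁ ∧ a₂ ∧ b₀ xor a₂ ∧ a₀ ∧ b₁

  nonsplit : Matrix 3 3 → F₂^ 3
  nonsplit (x ∷ y ∷ z ∷ []) = F y z ∷ F z x ∷ F x y ∷ []

split : Matrix n n → F₂^ n
split _ = 𝟎

split-cocycle : Cocycle (split {n})
split-cocycle f g = sym (trans (cong (_⊕ 𝟎) (𝟎-⊛ (matrix g))) (⊕-identityˡ 𝟎))

-- The cocycle identity multiplied on the right by `N′`, which cancels the inverse of `N′`; the
-- check over pairs of invertible matrices then needs no inversion.
NonsplitIdentity : Matrix 3 3 → Matrix 3 3 → Set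
NonsplitIdentity N N′ = nonsplit (N′ ⊠ N) ⊛ N′ ≡ nonsplit N ⊕ nonsplit N′ ⊛ N′

nonsplitIdentity? : ∀ N N′ → Dec (NonsplitIdentity N N′)
nonsplitIdentity? N N′ = (nonsplit (N′ ⊠ N) ⊛ N′) ≟ᵛ (nonsplit N ⊕ nonsplit N′ ⊛ N′)

opaque
  unfolding nonsplit

  nonsplit-check : everyIndependent 3 (λ N → everyIndependent 3 λ N′ → does (nonsplitIdentity? N N′)) ≡ true
  nonsplit-check = refl

nonsplit-identity : ∀ N N′ → Independent N → Independent N′ → NonsplitIdentity N N′
nonsplit-identity N N′ ind ind′ = does-sound (nonsplitIdentity? N N′)
  (everyIndependent-sound 3 (does ∘ nonsplitIdentity? N)
    (everyIndependent-sound 3 (λ N → everyIndependent 3 (does ∘ nonsplitIdentity? N)) nonsplit-check N ind) N′ ind′)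

nonsplit-cocycle : Cocycle nonsplit
nonsplit-cocycle f g = begin
  c (N′ ⊠ N)                               ≡⟨ ⊛-cancel N′ M′ (leftInverse g) (c (N′ ⊠ N)) ⟨
  (c (N′ ⊠ N) ⊛ N′) ⊛ M′                   ≡⟨ cong (_⊛ M′) (nonsplit-identity N N′
                                                (invertible⇒independent N (matrix f) (leftInverse f))
                                                (invertible⇒independent N′ M′ (leftInverse g))) ⟩
  (c N ⊕ c N′ ⊛ N′) ⊛ M′                   ≡⟨ ⊛-⊕ (c N) (c N′ ⊛ N′) M′ ⟩
  c N ⊛ M′ ⊕ (c N′ ⊛ N′) ⊛ M′              ≡⟨ cong (c N ⊛ M′ ⊕_) (⊛-cancel N′ M′ (leftInverse g) (c N′)) ⟩
  c N ⊛ M′ ⊕ c N′                          ∎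
  where
  open ≡-Reasoning
  c = nonsplit
  N N′ M′ : Matrix 3 3
  N  = matrix⁻ f
  N′ = matrix⁻ g
  M′ = matrix g

-- The two actions of AGL(3,2) of degree 8

points : Vec (F₂^ 3) 8
points =
    (false ∷ false ∷ false ∷ []) ∷ (false ∷ false ∷ true ∷ []) ∷ (false ∷ true ∷ false ∷ []) ∷ (false ∷ true ∷ true ∷ [])
  ∷ (true ∷ false ∷ false ∷ [])  ∷ (true ∷ false ∷ true ∷ [])  ∷ (true ∷ true ∷ false ∷ [])  ∷ (true ∷ true ∷ true ∷ [])
  ∷ []

point : Fin 8 → F₂^ 3
point = lookup points

point-injective : ∀ i j → point i ≡ point j → i ≡ j
point-injective = from-yes (all? λ i → all? λ j → (point i ≟ᵛ point j) →-dec (i ≟ j))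

module AGL = Group (AGL₂ 3)

translation : F₂^ 3 → Affine 3
translation v = record { matrix = 𝟙 ; matrix⁻ = 𝟙 ; shift = v ; rightInverse = refl ; leftInverse = refl }

-- The number of cosets of Graph c moved by the transformation
-- x ↦ (x + y) N⁻¹.
movedPoints : (Matrix 3 3 → F₂^ 3) → Matrix 3 3 → F₂^ 3 → ℕ
movedPoints c N y = counting (c N ⊛ N)
  where
  counting : F₂^ 3 → ℕ
  counting w = sum λ j → indicator (does (¬? ((point j ⊕ y ⊕ point j ⊛ N) ≟ᵛ w)))

indicator-¬-cong : {A B : Set} (A? : Dec A) (B? : Dec B) → (A → B) → (B → A) →
  indicator (does (¬? A?)) ≡ indicator (does (¬? B?))
indicator-¬-cong (yes _) (yes _) _ _ = refl
indicator-¬-cong (no _)  (no _)  _ _ = refl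
indicator-¬-cong (yes a) (no ¬b) f _ = contradiction (f a) ¬b
indicator-¬-cong (no ¬a) (yes b) _ g = contradiction (g b) ¬a

module _ (c : Matrix 3 3 → F₂^ 3) (cocycle : Cocycle c) where

  private
    K : Subgroup (AGL₂ 3) 0ℓ
    K = Graph c cocycle

    z : Fin 8 → Affine 3
    z j = translation (point j)

    -- The quotient of two translations is a translation, and a complement contains only the trivial
    -- one; so the eight translations represent distinct cosets.
    distinct : ∀ {i j} → Mem K (z i AGL.∙ z j AGL.⁻¹) → i ≡ j
    distinct {i} {j} k = point-injective i j (⊕≡𝟎⇒≡ (point i) (point j) (begin
      point i ⊕ point j           ≡⟨ cong₂ _⊕_ (⊛-𝟙 (point i)) (⊛-𝟙 (point j)) ⟨
      point i ⊛ 𝟙 ⊕ point j ⊛ 𝟙   ≡⟨ proj₂ (proj₁ (Graph-complement c cocycle) (z i AGL.∙ z j AGL.⁻¹) k refl) ⟩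
      𝟎                           ∎))
      where open ≡-Reasoning

    module _ (t : Affine 3) (v : F₂^ 3) where

      private
        M N : Matrix 3 3
        M = matrix t
        N = matrix⁻ t

        conjugate : Affine 3
        conjugate = translation v AGL.∙ t AGL.∙ translation v AGL.⁻¹

        matrix⁻-conjugate : matrix⁻ conjugate ≡ N
        matrix⁻-conjugate = trans (⊠-identityˡ (N ⊠ 𝟙)) (⊠-identityʳ N)

        shift-conjugate : shift conjugate ≡ v ⊛ M ⊕ shift t ⊕ v
        shift-conjugate = cong₂ _⊕_ (⊛-𝟙 (v ⊛ M ⊕ shift t)) (⊛-𝟙 v)

        multiply : (v ⊛ M ⊕ shift t ⊕ v) ⊛ N ≡ v ⊕ shift t ⊛ N ⊕ v ⊛ N
        multiply = trans (⊛-⊕ (v ⊛ M ⊕ shift t) v N) (cong (_⊕ v ⊛ N)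
          (trans (⊛-⊕ (v ⊛ M) (shift t) N) (cong (_⊕ shift t ⊛ N) (⊛-cancel M N (rightInverse t) v))))

      -- Multiplying the membership condition v M + s + v = c(N) by N = M⁻¹ leaves only N and s N.
      -- The exhaustive check can therefore range over pairs (N, y) with y = s N, which cover all
      -- 168 · 8 transformations.
      mem⇒ : Mem K conjugate → v ⊕ shift t ⊛ N ⊕ v ⊛ N ≡ c N ⊛ N
      mem⇒ k = trans (sym multiply) (cong (_⊛ N)
        (trans (sym shift-conjugate) (trans k (cong c matrix⁻-conjugate))))

      mem⇐ : v ⊕ shift t ⊛ N ⊕ v ⊛ N ≡ c N ⊛ N → Mem K conjugate
      mem⇐ e = trans shift-conjugate (trans
        (trans (sym (⊛-cancel N M (leftInverse t) _)) (trans (cong (_⊛ M) (trans multiply e)) (⊛-cancel N M (leftInverse t) (c N))))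
        (cong c (sym matrix⁻-conjugate)))

  moved-Graph : (H : Subgroup (AGL₂ 3) 0ℓ) (ρ : PermRep (AGL₂ 3) 8) → CosetAction H ρ → Conjugate H K →
    ∀ t → moved (⟦ ρ ⟧ t) ≡ movedPoints c (matrix⁻ t) (shift t ⊛ matrix⁻ t)
  moved-Graph H ρ action conj t = trans
    (moved-coset H K ρ action conj (Graph? c cocycle) z distinct t)
    (sum-cong-≗ λ j → indicator-¬-cong (Graph? c cocycle (z j AGL.∙ t AGL.∙ z j AGL.⁻¹)) (_ ≟ᵛ _)
      (mem⇒ t (point j)) (mem⇐ t (point j)))

MovedBound : Matrix 3 3 → F₂^ 3 → Set
MovedBound N y = ¬ (N ≡ 𝟙 × y ≡ 𝟎) →
  4 ≤ movedPoints split N y × 4 ≤ movedPoints nonsplit N y × 12 ≤ movedPoints split N y + movedPoints nonsplit N y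

movedBound? : ∀ N y → Dec (MovedBound N y)
movedBound? N y = ¬? ((N ≟ᵐ 𝟙) ×-dec (y ≟ᵛ 𝟎)) →-dec
  check (movedPoints split N y) (movedPoints nonsplit N y)
  where
  check : ∀ a b → Dec (4 ≤ a × 4 ≤ b × 12 ≤ a + b)
  check a b = (4 ℕ.≤? a) ×-dec (4 ℕ.≤? b) ×-dec (12 ℕ.≤? a + b)

transvection : F₂^ 3 → Affine 3
transvection v = record { matrix = M ; matrix⁻ = M ; shift = v ; rightInverse = refl ; leftInverse = refl }
  where
  M : Matrix 3 3
  M = (true ∷ false ∷ false ∷ []) ∷ (false ∷ true ∷ false ∷ []) ∷ (false ∷ true ∷ true ∷ []) ∷ []

movedAt : (Matrix 3 3 → F₂^ 3) → Affine 3 → ℕ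
movedAt c t = movedPoints c (matrix⁻ t) (shift t ⊛ matrix⁻ t)

-- Two elements with the same linear part: t₀ moves four points in the split action and all eight in
-- the other, t₁ the reverse. They attain both minima 4 and the total 12, and t₀ separates the two
-- characters.
t₀ t₁ : Affine 3
t₀ = transvection (false ∷ false ∷ false ∷ [])
t₁ = transvection (true ∷ false ∷ false ∷ [])

opaque
  unfolding nonsplit

  movedBound-check : everyIndependent 3 (λ N → everyVector 3 λ y → does (movedBound? N y)) ≡ true
  movedBound-check = refl

  movedAt-t₀ : movedAt split t₀ ≡ 4 × movedAt nonsplit t₀ ≡ 8
  movedAt-t₀ = refl , refl

  movedAt-t₁ : movedAt split t₁ ≡ 8 × movedAt nonsplit t₁ ≡ 4
  movedAt-t₁ = refl , refl

movedAt-bound : ∀ t → ¬ t AGL.≈ AGL.ε →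
  4 ≤ movedAt split t × 4 ≤ movedAt nonsplit t × 12 ≤ movedAt split t + movedAt nonsplit t
movedAt-bound t t≉ε = does-sound (movedBound? N (shift t ⊛ N))
  (everyVector-sound (does ∘ movedBound? N)
    (everyIndependent-sound 3 (λ N → everyVector 3 (does ∘ movedBound? N)) movedBound-check N
      (invertible⇒independent N (matrix t) (leftInverse t)))
    (shift t ⊛ N))
  λ (N≡𝟙 , s≡𝟎) → t≉ε
    ( ⊠-inverse-unique {M = N} {matrix t} {𝟙} {𝟙} (rightInverse t) (⊠-identityˡ 𝟙) N≡𝟙
    , trans (sym (⊛-cancel N (matrix t) (leftInverse t) (shift t)))
        (trans (cong (_⊛ matrix t) s≡𝟎) (𝟎-⊛ (matrix t))) )
  where
  N : Matrix 3 3
  N = matrix⁻ t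

two-actions : (ρ : Vector (PermRep (AGL₂ 3) 8) 2) (w : Fin 2 → Affine 3 → ℕ) →
  (∀ i t → moved (⟦ ρ i ⟧ t) ≡ w i t) →
  (∀ i t → ¬ t AGL.≈ AGL.ε → 4 ≤ w i t) → (∀ i → ∃[ t ] w i t ≡ 4) →
  (∀ t → ¬ t AGL.≈ AGL.ε → 12 ≤ w 0F t + w 1F t) → (∃[ t ] w 0F t + w 1F t ≡ 12) →
  Improves (AGL₂ 3) ρ 8 12
two-actions ρ w moved≡ 4≤ attains₄ 12≤ (s , attains₁₂) =
  δrep-intro {T = AGL₂ 3} ρ (const 4) 0F (λ _ → s≤s z≤n)
    (λ i → proj₁ (attains₄ i) , trans (moved≡ i _) (proj₂ (attains₄ i)))
    (λ i t t≉ε → subst (4 ≤_) (sym (moved≡ i t)) (4≤ i t t≉ε))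
    (λ _ → ℕ.≤-refl) ,
  δtw-intro {T = AGL₂ 3} ρ 12 (s≤s z≤n) (s , trans (weight≡ s) attains₁₂)
    (λ t t≉ε → subst (12 ≤_) (sym (weight≡ t)) (12≤ t t≉ε)) ,
  ℕ.m≤m+n 9 3
  where
  weight≡ : ∀ t → weight {T = AGL₂ 3} ρ t ≡ w 0F t + w 1F t
  weight≡ t = cong₂ _+_ (moved≡ 0F t) (trans (ℕ.+-identityʳ _) (moved≡ 1F t))

affine-improves : (H : Vector (Subgroup (AGL₂ 3) 0ℓ) 2) →
  ClassRepresentatives (Complement (Translations 3)) H →
  (ρ : Vector (PermRep (AGL₂ 3) 8) 2) → (∀ i → CosetAction (H i) (ρ i)) →
  Improves (AGL₂ 3) ρ 8 12
affine-improves H (_ , _ , classes) ρ action =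
  cases (proj₁ class₀) (proj₁ class₁)
    (moved-Graph split split-cocycle (H _) (ρ _) (action _) (proj₂ class₀))
    (moved-Graph nonsplit nonsplit-cocycle (H _) (ρ _) (action _) (proj₂ class₁))
  where
  class₀ : ∃[ i ] Conjugate (H i) (Graph split split-cocycle)
  class₀ = classes (Graph split split-cocycle) (Graph-complement split split-cocycle)

  class₁ : ∃[ i ] Conjugate (H i) (Graph nonsplit nonsplit-cocycle)
  class₁ = classes (Graph nonsplit nonsplit-cocycle) (Graph-complement nonsplit nonsplit-cocycle)

  -- Graphs conjugate to the same `H i` would have equal counts at t₀, where the counts are 4 and 8.
  same : ∀ i → (∀ t → moved (⟦ ρ i ⟧ t) ≡ movedAt split t) → (∀ t → moved (⟦ ρ i ⟧ t) ≡ movedAt nonsplit t) →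
    Improves (AGL₂ 3) ρ 8 12
  same i e e′ = contradiction
    (trans (sym (proj₁ movedAt-t₀)) (trans (sym (e t₀)) (trans (e′ t₀) (proj₂ movedAt-t₀))))
    λ ()

  w₀₁ w₁₀ : Fin 2 → Affine 3 → ℕ
  w₀₁ 0F = movedAt split
  w₀₁ 1F = movedAt nonsplit
  w₁₀ 0F = movedAt nonsplit
  w₁₀ 1F = movedAt split

  cases : ∀ i j → (∀ t → moved (⟦ ρ i ⟧ t) ≡ movedAt split t) → (∀ t → moved (⟦ ρ j ⟧ t) ≡ movedAt nonsplit t) →
    Improves (AGL₂ 3) ρ 8 12
  cases 0F 0F e e′ = same 0F e e′
  cases 1F 1F e e′ = same 1F e e′
  cases 0F 1F e e′ = two-actions ρ w₀₁ (λ { 0F → e ; 1F → e′ })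
    (λ { 0F t t≉ε → proj₁ (movedAt-bound t t≉ε) ; 1F t t≉ε → proj₁ (proj₂ (movedAt-bound t t≉ε)) })
    (λ { 0F → t₀ , proj₁ movedAt-t₀ ; 1F → t₁ , proj₂ movedAt-t₁ })
    (λ t t≉ε → proj₂ (proj₂ (movedAt-bound t t≉ε)))
    (t₀ , cong₂ _+_ (proj₁ movedAt-t₀) (proj₂ movedAt-t₀))
  cases 1F 0F e e′ = two-actions ρ w₁₀ (λ { 0F → e′ ; 1F → e })
    (λ { 0F t t≉ε → proj₁ (proj₂ (movedAt-bound t t≉ε)) ; 1F t t≉ε → proj₁ (movedAt-bound t t≉ε) })
    (λ { 0F → t₁ , proj₂ movedAt-t₁ ; 1F → t₀ , proj₁ movedAt-t₀ })
    (λ t t≉ε → subst (12 ≤_) (ℕ.+-comm (movedAt split t) (movedAt nonsplit t)) (proj₂ (proj₂ (movedAt-bound t t≉ε))))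
    (t₀ , cong₂ _+_ (proj₂ movedAt-t₀) (proj₁ movedAt-t₀))

-- Four subgroups of order 12 of S₆

opaque
  -- A word x₀…x₅ is encoded by its decimal digits.
  decode : ℕ → Word 6
  decode n = (n / 100000) mod 6 ∷ (n / 10000 % 10) mod 6 ∷ (n / 1000 % 10) mod 6
           ∷ (n / 100 % 10) mod 6 ∷ (n / 10 % 10) mod 6 ∷ (n % 10) mod 6 ∷ []

  -- In this order: A₄ with two fixed points, A₄ acting transitively, the
  -- stabiliser of {3,4} in S₃ × S₃, and the symmetry group of a hexagon.
  elementCodes : Vec (Vec ℕ 12) 4
  elementCodes =
      (12345 ∷ 23145 ∷ 31245 ∷ 103245 ∷ 120345 ∷ 132045 ∷ 201345 ∷ 213045 ∷ 230145 ∷ 302145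
      ∷ 310245 ∷ 321045 ∷ [])
    ∷ (12345 ∷ 45312 ∷ 120453 ∷ 153420 ∷ 201534 ∷ 234501 ∷ 315042 ∷ 342015 ∷ 423150 ∷ 450123
      ∷ 504231 ∷ 531204 ∷ [])
    ∷ (12345 ∷ 12435 ∷ 21345 ∷ 21435 ∷ 102345 ∷ 102435 ∷ 120345 ∷ 120435 ∷ 201345 ∷ 201435
      ∷ 210345 ∷ 210435 ∷ [])
    ∷ (12345 ∷ 54321 ∷ 105432 ∷ 123450 ∷ 210543 ∷ 234501 ∷ 321054 ∷ 345012 ∷ 432105 ∷ 450123
      ∷ 501234 ∷ 543210 ∷ [])
    ∷ []

  -- One representative of each right coset. Only distinctness of the cosets is checked: the action
  -- has just 60 points, so 60 distinct cosets exhaust it.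
  cosetCodes : Vec (Vec ℕ 60) 4
  cosetCodes =
      (12345 ∷ 12354 ∷ 12435 ∷ 12453 ∷ 12534 ∷ 12543 ∷ 13245 ∷ 13254 ∷ 13425 ∷ 13452
      ∷ 13524 ∷ 13542 ∷ 14235 ∷ 14253 ∷ 14325 ∷ 14352 ∷ 14523 ∷ 14532 ∷ 15234 ∷ 15243
      ∷ 15324 ∷ 15342 ∷ 15423 ∷ 15432 ∷ 23415 ∷ 23451 ∷ 23514 ∷ 23541 ∷ 24315 ∷ 24351
      ∷ 24513 ∷ 24531 ∷ 25314 ∷ 25341 ∷ 25413 ∷ 25431 ∷ 34512 ∷ 34521 ∷ 35412 ∷ 35421
      ∷ 123405 ∷ 123450 ∷ 123504 ∷ 123540 ∷ 124305 ∷ 124350 ∷ 124503 ∷ 124530 ∷ 125304 ∷ 125340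
      ∷ 125403 ∷ 125430 ∷ 134502 ∷ 134520 ∷ 135402 ∷ 135420 ∷ 234501 ∷ 234510 ∷ 235401 ∷ 235410 ∷ [])
    ∷ (12345 ∷ 12354 ∷ 12435 ∷ 12453 ∷ 12534 ∷ 12543 ∷ 13245 ∷ 13254 ∷ 13425 ∷ 13452
      ∷ 13524 ∷ 13542 ∷ 14235 ∷ 14253 ∷ 14325 ∷ 14352 ∷ 14523 ∷ 14532 ∷ 15234 ∷ 15243
      ∷ 15324 ∷ 15342 ∷ 15423 ∷ 15432 ∷ 21345 ∷ 21354 ∷ 21435 ∷ 21453 ∷ 21534 ∷ 21543
      ∷ 23145 ∷ 23154 ∷ 23451 ∷ 23541 ∷ 24135 ∷ 24153 ∷ 24351 ∷ 24531 ∷ 25134 ∷ 25143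
      ∷ 25341 ∷ 25431 ∷ 31245 ∷ 31254 ∷ 31452 ∷ 31542 ∷ 32145 ∷ 32154 ∷ 32451 ∷ 32541
      ∷ 34152 ∷ 34251 ∷ 35142 ∷ 35241 ∷ 41253 ∷ 41352 ∷ 42153 ∷ 42351 ∷ 43152 ∷ 43251 ∷ [])
    ∷ (12345 ∷ 12354 ∷ 12453 ∷ 13245 ∷ 13254 ∷ 13452 ∷ 14235 ∷ 14253 ∷ 14352 ∷ 15234
      ∷ 15243 ∷ 15342 ∷ 23145 ∷ 23154 ∷ 23451 ∷ 24135 ∷ 24153 ∷ 24351 ∷ 25134 ∷ 25143
      ∷ 25341 ∷ 34125 ∷ 34152 ∷ 34251 ∷ 35124 ∷ 35142 ∷ 35241 ∷ 45123 ∷ 45132 ∷ 45231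
      ∷ 123045 ∷ 123054 ∷ 123450 ∷ 124035 ∷ 124053 ∷ 124350 ∷ 125034 ∷ 125043 ∷ 125340 ∷ 134025
      ∷ 134052 ∷ 134250 ∷ 135024 ∷ 135042 ∷ 135240 ∷ 145023 ∷ 145032 ∷ 145230 ∷ 234015 ∷ 234051
      ∷ 234150 ∷ 235014 ∷ 235041 ∷ 235140 ∷ 245013 ∷ 245031 ∷ 245130 ∷ 345012 ∷ 345021 ∷ 345120 ∷ [])
    ∷ (12345 ∷ 12354 ∷ 12435 ∷ 12453 ∷ 12534 ∷ 12543 ∷ 13245 ∷ 13254 ∷ 13425 ∷ 13452
      ∷ 13524 ∷ 13542 ∷ 14235 ∷ 14253 ∷ 14325 ∷ 14352 ∷ 14523 ∷ 14532 ∷ 15234 ∷ 15243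
      ∷ 15324 ∷ 15342 ∷ 15423 ∷ 15432 ∷ 21345 ∷ 21354 ∷ 21435 ∷ 21453 ∷ 21534 ∷ 21543
      ∷ 23145 ∷ 23154 ∷ 23415 ∷ 23514 ∷ 24135 ∷ 24153 ∷ 24315 ∷ 24513 ∷ 25134 ∷ 25143
      ∷ 25314 ∷ 25413 ∷ 31245 ∷ 31254 ∷ 31425 ∷ 31524 ∷ 32145 ∷ 32154 ∷ 32415 ∷ 32514
      ∷ 34125 ∷ 34215 ∷ 35124 ∷ 35214 ∷ 41235 ∷ 41325 ∷ 42135 ∷ 42315 ∷ 43125 ∷ 43215 ∷ [])
    ∷ []

  elementʷ : Fin 4 → Fin 12 → Word 6
  elementʷ κ i = decode (lookup (lookup elementCodes κ) i)

  cosetʷ : Fin 4 → Fin 60 → Word 6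
  cosetʷ κ j = decode (lookup (lookup cosetCodes κ) j)

element : Fin 4 → Fin 12 → Permutation′ 6
element κ i = fromWord (elementʷ κ i)

coset : Fin 4 → Fin 60 → Permutation′ 6
coset κ j = fromWord (cosetʷ κ j)

Member : Fin 4 → Word 6 → Set
Member κ v = ∃[ i ] elementʷ κ i ≡ v

member? : ∀ κ v → Dec (Member κ v)
member? κ v = any? λ i → elementʷ κ i ≟ʷ v

quotient : Word 6 → Word 6 → Word 6 → Word 6
quotient x v y = x ⨾ v ⨾ inverseʷ y

CosetsDistinct : Fin 4 → Fin 60 → Fin 60 → Set
CosetsDistinct κ i j = Member κ (cosetʷ κ i ⨾ inverseʷ (cosetʷ κ j)) → i ≡ j

cosetsDistinct? : ∀ κ i j → Dec (CosetsDistinct κ i j)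
cosetsDistinct? κ i j = member? κ (cosetʷ κ i ⨾ inverseʷ (cosetʷ κ j)) →-dec (i ≟ j)

opaque
  unfolding elementʷ

  ⌜element⌝ : ∀ κ i → ⌜ element κ i ⌝ ≡ elementʷ κ i
  ⌜element⌝ = from-yes (all? λ κ → all? λ i → ⌜ element κ i ⌝ ≟ʷ elementʷ κ i)

  ⌜coset⌝ : ∀ κ j → ⌜ coset κ j ⌝ ≡ cosetʷ κ j
  ⌜coset⌝ = from-yes (all? λ κ → all? λ j → ⌜ coset κ j ⌝ ≟ʷ cosetʷ κ j)

  ⌜coset⁻¹⌝ : ∀ κ j → ⌜ Perm.flip (coset κ j) ⌝ ≡ inverseʷ (cosetʷ κ j)
  ⌜coset⁻¹⌝ = from-yes (all? λ κ → all? λ j → ⌜ Perm.flip (coset κ j) ⌝ ≟ʷ inverseʷ (cosetʷ κ j))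

  element-injective : ∀ κ i j → elementʷ κ i ≡ elementʷ κ j → i ≡ j
  element-injective = from-yes (all? λ κ → all? λ i → all? λ j → (elementʷ κ i ≟ʷ elementʷ κ j) →-dec (i ≟ j))

  element-∙ : ∀ κ i j → Member κ (elementʷ κ i ⨾ elementʷ κ j)
  element-∙ = from-yes (all? λ κ → all? λ i → all? λ j → member? κ (elementʷ κ i ⨾ elementʷ κ j))

  element-ε : ∀ κ → Member κ idʷ
  element-ε = from-yes (all? λ κ → member? κ idʷ)

  element-⁻¹ : ∀ κ i → ∃[ j ] elementʷ κ i ⨾ elementʷ κ j ≡ idʷ
  element-⁻¹ = from-yes (all? λ κ → all? λ i → any? λ j → (elementʷ κ i ⨾ elementʷ κ j) ≟ʷ idʷ)

  cosetsDistinct-check : every (λ κ → every λ i → every λ j → does (cosetsDistinct? κ i j)) ≡ true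
  cosetsDistinct-check = refl

coset-distinct : ∀ κ i j → CosetsDistinct κ i j
coset-distinct κ i j = does-sound (cosetsDistinct? κ i j)
  (every-sound (λ j → does (cosetsDistinct? κ i j))
    (every-sound (λ i → every λ j → does (cosetsDistinct? κ i j))
      (every-sound (λ κ → every λ i → every λ j → does (cosetsDistinct? κ i j)) cosetsDistinct-check κ) i) j)

opaque
  subgroup : Fin 4 → Subgroup (Sym 6) 0ℓ
  subgroup κ = record
    { Mem    = λ π → Member κ ⌜ π ⌝
    ; resp   = λ {π} {σ} π≈σ → subst (Member κ) (⌜⌝-cong π σ π≈σ)
    ; ∙-mem  = λ {π} {σ} π∈ σ∈ → product π σ π∈ σ∈
    ; ε-mem  = element-ε κ
    ; ⁻¹-mem = λ {π} π∈ → inverse π π∈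
    }
    where
    product : ∀ π σ → Member κ ⌜ π ⌝ → Member κ ⌜ σ ⌝ → Member κ ⌜ π ∘ₚ σ ⌝
    product π σ (i , e) (j , e′) = subst (Member κ) (trans (cong₂ _⨾_ e e′) (sym (⌜∘ₚ⌝ π σ))) (element-∙ κ i j)

    inverse : ∀ π → Member κ ⌜ π ⌝ → Member κ ⌜ Perm.flip π ⌝
    inverse π (i , e) = j , trans (sym (⌜element⌝ κ j)) (⌜⌝-cong (element κ j) (Perm.flip π) λ x →
      trans (cong (element κ j ⟨$⟩ʳ_) (sym (Perm.inverseʳ π))) (πρ≈id (π ⟨$⟩ˡ x)))
      where
      j : Fin 12
      j = proj₁ (element-⁻¹ κ i)
      πρ≈id : π ∘ₚ element κ j Perm.≈ Perm.id
      πρ≈id = ⌜⌝≡id⇒ (π ∘ₚ element κ j) (trans (⌜∘ₚ⌝ π (element κ j))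
        (trans (cong₂ _⨾_ (sym e) (⌜element⌝ κ j)) (proj₂ (element-⁻¹ κ i))))

opaque
  unfolding subgroup

  subgroup-order : ∀ κ → HasOrder 12 (subgroup κ)
  subgroup-order κ = record
    { to        = λ (π , i , e) → i
    ; from      = λ i → element κ i , i , sym (⌜element⌝ κ i)
    ; to-cong   = λ {(π , i , e)} {(σ , j , e′)} π≈σ → same π σ e e′ π≈σ
    ; from-cong = λ { refl _ → refl }
    ; inverse   =
        (λ {i} {(π , j , e)} π≈ → same π (element κ i) e (sym (⌜element⌝ κ i)) π≈) ,
        (λ { {(π , i , e)} refl → ⌜⌝-injective (element κ i) π (trans (⌜element⌝ κ i) e) })
    }
    where
    same : ∀ π σ {i j} → elementʷ κ i ≡ ⌜ π ⌝ → elementʷ κ j ≡ ⌜ σ ⌝ → π Perm.≈ σ → i ≡ j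
    same π σ {i} {j} e e′ π≈σ = element-injective κ i j (trans e (trans (⌜⌝-cong π σ π≈σ) (sym e′)))

opaque
  movedCosets : Fin 4 → Word 6 → ℕ
  movedCosets κ v = sum λ j → indicator (does (¬? (member? κ (quotient (cosetʷ κ j) v (cosetʷ κ j)))))

opaque
  unfolding subgroup movedCosets

  moved-subgroup : ∀ κ (H : Subgroup (Sym 6) 0ℓ) (ρ : PermRep (Sym 6) 60) → CosetAction H ρ →
    Conjugate H (subgroup κ) → ∀ t → moved (⟦ ρ ⟧ t) ≡ movedCosets κ ⌜ t ⌝
  moved-subgroup κ H ρ action conj t = trans
    (moved-coset H (subgroup κ) ρ action conj (λ π → member? κ ⌜ π ⌝) (coset κ)
      (λ {i} {j} k → coset-distinct κ i j (subst (Member κ)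
        (trans (⌜∘ₚ⌝ (coset κ i) (Perm.flip (coset κ j))) (cong₂ _⨾_ (⌜coset⌝ κ i) (⌜coset⁻¹⌝ κ j))) k)) t)
    (sum-cong-≗ λ j → cong (λ v → indicator (does (¬? (member? κ v)))) (word j))
    where
    word : ∀ j → ⌜ (coset κ j ∘ₚ t) ∘ₚ Perm.flip (coset κ j) ⌝ ≡ quotient (cosetʷ κ j) ⌜ t ⌝ (cosetʷ κ j)
    word j = trans (⌜∘ₚ⌝ (coset κ j ∘ₚ t) (Perm.flip (coset κ j)))
      (cong₂ _⨾_ (trans (⌜∘ₚ⌝ (coset κ j) t) (cong (_⨾ ⌜ t ⌝) (⌜coset⌝ κ j))) (⌜coset⁻¹⌝ κ j))

-- Each entry is 60 minus the value of the permutation character on the class. The first two rows,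
-- and likewise the last two, are exchanged by the class permutation of an outer automorphism of S₆:
-- 2 with 2³, 3 with 3², and 3·2 with 6.
characters : Vec (Vec ℕ 11) 4
characters =
    (0 ∷ 60 ∷ 56 ∷ 60 ∷ 48 ∷ 60 ∷ 60 ∷ 60 ∷ 60 ∷ 60 ∷ 60 ∷ [])
  ∷ (0 ∷ 60 ∷ 56 ∷ 60 ∷ 60 ∷ 60 ∷ 48 ∷ 60 ∷ 60 ∷ 60 ∷ 60 ∷ [])
  ∷ (0 ∷ 44 ∷ 56 ∷ 60 ∷ 57 ∷ 59 ∷ 60 ∷ 60 ∷ 60 ∷ 60 ∷ 60 ∷ [])
  ∷ (0 ∷ 60 ∷ 56 ∷ 44 ∷ 60 ∷ 60 ∷ 57 ∷ 60 ∷ 60 ∷ 60 ∷ 59 ∷ [])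
  ∷ []

χ : Fin 4 → Fin 11 → ℕ
χ κ k = lookup (lookup characters κ) k

opaque
  unfolding elementʷ movedCosets

  movedCosets-rep : ∀ κ k → movedCosets κ (lookup representatives k) ≡ χ κ k
  movedCosets-rep = from-yes (all? λ κ → all? λ k → movedCosets κ (lookup representatives k) ℕ.≟ χ κ k)

-- Minimum distances of the codes of length 240

least : Fin 4 → ℕ
least = lookup (48 ∷ 48 ∷ 44 ∷ 44 ∷ [])

least-attained : ∀ κ → ∃[ k ] χ κ k ≡ least κ
least-attained = from-yes (all? λ κ → any? λ k → χ κ k ℕ.≟ least κ)

least-bound : ∀ κ k → k ≢ 0F → least κ ≤ χ κ k
least-bound = from-yes (all? λ κ → all? λ k → ¬? (k ≟ 0F) →-dec (least κ ℕ.≤? χ κ k))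

χ-injective : ∀ κ κ′ → (∀ k → χ κ k ≡ χ κ′ k) → κ ≡ κ′
χ-injective = from-yes (all? λ κ → all? λ κ′ → (all? λ k → χ κ k ℕ.≟ χ κ′ k) →-dec (κ ≟ κ′))

total : Vec (Fin 4) 4 → Fin 11 → ℕ
total a k = sum λ i → χ (lookup a i) k

Minimal : Vec (Fin 4) 4 → Fin 11 → Set
Minimal a k = k ≢ 0F × (∀ k′ → k′ ≢ 0F → total a k ≤ total a k′)

minimal? : ∀ a k → Dec (Minimal a k)
minimal? a k = ¬? (k ≟ 0F) ×-dec all? λ k′ → ¬? (k′ ≟ 0F) →-dec (total a k ℕ.≤? total a k′)

Least : Vec (Fin 4) 4 → Fin 4 → Set
Least a i = ∀ j → least (lookup a i) ≤ least (lookup a j)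

least? : ∀ a i → Dec (Least a i)
least? a i = all? λ j → least (lookup a i) ℕ.≤? least (lookup a j)

InRange : Vec (Fin 4) 4 → ℕ → ℕ → Set
InRange a drep dtw = 176 ≤ drep × drep ≤ 192 × 176 ≤ dtw × dtw ≤ 224 ×
  (∀ i j → lookup a i ≢ lookup a j → drep < dtw)

inRange? : ∀ a drep dtw → Dec (InRange a drep dtw)
inRange? a drep dtw = (176 ℕ.≤? drep) ×-dec (drep ℕ.≤? 192) ×-dec (176 ℕ.≤? dtw) ×-dec (dtw ℕ.≤? 224) ×-dec
  (all? λ i → all? λ j → ¬? (lookup a i ≟ lookup a j) →-dec (drep ℕ.<? dtw))

opaque
  -- Double transpositions move 56 points in each of the four actions, so the total is 4 · 56 = 224
  -- at this class for every choice and the minimum cannot exceed it. The row minima 44 and 48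
  -- account for 176 and 192.
  ranges : ∀ x₀ x₁ x₂ x₃ → let a = x₀ ∷ x₁ ∷ x₂ ∷ x₃ ∷ [] in
    ∃[ i ] ∃[ k ] (Least a i × Minimal a k × InRange a (4 * least (lookup a i)) (total a k))
  ranges = from-yes (all? λ x₀ → all? λ x₁ → all? λ x₂ → all? λ x₃ → let a = x₀ ∷ x₁ ∷ x₂ ∷ x₃ ∷ [] in
    any? λ i → any? λ k → least? a i ×-dec minimal? a k ×-dec inRange? a (4 * least (lookup a i)) (total a k))

module _ (H : Vector (Subgroup (Sym 6) 0ℓ) 4) (classes : ClassRepresentatives (HasOrder 12) H)
  (ρ : Vector (PermRep (Sym 6) 60) 4) (actions : ∀ i → CosetAction (H i) (ρ i)) where

  private
    conjugate-subgroup : ∀ κ → ∃[ i ] Conjugate (H i) (subgroup κ)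
    conjugate-subgroup κ = proj₂ (proj₂ classes) (subgroup κ) (subgroup-order κ)

    index : Fin 4 → Fin 4
    index κ = proj₁ (conjugate-subgroup κ)

    moved-index : ∀ κ k → moved (⟦ ρ (index κ) ⟧ (rep k)) ≡ χ κ k
    moved-index κ k = trans
      (moved-subgroup κ (H (index κ)) (ρ (index κ)) (actions (index κ)) (proj₂ (conjugate-subgroup κ)) (rep k))
      (trans (cong (movedCosets κ) (rep-word k)) (movedCosets-rep κ k))

    index-injective : ∀ {κ κ′} → index κ ≡ index κ′ → κ ≡ κ′
    index-injective {κ} {κ′} e = χ-injective κ κ′ λ k →
      trans (sym (moved-index κ k)) (trans (cong (λ i → moved (⟦ ρ i ⟧ (rep k))) e) (moved-index κ′ k))

    -- Tells to which of the exhibited subgroups the given `H i` is conjugate, as the classes may be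
    -- listed in any order.
    kind : Fin 4 → Fin 4
    kind i = proj₁ (injective⇒surjective index index-injective i)

    index-kind : ∀ i → index (kind i) ≡ i
    index-kind i = proj₂ (injective⇒surjective index index-injective i)

    kind-index : ∀ κ → kind (index κ) ≡ κ
    kind-index κ = index-injective (index-kind (index κ))

    moved-ρ : ∀ i k → moved (⟦ ρ i ⟧ (rep k)) ≡ χ (kind i) k
    moved-ρ i k = trans (cong (λ i → moved (⟦ ρ i ⟧ (rep k))) (sym (index-kind i))) (moved-index (kind i) k)

    nontrivial-class : ∀ t → ¬ t Perm.≈ Perm.id → ∃[ k ] (k ≢ 0F × (∀ i → moved (⟦ ρ i ⟧ t) ≡ χ (kind i) k))
    nontrivial-class t t≉id = k , k≢0 , λ i → trans (moved-conjugate-rep (ρ i) t k g t≈) (moved-ρ i k)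
      where
      class = conjugate-to-rep t
      k : Fin 11
      k = proj₁ class
      g : Permutation′ 6
      g = proj₁ (proj₂ class)
      t≈ : t Perm.≈ rep k ^ g
      t≈ = proj₂ (proj₂ class)
      k≢0 : k ≢ 0F
      k≢0 k≡0 = t≉id (moved≡0⇒≈id t (trans (moved-cong t (rep k ^ g) t≈) (trans (moved-^ g (rep k))
        (trans (cong (moved ∘ rep) k≡0) (moved-rep 0F)))))

    module _ (f : Fin 4 → Fin 4) (a : Vec (Fin 4) 4) (a≡ : ∀ i → kind (f i) ≡ lookup a i) where

      moved-f : ∀ i k → moved (⟦ ρ (f i) ⟧ (rep k)) ≡ χ (lookup a i) k
      moved-f i k = trans (moved-ρ (f i) k) (cong (λ κ → χ κ k) (a≡ i))

      δrep-f : ∀ i → Least a i → δrep≡ (Sym 6) (ρ ∘ f) (4 * least (lookup a i))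
      δrep-f i = δrep-intro {T = Sym 6} (ρ ∘ f) (least ∘ lookup a) i
        (λ j → positive (lookup a j))
        (λ j → rep (proj₁ (least-attained (lookup a j))) ,
          trans (moved-f j (proj₁ (least-attained (lookup a j)))) (proj₂ (least-attained (lookup a j))))
        bound
        where
        positive : ∀ κ → 0 < least κ
        positive = from-yes (all? λ κ → 0 ℕ.<? least κ)

        bound : ∀ j t → ¬ t Perm.≈ Perm.id → least (lookup a j) ≤ moved (⟦ ρ (f j) ⟧ t)
        bound j t t≉id = subst (least (lookup a j) ≤_)
          (sym (trans (proj₂ (proj₂ class) (f j)) (cong (λ κ → χ κ (proj₁ class)) (a≡ j))))
          (least-bound (lookup a j) (proj₁ class) (proj₁ (proj₂ class)))
          where
          class = nontrivial-class t t≉id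

      δtw-f : ∀ k → Minimal a k → 0 < total a k → δtw≡ (Sym 6) (ρ ∘ f) (total a k)
      δtw-f k (_ , minimal) 0<total = δtw-intro {T = Sym 6} (ρ ∘ f) (total a k) 0<total
        (rep k , sum-cong-≗ (λ i → moved-f i k))
        bound
        where
        bound : ∀ t → ¬ t Perm.≈ Perm.id → total a k ≤ weight {T = Sym 6} (ρ ∘ f) t
        bound t t≉id = subst (total a k ≤_)
          (sum-cong-≗ λ i → sym (trans (proj₂ (proj₂ class) (f i)) (cong (λ κ → χ κ (proj₁ class)) (a≡ i))))
          (minimal (proj₁ class) (proj₁ (proj₂ class)))
          where
          class = nontrivial-class t t≉id

  order-12-range : (f : Fin 4 → Fin 4) → ∃[ drep ] ∃[ dtw ]
    ( δrep≡ (Sym 6) (ρ ∘ f) drep × 176 ≤ drep × drep ≤ 192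
    × δtw≡ (Sym 6) (ρ ∘ f) dtw × 176 ≤ dtw × dtw ≤ 224
    × (∀ i j → f i ≢ f j → drep < dtw))
  order-12-range f =
    let i , k , least-i , minimal-k , 176≤drep , drep≤192 , 176≤dtw , dtw≤224 , strict =
          ranges (kind (f 0F)) (kind (f 1F)) (kind (f 2F)) (kind (f 3F)) in
    4 * least (lookup a i) , total a k ,
    δrep-f f a a≡ i least-i , 176≤drep , drep≤192 ,
    δtw-f f a a≡ k minimal-k (ℕ.≤-trans (s≤s z≤n) 176≤dtw) , 176≤dtw , dtw≤224 ,
    λ i j fi≢fj → strict i j λ e → fi≢fj (begin
      f i                  ≡⟨ index-kind (f i) ⟨
      index (kind (f i))   ≡⟨ cong index (trans (a≡ i) (trans e (sym (a≡ j)))) ⟩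
      index (kind (f j))   ≡⟨ index-kind (f j) ⟩
      f j                  ∎)
    where
    open ≡-Reasoning
    a : Vec (Fin 4) 4
    a = tabulate (kind ∘ f)
    a≡ : ∀ i → kind (f i) ≡ lookup a i
    a≡ i = sym (lookup∘tabulate (kind ∘ f) i)

  private
    kind-const : ∀ κ i → kind (const (index κ) i) ≡ lookup (replicate 4 κ) i
    kind-const κ i = trans (kind-index κ) (sym (lookup-replicate i κ))

  δrep-176 : Σ[ f ∈ (Fin 4 → Fin 4) ] δrep≡ (Sym 6) (ρ ∘ f) 176
  δrep-176 = const (index 2F) , δrep-f (const (index 2F)) (replicate 4 2F) (kind-const 2F)
    0F (from-yes (least? (replicate 4 2F) 0F))

  δrep-192 : Σ[ f ∈ (Fin 4 → Fin 4) ] δrep≡ (Sym 6) (ρ ∘ f) 192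
  δrep-192 = const (index 0F) , δrep-f (const (index 0F)) (replicate 4 0F) (kind-const 0F)
    0F (from-yes (least? (replicate 4 0F) 0F))

  δtw-176 : Σ[ f ∈ (Fin 4 → Fin 4) ] δtw≡ (Sym 6) (ρ ∘ f) 176
  δtw-176 = const (index 2F) , δtw-f (const (index 2F)) (replicate 4 2F) (kind-const 2F)
    1F (from-yes (minimal? (replicate 4 2F) 1F)) (s≤s z≤n)

  -- Taking each class once, the transpositions already attain the minimum 60 + 60 + 44 + 60.
  δtw-224 : Σ[ f ∈ (Fin 4 → Fin 4) ] δtw≡ (Sym 6) (ρ ∘ f) 224
  δtw-224 = index , δtw-f index (tabulate λ κ → κ) (λ i → trans (kind-index i) (sym (lookup∘tabulate (λ κ → κ) i)))
    1F (from-yes (minimal? (tabulate λ κ → κ) 1F)) (s≤s z≤n)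

theorem1p1 : (c ℓ : Level) →

  -- the general bound
  ((q : ℕ) .{{_ : NonZero q}} (T : Group c ℓ)
   (r : ℕ) .{{_ : NonZero r}} (I : Vector (PermRep T q) r) →
     FrequencyPermutationArray r (twistedCode T I)
     × (SameKernel T I →
        ∀ dtw drep → δtw≡ T I dtw → δrep≡ T I drep → drep ≤ dtw))

  -- (1)
  × ((σ : Hom (Sym 6) (Sym 6)) →
     IsAutomorphism (Sym 6) σ → ¬ IsInner (Sym 6) σ → SquaresToIdentity (Sym 6) σ →
     Improves (Sym 6) (idHom (Sym 6) Vector.∷ σ Vector.∷ Vector.[]) 4 8)

  -- (2)
  × ((σ : Hom (toGroup (Alt 6)) (toGroup (Alt 6))) →
     IsAutomorphism (toGroup (Alt 6)) σ → ¬ InducedByConjugation (Alt 6) σ →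
     SquaresToIdentity (toGroup (Alt 6)) σ →
     Improves (toGroup (Alt 6))
       ( inclusion (Alt 6)
       Vector.∷ compose (toGroup (Alt 6)) (toGroup (Alt 6)) (Sym 6) σ (inclusion (Alt 6))
       Vector.∷ Vector.[]) 6 8)

  -- (3)
  × ((H : Vector (Subgroup (AGL₂ 3) 0ℓ) 2) →
     ClassRepresentatives (Complement (Translations 3)) H →
     (ρ : Vector (PermRep (AGL₂ 3) 8) 2) → (∀ i → CosetAction (H i) (ρ i)) →
     Improves (AGL₂ 3) ρ 8 12)

  -- (4): the entries of I = ρ ∘ f are any four elements of {ρ₁, ρ₂, ρ₃, ρ₄}
  × ((H : Vector (Subgroup (Sym 6) 0ℓ) 4) →
     ClassRepresentatives (HasOrder 12) H →
     (ρ : Vector (PermRep (Sym 6) 60) 4) → (∀ i → CosetAction (H i) (ρ i)) →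
     ((f : Fin 4 → Fin 4) →
       ∃[ drep ] ∃[ dtw ]
         ( δrep≡ (Sym 6) (ρ ∘ f) drep × 176 ≤ drep × drep ≤ 192
         × δtw≡ (Sym 6) (ρ ∘ f) dtw × 176 ≤ dtw × dtw ≤ 224
         × (∀ i j → f i ≢ f j → drep < dtw)))
     × (Σ[ f ∈ (Fin 4 → Fin 4) ] δrep≡ (Sym 6) (ρ ∘ f) 176) × (Σ[ f ∈ (Fin 4 → Fin 4) ] δrep≡ (Sym 6) (ρ ∘ f) 192)
     × (Σ[ f ∈ (Fin 4 → Fin 4) ] δtw≡ (Sym 6) (ρ ∘ f) 176) × (Σ[ f ∈ (Fin 4 → Fin 4) ] δtw≡ (Sym 6) (ρ ∘ f) 224))
theorem1p1 c ℓ =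
  (λ q T r I → frequency {T = T} I , δrep≤δtw {T = T} I) ,
  (λ σ auto outer _ → outer-improves σ auto outer) ,
  (λ σ auto exceptional _ → exceptional-improves σ auto exceptional) ,
  affine-improves ,
  (λ H classes ρ actions →
    order-12-range H classes ρ actions ,
    δrep-176 H classes ρ actions , δrep-192 H classes ρ actions ,
    δtw-176 H classes ρ actions , δtw-224 H classes ρ actions)
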